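{- Let $m,n\ge 0$ be integers with $(m,n)\neq(0,1)$, and let $\mathcal{P}$ be the family of planar graphs. Then $3(2m+n)^2+(2m+n)+1\le \omega_{a(m,n)}(\mathcal{P})\le 9(2m+n)^2+2(2m+n)+2$.
   Context: An $(m,n)$-colored mixed graph has arcs colored with $m$ colors and edges colored with $n$ colors, with simple underlying undirected graph. A homomorphism $f:G\to H$ maps vertices to vertices so that every arc (resp. edge) $uv$ of color $c$ is sent to an arc (resp. edge) $f(u)f(v)$ of color $c$ (arcs keep direction). $\chi_{(m,n)}(G)$ is the minimum order of an $H$ with $G\to H$; $G$ is an $(m,n)$-clique if $\chi_{(m,n)}(G)=|V(G)|$. For an $(m,n)$-colored mixed graph $G$, $\omega_{a(m,n)}(G)$ is the maximum order of a subgraph of $G$ that is an $(m,n)$-clique. For an undirected simple graph $G$, $\omega_{a(m,n)}(G)$ is the maximum of this over all $(m,n)$-colored mixed graphs with underlying graph $G$, and for a family $\mathcal{F}$, $\omega_{a(m,n)}(\mathcal{F})$ is the maximum over $G\in\mathcal{F}$. -}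

module Defs where

open import Data.Nat using (ℕ; zero; suc; _+_; _*_; _<_; _<ᵇ_; _≤ᵇ_)
open import Data.Bool using (Bool; true; false; _∧_; _∨_; not; if_then_else_)
open import Data.Fin using (Fin; toℕ; _≟_)
open import Data.List using (List; upTo; map)
open import Data.Nat.ListAction using (sum)
open import Data.Bool.ListAction using (all; any)
open import Data.List using (allFin)
open import Data.Maybe using (Maybe; just; nothing; is-just)
import Data.Maybe as Maybe
open import Data.Product using (Σ; _×_; _,_; proj₁; proj₂)
open import Relation.Nullary using (¬_; does)
open import Relation.Binary.PropositionalEquality using (_≡_)
open import Function using (Injective)
open import Function.Base using (_∘_)

record Graph (N : ℕ) : Set where
  field
    adj   : Fin N → Fin N → Bool
    irrefl : ∀ u → adj u u ≡ false
    sym    : ∀ u v → adj u v ≡ adj v u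
open Graph public

-- Planarity, defined combinatorially: the graph admits a rotation system
-- (combinatorial embedding) of Euler genus 0.

iter : {A : Set} → (A → A) → ℕ → A → A
iter f zero    a = a
iter f (suc k) a = f (iter f k a)

count : {N : ℕ} → (Fin N → Bool) → ℕ
count p = sum (map (λ i → if p i then 1 else 0) (allFin _))

IsRotation : {N : ℕ} → Graph N → (Fin N → Fin N → Fin N) → Set
IsRotation {N} Γ ρ =
  (∀ u v → adj Γ u v ≡ true → adj Γ u (ρ u v) ≡ true) ×
  ((∀ u v w → adj Γ u v ≡ true → adj Γ u w ≡ true → ρ u v ≡ ρ u w → v ≡ w) ×
   (∀ u v w → adj Γ u v ≡ true → adj Γ u w ≡ true →
       Σ ℕ λ k → iter (ρ u) k v ≡ w))

module _ {N : ℕ} (Γ : Graph N) (ρ : Fin N → Fin N → Fin N) where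

  -- face-tracing permutation on darts (u,v)
  φ : Fin N × Fin N → Fin N × Fin N
  φ (u , v) = (v , ρ v u)

  code : Fin N × Fin N → ℕ
  code (u , v) = toℕ u * N + toℕ v

  isDart : Fin N × Fin N → Bool
  isDart (u , v) = adj Γ u v

  -- a dart is the representative of its face if it has the least code
  -- in its φ-orbit (orbits have length ≤ N*N)
  faceRep : Fin N × Fin N → Bool
  faceRep d = isDart d ∧ all (λ k → code d ≤ᵇ code (iter φ k d)) (upTo (N * N))

  numFaces : ℕ
  numFaces = sum (map (λ u → count (λ v → faceRep (u , v))) (allFin N))

darts : {N : ℕ} → Graph N → ℕ
darts {N} Γ = sum (map (λ u → count (λ v → adj Γ u v)) (allFin N))

reachIn : {N : ℕ} → Graph N → ℕ → Fin N → Fin N → Bool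
reachIn Γ zero    u v = does (u ≟ v)
reachIn Γ (suc k) u v =
  reachIn Γ k u v ∨ any (λ w → reachIn Γ k u w ∧ adj Γ w v) (allFin _)

reach : {N : ℕ} → Graph N → Fin N → Fin N → Bool
reach {N} Γ = reachIn Γ N

components : {N : ℕ} → Graph N → ℕ
components {N} Γ =
  count λ u → not (any (λ v → reach Γ u v ∧ (toℕ v <ᵇ toℕ u)) (allFin N))

isolated : {N : ℕ} → Graph N → ℕ
isolated {N} Γ = count λ u → not (any (λ v → adj Γ u v) (allFin N))

-- Planar: some rotation system has Euler characteristic 2 on every
-- component (isolated vertices contribute 1); summed over components:
-- N - E + F = 2c - i, written as 2N + 2F + 2i = 2E + 4c.
Planar : {N : ℕ} → Graph N → Set
Planar {N} Γ = Σ (Fin N → Fin N → Fin N) λ ρ →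
  IsRotation Γ ρ ×
  (2 * N + 2 * numFaces Γ ρ + 2 * isolated Γ ≡ darts Γ + 4 * components Γ)

-- label of an ordered pair (u,v): arc u→v of colour i, arc v→u of
-- colour i, or edge of colour j
data Lab (m n : ℕ) : Set where
  fwd  : Fin m → Lab m n
  bwd  : Fin m → Lab m n
  edge : Fin n → Lab m n

flipLab : {m n : ℕ} → Lab m n → Lab m n
flipLab (fwd i)  = bwd i
flipLab (bwd i)  = fwd i
flipLab (edge j) = edge j

record MixedGraph (m n N : ℕ) : Set where
  field
    lab      : Fin N → Fin N → Maybe (Lab m n)
    loopless : ∀ u → lab u u ≡ nothing
    labSym   : ∀ u v → lab v u ≡ Maybe.map flipLab (lab u v)
open MixedGraph public

Hom : {m n N K : ℕ} → MixedGraph m n N → MixedGraph m n K → Set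
Hom {N = N} {K} G H = Σ (Fin N → Fin K) λ f →
  ∀ u v l → lab G u v ≡ just l → lab H (f u) (f v) ≡ just l

-- χ_(m,n)(G) = |V(G)|: no homomorphism to a graph of smaller order
IsClique : {m n N : ℕ} → MixedGraph m n N → Set
IsClique {m} {n} {N} G = ∀ K → K < N → (H : MixedGraph m n K) → ¬ Hom G H

-- a subgraph of G of order k (given up to isomorphism by an injective
-- vertex map preserving all arcs/edges and their colours)
record Subgraph {m n N : ℕ} (G : MixedGraph m n N) (k : ℕ) : Set where
  field
    sub  : MixedGraph m n k
    ι    : Fin k → Fin N
    inj  : Injective _≡_ _≡_ ι
    pres : ∀ u v l → lab sub u v ≡ just l → lab G (ι u) (ι v) ≡ just l
open Subgraph public

HasUnderlying : {m n N : ℕ} → MixedGraph m n N → Graph N → Set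
HasUnderlying G Γ = ∀ u v → adj Γ u v ≡ is-just (lab G u v)

ωa≥ : (m n : ℕ) {N : ℕ} → Graph N → ℕ → Set
ωa≥ m n {N} Γ L = Σ (MixedGraph m n N) λ G → HasUnderlying G Γ ×
  Σ ℕ λ k → Σ (Subgraph G k) λ S → IsClique (sub S) × (L Data.Nat.≤ k)

ωa≤ : (m n : ℕ) {N : ℕ} → Graph N → ℕ → Set
ωa≤ m n {N} Γ U = (G : MixedGraph m n N) → HasUnderlying G Γ →
  ∀ k → (S : Subgraph G k) → IsClique (sub S) → k Data.Nat.≤ U

{-# OPTIONS --safe #-}
module Submission where

-- Write p = 2m + n.
--
-- Lower bound: p hubs, each joined to p paths of three vertices, and an apex joined to
-- everything.  The label at the apex tells the groups apart, the label at the hub tells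
-- the paths of a group apart, and the ends of a path are told apart by its middle vertex.
-- Inserting the vertices one by one into faces of a triangulation shows planarity.
--
-- Upper bound: in a clique any two vertices are adjacent or receive different labels from
-- a common neighbour.  Let S be a set of vertices with the same label at w.  If some y ≠ w
-- is adjacent to the rest of S, then |S| ≤ 4p + 1 (or S is tiny), since five vertices of S
-- with the same label at y would be linked among themselves.  If there is no such y, every
-- y ≠ w has at most four neighbours in S, for otherwise a K₃,₃-minor appears; contracting
-- the graph onto S ∪ {w} then leaves a vertex of S with at most three neighbours in S, and
-- |S| ≤ 10 follows.  Hence all classes are small, and counting the pairs of vertices
-- by the vertex that separates them, with the Euler bounds for edges and for edge cuts,
-- bounds the order.
--
-- Planarity is only used through Euler's inequality, which survives the contraction of
-- an edge of a plane multigraph.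

import Defs
open import Defs using
  ( Graph; adj; irrefl; IsRotation; Planar; iter; reach; reachIn; darts; components; isolated; numFaces; faceRep
  ; Lab; fwd; bwd; edge; flipLab; MixedGraph; lab; labSym; Hom; IsClique; Subgraph; HasUnderlying; ωa≤; ωa≥ )
import Algebra.Properties.Semiring.Sum as Sum
open import Data.Bool using (Bool; true; false; _∧_; _∨_; _xor_; not; if_then_else_) renaming (_≟_ to _≟ᵇ_; T to IsTrue)
open import Data.Bool.ListAction using (any; all)
open import Data.Bool.Properties using (∨-zeroʳ; ∧-zeroʳ)
open import Data.Empty using (⊥; ⊥-elim)
open import Data.Fin using (Fin; zero; suc; toℕ; _≟_; join; splitAt; punchIn; punchOut; combine; remQuot; fromℕ<; _↑ˡ_; _↑ʳ_)
open import Data.Fin.Properties using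
  ( any?; all?; suc-injective; toℕ-injective; toℕ<n; toℕ-combine; remQuot-combine; combine-remQuot; pigeonhole
  ; fromℕ<-injective; join-splitAt; splitAt-↑ˡ; splitAt-↑ʳ; splitAt⁻¹-↑ˡ; splitAt⁻¹-↑ʳ
  ; punchIn-injective; punchIn-punchOut; punchInᵢ≢i )
open import Data.List using (List; []; _∷_; map; allFin; upTo; tabulate; length)
open import Data.List.Membership.Propositional using (_∈_)
open import Data.List.Membership.Propositional.Properties using (∈-allFin; ∈-upTo⁺)
open import Data.List.Properties using (map-tabulate; length-tabulate)
open import Data.List.Relation.Unary.All using (All; []; _∷_)
import Data.List.Relation.Unary.All.Properties as All
open import Data.List.Relation.Unary.Any using (here; there)
open import Data.List.Relation.Unary.Unique.Propositional using (Unique; []; _∷_)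
import Data.List.Relation.Unary.Unique.Propositional.Properties as Unique
open import Data.Maybe using (Maybe; just; nothing; is-just; _<∣>_)
import Data.Maybe as Maybe
open import Data.Maybe.Properties using (just-injective)
import Data.Maybe.Properties as Maybe
open import Data.Nat using (ℕ; zero; suc; _+_; _*_; _∸_; _^_; _≤_; _<_; z≤n; s≤s; s≤s⁻¹; _≤?_; _<?_; _≤ᵇ_; _<ᵇ_; >-nonZero) renaming (_≟_ to _≟ℕ_)
open import Data.Nat.DivMod using (_%_; _/_; m≡m%n+[m/n]*n; m%n<n)
open import Data.Nat.Induction using (<-wellFounded)
open import Data.Nat.ListAction using (sum)
open import Data.Nat.Properties hiding (_≟_; suc-injective; _≤?_; _<?_)
open import Data.Nat.Solver using (module +-*-Solver)
open import Data.Product using (Σ; _×_; _,_; proj₁; proj₂; ∃)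
open import Data.Sum using (_⊎_; inj₁; inj₂; [_,_]′)
open import Data.Vec using ([]; _∷_; lookup)
open import Function using (_∘_; Injective)
open import Induction.WellFounded using (Acc; acc)
open import Relation.Binary.Definitions using (tri<; tri≈; tri>)
open import Relation.Binary.PropositionalEquality
open import Relation.Nullary using (¬_; Dec; yes; no; does; contradiction)
open import Relation.Nullary.Decidable using (dec-true; dec-false; _×-dec_; _→-dec_; ¬?)

open +-*-Solver using (solve; con; _:+_; _:*_; _:=_)

-- Finite sums and counts

-- Let k be the order, d a degree and σ a bound on the classes. By Cauchy's inequality over its p
-- classes a vertex separates at most (1 - 1/p) d² ordered pairs. Degrees may reach pσ, so only the
-- excess of d over 6 is multiplied by pσ: the cut bound limits the total excess to 2k - 4, whereas
-- the total degree may be close to 6k. This gives roughly k ≤ 2(p - 1)σ, about 8p² for σ = 4p + 1,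
-- which leaves room when p ≥ 3. For p = 2 the undominated classes force σ = 10, and 42 is reached
-- only because the additive constants 12 and 4 of the Euler bounds are kept. The case p = 1 is the
-- excluded pair (0,1), and p = 0 has no labels.
--
-- The topological obstacle is that planarity is an equation for simple, possibly disconnected
-- graphs, while contraction creates parallel edges and Euler's inequality wants connectedness.

⟦_⟧ : Bool → ℕ
⟦ b ⟧ = if b then 1 else 0

⟦_⟧≤1 : ∀ b → ⟦ b ⟧ ≤ 1
⟦ true ⟧≤1 = ≤-refl
⟦ false ⟧≤1 = z≤n

opaque

  -- Opaque, so that unification can read the summand off a sum.
  ∑ : ∀ {n} → (Fin n → ℕ) → ℕ
  ∑ = Sum.sum +-*-semiring

  ∑-empty : (f : Fin 0 → ℕ) → ∑ f ≡ 0
  ∑-empty f = refl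

  ∑-suc : ∀ {n} (f : Fin (suc n) → ℕ) → ∑ f ≡ f zero + ∑ (λ i → f (suc i))
  ∑-suc f = refl

  ∑-cong : ∀ {n} {f g : Fin n → ℕ} → (∀ i → f i ≡ g i) → ∑ f ≡ ∑ g
  ∑-cong = Sum.sum-cong-≗ +-*-semiring

  ∑-distrib-+ : ∀ {n} (f g : Fin n → ℕ) → ∑ (λ i → f i + g i) ≡ ∑ f + ∑ g
  ∑-distrib-+ = Sum.∑-distrib-+ +-*-semiring

  ∑-comm : ∀ {m n} (f : Fin m → Fin n → ℕ) → ∑ (λ i → ∑ (λ j → f i j)) ≡ ∑ (λ j → ∑ (λ i → f i j))
  ∑-comm = Sum.∑-comm +-*-semiring

  *-distribˡ-∑ : ∀ {n} c (f : Fin n → ℕ) → c * ∑ f ≡ ∑ (λ i → c * f i)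
  *-distribˡ-∑ = Sum.*-distribˡ-sum +-*-semiring

  ∑-mono : ∀ {n} {f g : Fin n → ℕ} → (∀ i → f i ≤ g i) → ∑ f ≤ ∑ g
  ∑-mono {zero} h = z≤n
  ∑-mono {suc n} h = +-mono-≤ (h zero) (∑-mono (λ i → h (suc i)))

  ∑-const : ∀ n c → ∑ {n} (λ _ → c) ≡ n * c
  ∑-const zero c = refl
  ∑-const (suc n) c = cong (c +_) (∑-const n c)

# : ∀ {n} → (Fin n → Bool) → ℕ
# P = ∑ (λ i → ⟦ P i ⟧)

∑-≤-const : ∀ {n} {f : Fin n → ℕ} c → (∀ i → f i ≤ c) → ∑ f ≤ n * c
∑-≤-const {n} c h = ≤-trans (∑-mono h) (≤-reflexive (∑-const n c))

∑-zero : ∀ {n} {f : Fin n → ℕ} → (∀ i → f i ≡ 0) → ∑ f ≡ 0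
∑-zero {n} h = trans (∑-cong h) (trans (∑-const n 0) (*-zeroʳ n))

only : ∀ {n} → Fin n → (Fin n → ℕ) → Fin n → ℕ
only a f i = if does (i ≟ a) then f i else 0

except : ∀ {n} → Fin n → (Fin n → ℕ) → Fin n → ℕ
except a f i = if does (i ≟ a) then 0 else f i

≟-suc : ∀ {n} (i a : Fin n) → does (suc i ≟ suc a) ≡ does (i ≟ a)
≟-suc i a with i ≟ a
... | yes _ = refl
... | no _ = refl

∑-only : ∀ {n} (a : Fin n) f → ∑ (only a f) ≡ f a
∑-only zero f = trans (∑-suc _) (trans (cong (f zero +_) (∑-zero (λ i → refl))) (+-identityʳ _))
∑-only (suc a) f = trans (∑-suc _) (trans (∑-cong (λ i → cong (λ b → if b then f (suc i) else 0) (≟-suc i a))) (∑-only a (f ∘ suc)))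

∑-extract : ∀ {n} (a : Fin n) f → ∑ f ≡ f a + ∑ (except a f)
∑-extract a f = trans (∑-cong split) (trans (∑-distrib-+ (only a f) (except a f)) (cong (_+ ∑ (except a f)) (∑-only a f)))
  where
  split : ∀ i → f i ≡ only a f i + except a f i
  split i with does (i ≟ a)
  ... | true = sym (+-identityʳ _)
  ... | false = refl

term≤∑ : ∀ {n} (f : Fin n → ℕ) a → f a ≤ ∑ f
term≤∑ f a = ≤-trans (m≤m+n _ _) (≤-reflexive (sym (∑-extract a f)))

except-≢ : ∀ {n} {a i : Fin n} f → i ≢ a → except a f i ≡ f i
except-≢ {a = a} {i} f ne rewrite dec-false (i ≟ a) ne = refl

∑-injective : ∀ {m n} (w : Fin n → ℕ) (j : Fin m → Fin n) → Injective _≡_ _≡_ j → ∑ (w ∘ j) ≤ ∑ w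
∑-injective {zero} w j inj = ≤-trans (≤-reflexive (∑-empty _)) z≤n
∑-injective {suc m} w j inj = begin
  ∑ (w ∘ j)                                       ≡⟨ ∑-suc _ ⟩
  w (j zero) + ∑ (w ∘ j ∘ suc)                    ≡⟨ cong (w (j zero) +_) (∑-cong (λ i → sym (except-≢ w (λ e → contradiction (inj e) λ ())))) ⟩
  w (j zero) + ∑ (except (j zero) w ∘ j ∘ suc)    ≤⟨ +-monoʳ-≤ (w (j zero)) (∑-injective (except (j zero) w) (j ∘ suc) (λ e → suc-injective (inj e))) ⟩
  w (j zero) + ∑ (except (j zero) w)              ≡⟨ sym (∑-extract (j zero) w) ⟩
  ∑ w ∎
  where open ≤-Reasoning

opaque

  remove : ∀ {n} → Fin n → (Fin n → Bool) → Fin n → Bool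
  remove a P i = if does (i ≟ a) then false else P i

  remove-intro : ∀ {n} {a i : Fin n} {P} → i ≢ a → P i ≡ true → remove a P i ≡ true
  remove-intro {a = a} {i} ne p rewrite dec-false (i ≟ a) ne = p

  remove-elim : ∀ {n} {a i : Fin n} {P} → remove a P i ≡ true → i ≢ a × P i ≡ true
  remove-elim {a = a} {i} p with i ≟ a
  ... | no ne = ne , p

  #-split : ∀ {n} {a : Fin n} {P} → # P ≡ ⟦ P a ⟧ + # (remove a P)
  #-split {a = a} {P} = trans (∑-extract a (λ i → ⟦ P i ⟧)) (cong (⟦ P a ⟧ +_) (∑-cong same))
    where
    same : ∀ i → except a (λ i → ⟦ P i ⟧) i ≡ ⟦ remove a P i ⟧
    same i with does (i ≟ a)
    ... | true = refl
    ... | false = refl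

#-remove : ∀ {n} {a : Fin n} {P} → P a ≡ true → # P ≡ suc (# (remove a P))
#-remove {a = a} {P} p = trans #-split (cong (λ b → ⟦ b ⟧ + # (remove a P)) p)

#-remove-≤ : ∀ {n} {a : Fin n} {P} → # P ≤ suc (# (remove a P))
#-remove-≤ {a = a} {P} = ≤-trans (≤-reflexive #-split) (+-monoˡ-≤ (# (remove a P)) ⟦ P a ⟧≤1)

#-mono : ∀ {n} {P Q : Fin n → Bool} → (∀ i → P i ≡ true → Q i ≡ true) → # P ≤ # Q
#-mono {P = P} {Q} h = ∑-mono le
  where
  le : ∀ i → ⟦ P i ⟧ ≤ ⟦ Q i ⟧
  le i with P i | h i
  ... | false | _ = z≤n
  ... | true | q rewrite q refl = ≤-refl

≤-#-of-injection : ∀ {m n} {P : Fin n → Bool} (j : Fin m → Fin n) → Injective _≡_ _≡_ j → (∀ i → P (j i) ≡ true) → m ≤ # P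
≤-#-of-injection {m} {P = P} j inj h = begin
  m                      ≡⟨ sym (*-identityʳ m) ⟩
  m * 1                  ≡⟨ sym (∑-const m 1) ⟩
  ∑ {m} (λ _ → 1)        ≡⟨ ∑-cong (λ i → cong ⟦_⟧ (sym (h i))) ⟩
  ∑ (λ i → ⟦ P (j i) ⟧)  ≤⟨ ∑-injective (λ i → ⟦ P i ⟧) j inj ⟩
  # P ∎
  where open ≤-Reasoning

pick : ∀ {n} (P : Fin n → Bool) m → m ≤ # P →
       Σ (Fin m → Fin n) λ j → Injective _≡_ _≡_ j × (∀ i → P (j i) ≡ true)
pick P zero _ = (λ ()) , (λ { {()} }) , λ ()
pick {zero} P (suc m) le = contradiction (≤-trans le (≤-reflexive (∑-empty _))) λ ()
pick {suc n} P (suc m) le with P zero in eq | ≤-trans le (≤-reflexive (∑-suc (λ i → ⟦ P i ⟧)))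
... | false | le' with pick (P ∘ suc) (suc m) le'
...   | j , inj , h = suc ∘ j , (λ e → inj (suc-injective e)) , h
pick {suc n} P (suc m) le | true | le' with pick (P ∘ suc) m (s≤s⁻¹ le')
... | j , inj , h = j' , inj' , h'
  where
  j' : Fin (suc m) → Fin (suc n)
  j' zero = zero
  j' (suc i) = suc (j i)
  inj' : Injective _≡_ _≡_ j'
  inj' {zero} {zero} _ = refl
  inj' {suc x} {suc y} e = cong suc (inj (suc-injective e))
  h' : ∀ i → P (j' i) ≡ true
  h' zero = eq
  h' (suc i) = h i

true≢false : ∀ {b : Bool} → b ≡ true → b ≡ false → ⊥
true≢false refl ()

∧-intro : ∀ {a b} → a ≡ true → b ≡ true → a ∧ b ≡ true
∧-intro refl refl = refl

∧-elim : ∀ {a b} → a ∧ b ≡ true → a ≡ true × b ≡ true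
∧-elim {true} {true} _ = refl , refl

#-exists : ∀ {n} {P Q : Fin n → Bool} → # Q < # P → ∃ λ i → P i ≡ true × Q i ≡ false
#-exists {P = P} {Q} lt with any? (λ i → (P i ∧ not (Q i)) ≟ᵇ true)
... | no none = contradiction lt (≤⇒≯ (#-mono P⊆Q))
  where
  P⊆Q : ∀ i → P i ≡ true → Q i ≡ true
  P⊆Q i p with Q i in q
  ... | true = refl
  ... | false = contradiction (i , ∧-intro p (cong not q)) none
... | yes (i , e) with Q i in q
...   | true = contradiction (proj₂ (∧-elim {P i} e)) λ ()
...   | false = i , proj₁ (∧-elim e) , q

does⇒ : ∀ {a} {A : Set a} (d : Dec A) → does d ≡ true → A
does⇒ (yes p) _ = p

not-true : ∀ {b} → not b ≡ true → b ≡ false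
not-true {false} _ = refl

not-false : ∀ {b} → not b ≡ false → b ≡ true
not-false {true} _ = refl

T⇒≡ : ∀ {b} → IsTrue b → b ≡ true
T⇒≡ {true} _ = refl

#-≤2 : ∀ {n} {P : Fin n → Bool} {a b} → (∀ {v} → P v ≡ true → v ≡ a ⊎ v ≡ b) → # P ≤ 2
#-≤2 {P = P} {a} {b} h = begin
  # P                               ≤⟨ #-remove-≤ {a = a} ⟩
  suc (# (remove a P))              ≤⟨ s≤s (#-remove-≤ {a = b}) ⟩
  2 + # (remove b (remove a P))     ≡⟨ cong (2 +_) (∑-zero none) ⟩
  2 ∎
  where
  open ≤-Reasoning
  none : ∀ v → ⟦ remove b (remove a P) v ⟧ ≡ 0
  none v with remove b (remove a P) v in eq
  ... | false = refl
  ... | true with remove-elim {P = remove a P} eq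
  ...   | v≢b , r with remove-elim r
  ...     | v≢a , p with h p
  ...       | inj₁ e = contradiction e v≢a
  ...       | inj₂ e = contradiction e v≢b

∑∑ : ∀ {m n} → (Fin m → Fin n → ℕ) → ℕ
∑∑ f = ∑ (λ i → ∑ (λ j → f i j))

∑∑-distrib-+ : ∀ {m n} (f g : Fin m → Fin n → ℕ) → ∑∑ (λ i j → f i j + g i j) ≡ ∑∑ f + ∑∑ g
∑∑-distrib-+ f g = trans (∑-cong (λ i → ∑-distrib-+ (f i) (g i))) (∑-distrib-+ _ _)

∑∑-product : ∀ {n} (f : Fin n → ℕ) → ∑∑ (λ i j → f i * f j) ≡ ∑ f * ∑ f
∑∑-product f = trans (∑-cong (λ i → trans (sym (*-distribˡ-∑ (f i) f)) (*-comm (f i) (∑ f)))) (sym (*-distribˡ-∑ (∑ f) f))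

δ : ∀ {n} → Fin n → Fin n → ℕ
δ u v = ⟦ does (u ≟ v) ⟧

δ-refl : ∀ {n} (u : Fin n) → δ u u ≡ 1
δ-refl u rewrite dec-true (u ≟ u) refl = refl

∑-δ* : ∀ {n} (u : Fin n) c → ∑ (λ v → δ u v * c) ≡ c
∑-δ* u c = trans (∑-cong swap) (∑-only u (λ _ → c))
  where
  swap : ∀ v → δ u v * c ≡ only u (λ _ → c) v
  swap v with u ≟ v | v ≟ u
  ... | yes _ | yes _ = +-identityʳ c
  ... | no _ | no _ = refl
  ... | yes e | no ne = contradiction (sym e) ne
  ... | no ne | yes e = contradiction (sym e) ne

∑-δ : ∀ {n} (u : Fin n) → ∑ (δ u) ≡ 1
∑-δ u = trans (∑-cong (λ v → sym (*-identityʳ (δ u v)))) (∑-δ* u 1)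

-- Plane multigraphs

opaque

  -- Used in three ways: to bypass a dart in a face walk, to merge two face labels, and to merge two
  -- vertices.
  redirect : ∀ {n} → Fin n → Fin n → Fin n → Fin n
  redirect d e x = if does (x ≟ d) then e else x

  redirect-≡ : ∀ {n} (d e : Fin n) → redirect d e d ≡ e
  redirect-≡ d e rewrite dec-true (d ≟ d) refl = refl

  redirect-≢ : ∀ {n} {d e x : Fin n} → x ≢ d → redirect d e x ≡ x
  redirect-≢ {d = d} {e} {x} ne rewrite dec-false (x ≟ d) ne = refl

redirect-elim : ∀ {n ℓ} {d e x : Fin n} (P : Fin n → Set ℓ) → (x ≡ d → P e) → (x ≢ d → P x) → P (redirect d e x)
redirect-elim {d = d} {e} {x} P y n with x ≟ d
... | yes refl = subst P (sym (redirect-≡ x e)) (y refl)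
... | no ne = subst P (sym (redirect-≢ ne)) (n ne)

module Darts {m : ℕ} (α : Fin m → Fin m) (α-involutive : ∀ x → α (α x) ≡ x) where

  -- A loopless multigraph with a face-tracing map φ on its darts.  Face labels are
  -- constant along φ, so that the number of labels is at most the number of faces.
  -- The map σ = φ ∘ α turns around a vertex: vtx says that a set of darts closed under
  -- σ contains all or none of the darts at each vertex.
  record Map {n} (lv : Fin n → Bool) : Set₁ where
    field
      live : Fin m → Bool
      src  : Fin m → Fin n
      φ    : Fin m → Fin m
      fc   : Fin m → Fin m
      fr   : Fin m → Bool
      live-α   : ∀ {x} → live x ≡ true → live (α x) ≡ true
      live-φ   : ∀ {x} → live x ≡ true → live (φ x) ≡ true
      src-φ    : ∀ {x} → live x ≡ true → src (φ x) ≡ src (α x)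
      loopless : ∀ {x} → live x ≡ true → src x ≢ src (α x)
      fc-φ     : ∀ {x} → live x ≡ true → fc (φ x) ≡ fc x
      fr-fc    : ∀ {x} → live x ≡ true → fr (fc x) ≡ true
      fr-onto  : ∀ {l} → fr l ≡ true → ∃ λ x → live x ≡ true × fc x ≡ l
      lv-src   : ∀ {x} → live x ≡ true → lv (src x) ≡ true
      vtx      : (P : Fin m → Set) → (∀ {x} → live x ≡ true → P x → P (φ (α x))) →
                 ∀ {x y} → live x ≡ true → live y ≡ true → src x ≡ src y → P x → P y

    Adj : Fin n → Fin n → Set
    Adj u v = ∃ λ x → live x ≡ true × src x ≡ u × src (α x) ≡ v

  -- Connectedness, like `vtx`, is an induction principle, which passes through deletion and
  -- contraction without any walks being constructed. Since `# live` counts every edge twice,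
  -- `euler` is V - E + F ≥ 2 doubled; being an inequality, it tolerates labels that are shared by
  -- several faces.
  record Sphere {n} (lv : Fin n → Bool) : Set₁ where
    field
      shape : Map lv
    open Map shape public
    field
      conn  : (P : Fin n → Set) → (∀ {x} → live x ≡ true → P (src x) → P (src (α x))) →
              ∀ {u v} → lv u ≡ true → lv v ≡ true → P u → P v
      euler : # live + 4 ≤ 2 * # lv + 2 * # fr

  α-≢ : ∀ {x d} → x ≢ α d → α x ≢ d
  α-≢ ne e = ne (trans (sym (α-involutive _)) (cong α e))

  α-≢′ : ∀ {x d} → x ≢ d → α x ≢ α d
  α-≢′ ne e = ne (trans (sym (α-involutive _)) (trans (cong α e) (α-involutive _)))

  module RemoveEdge {n} {lv : Fin n → Bool} (S : Sphere lv) (d : Fin m) (ld : Map.live (Sphere.shape S) d ≡ true) where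
    open Sphere S

    d̄ = α d
    ld̄ = live-α ld

    d≢d̄ : d ≢ d̄
    d≢d̄ e = loopless ld (cong src e)

    live⁻ : Fin m → Bool
    live⁻ = remove d (remove d̄ live)

    live⁻-intro : ∀ {x} → x ≢ d → x ≢ d̄ → live x ≡ true → live⁻ x ≡ true
    live⁻-intro ne ne' l = remove-intro ne (remove-intro ne' l)

    live⁻-elim : ∀ {x} → live⁻ x ≡ true → x ≢ d × x ≢ d̄ × live x ≡ true
    live⁻-elim l = proj₁ (remove-elim l) , remove-elim (proj₂ (remove-elim l))

    live⁻-α : ∀ {x} → live⁻ x ≡ true → live⁻ (α x) ≡ true
    live⁻-α l with live⁻-elim l
    ... | ne , ne' , lx = live⁻-intro (α-≢ ne') (α-≢′ ne) (live-α lx)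

    #live⁻ : # live ≡ suc (suc (# live⁻))
    #live⁻ = trans (#-remove ld̄) (cong suc (#-remove (remove-intro d≢d̄ ld)))

    src-φ-α : ∀ {x} → live x ≡ true → src (φ (α x)) ≡ src x
    src-φ-α {x} l = trans (src-φ (live-α l)) (cong src (α-involutive x))

    φd̄-src : src (φ d̄) ≡ src d
    φd̄-src = src-φ-α ld

    φd-src : src (φ d) ≡ src d̄
    φd-src = src-φ ld

    φ-≢ : ∀ {x} → live x ≡ true → φ x ≢ x
    φ-≢ l e = loopless l (trans (sym (cong src e)) (src-φ l))

  -- Removing an edge that has a parallel edge merges the two face labels at it.
  module Delete {n} {lv : Fin n → Bool} (S : Sphere lv) (d : Fin m) (ld : Map.live (Sphere.shape S) d ≡ true)
    (e : Fin m) (le : Map.live (Sphere.shape S) e ≡ true) (e≢d : e ≢ d)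
    (se : Map.src (Sphere.shape S) e ≡ Map.src (Sphere.shape S) d)
    (te : Map.src (Sphere.shape S) (α e) ≡ Map.src (Sphere.shape S) (α d)) where
    open Sphere S
    open RemoveEdge S d ld

    φd̄≢d : φ d̄ ≢ d
    φd̄≢d eq = e≢d (vtx (λ x → x ≡ d) (λ { _ refl → eq }) ld le (sym se) refl)

    φd̄≢d̄ : φ d̄ ≢ d̄
    φd̄≢d̄ = φ-≢ ld̄

    φd≢d : φ d ≢ d
    φd≢d = φ-≢ ld

    φd≢d̄ : φ d ≢ d̄
    φd≢d̄ eq = α-≢′ e≢d (vtx (λ x → x ≡ d̄) (λ { _ refl → trans (cong φ (α-involutive d)) eq }) ld̄ (live-α le) (sym te) refl)

    -- A walk about to enter `d` continues with the next dart around its source, which is `φ d̄`;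
    -- likewise for `d̄`. The parallel edge ensures that there is another dart: if the rotation
    -- fixed `d`, then by `vtx` the dart `e` could not start at the same vertex.
    φ⁻ : Fin m → Fin m
    φ⁻ x = redirect d̄ (φ d) (redirect d (φ d̄) (φ x))

    φ⁻-elim : ∀ {ℓ} {x} (P : Fin m → Set ℓ) → (φ x ≡ d → P (φ d̄)) → (φ x ≡ d̄ → P (φ d)) →
              (φ x ≢ d → φ x ≢ d̄ → P (φ x)) → P (φ⁻ x)
    φ⁻-elim {x = x} P p q r = redirect-elim (λ y → P (redirect d̄ (φ d) y))
      (λ eq → redirect-elim P (λ eq' → contradiction eq' φd̄≢d̄) (λ _ → p eq))
      (λ ne → redirect-elim P q (r ne))

    l₁ = fc d
    l₂ = fc d̄

    fc⁻ : Fin m → Fin m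
    fc⁻ x = redirect l₂ l₁ (fc x)

    fr⁻ : Fin m → Bool
    fr⁻ l = if does (l₁ ≟ l₂) then fr l else remove l₂ fr l

    fc⁻-l₁ : ∀ {x} → fc x ≡ l₁ → fc⁻ x ≡ l₁
    fc⁻-l₁ e = redirect-elim (_≡ l₁) (λ _ → refl) (λ _ → e)

    fc⁻-l₂ : ∀ {x} → fc x ≡ l₂ → fc⁻ x ≡ l₁
    fc⁻-l₂ e = trans (cong (redirect l₂ l₁) e) (redirect-≡ l₂ l₁)

    fr⁻-fc : ∀ {x} → live x ≡ true → fr⁻ (fc⁻ x) ≡ true
    fr⁻-fc {x} l with l₁ ≟ l₂
    ... | yes _ = redirect-elim (λ y → fr y ≡ true) (λ _ → fr-fc ld) (λ _ → fr-fc l)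
    ... | no ne = redirect-elim (λ y → remove l₂ fr y ≡ true) (λ _ → remove-intro ne (fr-fc ld)) (λ ne' → remove-intro ne' (fr-fc l))

    fr⁻-elim : ∀ {l} → fr⁻ l ≡ true → fr l ≡ true × (l ≡ l₂ → l₁ ≡ l₂)
    fr⁻-elim p with l₁ ≟ l₂
    ... | yes e = p , (λ _ → e)
    ... | no ne with remove-elim p
    ...   | ne' , q = q , (λ e → contradiction e ne')

    #fr⁻ : # fr ≤ suc (# fr⁻)
    #fr⁻ with l₁ ≟ l₂
    ... | yes e = n≤1+n _
    ... | no ne = #-remove-≤

    φd̄-live : live⁻ (φ d̄) ≡ true
    φd̄-live = live⁻-intro φd̄≢d φd̄≢d̄ (live-φ ld̄)

    fr⁻-onto : ∀ {l} → fr⁻ l ≡ true → ∃ λ x → live⁻ x ≡ true × fc⁻ x ≡ l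
    fr⁻-onto {l} p with fr⁻-elim p
    ... | q , h with fr-onto q
    ...   | x , lx , refl with x ≟ d | x ≟ d̄
    ...     | yes refl | _ = φ d̄ , φd̄-live , fc⁻-l₂ (fc-φ ld̄)
    ...     | no _ | yes refl = φ d̄ , φd̄-live , trans (fc⁻-l₂ (fc-φ ld̄)) (h refl)
    ...     | no ne | no ne' = x , live⁻-intro ne ne' lx , redirect-elim (_≡ fc x) (λ e → trans (h e) (sym e)) (λ _ → refl)

    -- The old principle is applied to the predicate that reads `P` at a representative of `z`,
    -- where each removed dart is represented by its successor in the rotation.
    vtx⁻ : (P : Fin m → Set) → (∀ {x} → live⁻ x ≡ true → P x → P (φ⁻ (α x))) →
           ∀ {x y} → live⁻ x ≡ true → live⁻ y ≡ true → src x ≡ src y → P x → P y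
    vtx⁻ P closed {x} {y} lx ly s p = Q⇒P ly (vtx Q Q-closed (proj₂ (proj₂ (live⁻-elim lx))) (proj₂ (proj₂ (live⁻-elim ly))) s (P⇒Q lx p))
      where
      Q : Fin m → Set
      Q z = P (redirect d̄ (φ d) (redirect d (φ d̄) z))
      Q-fix : ∀ {z} → z ≢ d → z ≢ d̄ → redirect d̄ (φ d) (redirect d (φ d̄) z) ≡ z
      Q-fix ne ne' = trans (cong (redirect d̄ (φ d)) (redirect-≢ ne)) (redirect-≢ ne')
      Q⇒P : ∀ {z} → live⁻ z ≡ true → Q z → P z
      Q⇒P l q with live⁻-elim l
      ... | ne , ne' , _ = subst P (Q-fix ne ne') q
      P⇒Q : ∀ {z} → live⁻ z ≡ true → P z → Q z
      P⇒Q l q with live⁻-elim l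
      ... | ne , ne' , _ = subst P (sym (Q-fix ne ne')) q
      Qd : Q d → P (φ d̄)
      Qd = subst P (trans (cong (redirect d̄ (φ d)) (redirect-≡ d _)) (redirect-≢ φd̄≢d̄))
      Qd̄ : Q d̄ → P (φ d)
      Qd̄ = subst P (trans (cong (redirect d̄ (φ d)) (redirect-≢ (λ e → d≢d̄ (sym e)))) (redirect-≡ d̄ _))
      Q-closed : ∀ {z} → live z ≡ true → Q z → Q (φ (α z))
      Q-closed {z} l q = cases (z ≟ d) (z ≟ d̄)
        where
        cases : Dec (z ≡ d) → Dec (z ≡ d̄) → Q (φ (α z))
        cases (yes eq) _ = subst (λ w → Q (φ (α w))) (sym eq) (P⇒Q φd̄-live (Qd (subst Q eq q)))
        cases (no _) (yes eq) = subst Q (sym (cong φ (trans (cong α eq) (α-involutive d))))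
                                  (P⇒Q (live⁻-intro φd≢d φd≢d̄ (live-φ ld)) (Qd̄ (subst Q eq q)))
        cases (no ne) (no ne') = closed (live⁻-intro ne ne' l) (Q⇒P (live⁻-intro ne ne' l) q)

    conn⁻ : (P : Fin n → Set) → (∀ {x} → live⁻ x ≡ true → P (src x) → P (src (α x))) →
            ∀ {u v} → lv u ≡ true → lv v ≡ true → P u → P v
    conn⁻ P closed = conn P closed'
      where
      le⁻ : live⁻ e ≡ true
      le⁻ = live⁻-intro e≢d (λ eq → loopless ld (trans (sym se) (cong src eq))) le
      closed' : ∀ {x} → live x ≡ true → P (src x) → P (src (α x))
      closed' {x} l p with x ≟ d | x ≟ d̄
      ... | yes refl | _ = subst P te (closed le⁻ (subst P (sym se) p))
      ... | no _ | yes refl = subst P (trans (cong src (α-involutive e)) (trans se (sym (cong src (α-involutive d)))))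
                                (closed (live⁻-α le⁻) (subst P (sym te) p))
      ... | no ne | no ne' = closed (live⁻-intro ne ne' l) p

    map⁻ : Map lv
    map⁻ = record
      { live = live⁻ ; src = src ; φ = φ⁻ ; fc = fc⁻ ; fr = fr⁻
      ; live-α = live⁻-α
      ; live-φ = λ {x} l → let lx = proj₂ (proj₂ (live⁻-elim l)) in
          φ⁻-elim {x = x} (λ y → live⁻ y ≡ true) (λ _ → φd̄-live) (λ _ → live⁻-intro φd≢d φd≢d̄ (live-φ ld))
            (λ ne ne' → live⁻-intro ne ne' (live-φ lx))
      ; src-φ = λ {x} l → let lx = proj₂ (proj₂ (live⁻-elim l)) in
          φ⁻-elim {x = x} (λ y → src y ≡ src (α x))
            (λ eq → trans φd̄-src (trans (sym (cong src eq)) (src-φ lx)))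
            (λ eq → trans φd-src (trans (sym (cong src eq)) (src-φ lx)))
            (λ _ _ → src-φ lx)
      ; loopless = λ l → loopless (proj₂ (proj₂ (live⁻-elim l)))
      ; fc-φ = λ {x} l → let lx = proj₂ (proj₂ (live⁻-elim l)) in
          φ⁻-elim {x = x} (λ y → fc⁻ y ≡ fc⁻ x)
            (λ eq → trans (fc⁻-l₂ (fc-φ ld̄)) (sym (fc⁻-l₁ {x} (trans (sym (fc-φ lx)) (cong fc eq)))))
            (λ eq → trans (fc⁻-l₁ (fc-φ ld)) (sym (fc⁻-l₂ {x} (trans (sym (fc-φ lx)) (cong fc eq)))))
            (λ _ _ → cong (redirect l₂ l₁) (fc-φ lx))
      ; fr-fc = λ l → fr⁻-fc (proj₂ (proj₂ (live⁻-elim l)))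
      ; fr-onto = fr⁻-onto
      ; lv-src = λ l → lv-src (proj₂ (proj₂ (live⁻-elim l)))
      ; vtx = vtx⁻
      }

    result : Sphere lv
    result = record { shape = map⁻ ; conn = conn⁻ ; euler = eul }
      where
      open ≤-Reasoning
      eul : # live⁻ + 4 ≤ 2 * # lv + 2 * # fr⁻
      eul = s≤s⁻¹ (s≤s⁻¹ (begin
        suc (suc (# live⁻)) + 4 ≡⟨ cong (_+ 4) (sym #live⁻) ⟩
        # live + 4 ≤⟨ euler ⟩
        2 * # lv + 2 * # fr ≤⟨ +-monoʳ-≤ (2 * # lv) (*-monoʳ-≤ 2 #fr⁻) ⟩
        2 * # lv + 2 * suc (# fr⁻) ≡⟨ cong (2 * # lv +_) (*-suc 2 (# fr⁻)) ⟩
        2 * # lv + (2 + 2 * # fr⁻) ≡⟨ +-assoc (2 * # lv) 2 _ ⟨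
        (2 * # lv + 2) + 2 * # fr⁻ ≡⟨ cong (_+ 2 * # fr⁻) (+-comm (2 * # lv) 2) ⟩
        suc (suc (2 * # lv + 2 * # fr⁻)) ∎))

module Contraction {m : ℕ} (α : Fin m → Fin m) (α-involutive : ∀ x → α (α x) ≡ x) where
  open Darts α α-involutive

  -- Contracting d moves the darts of z = src d to a = src (α d); faces keep their labels.
  module Contract {n} {lv : Fin n → Bool} (S : Sphere lv) (d : Fin m) (ld : Map.live (Sphere.shape S) d ≡ true)
    (three : 3 ≤ # lv)
    (unique : ∀ {e} → Map.live (Sphere.shape S) e ≡ true → Map.src (Sphere.shape S) e ≡ Map.src (Sphere.shape S) d →
              Map.src (Sphere.shape S) (α e) ≡ Map.src (Sphere.shape S) (α d) → e ≡ d) where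
    open Sphere S
    open RemoveEdge S d ld

    z a : Fin n
    z = src d
    a = src d̄

    z≢a : z ≢ a
    z≢a = loopless ld

    -- The two equations say that the rotation fixes both darts, so the edge would be a whole
    -- component and, by connectedness, the whole graph, against `three`. Contracting it would leave
    -- no dart to carry the face label.
    ¬isolated-edge : φ d ≡ d̄ → φ d̄ ≡ d → ⊥
    ¬isolated-edge e e' = <⇒≱ three (#-≤2 both)
      where
      at-z : ∀ {x} → live x ≡ true → src x ≡ z → x ≡ d
      at-z l s = vtx (_≡ d) (λ { _ refl → e' }) ld l (sym s) refl
      at-a : ∀ {x} → live x ≡ true → src x ≡ a → x ≡ d̄
      at-a l s = vtx (_≡ d̄) (λ { _ refl → trans (cong φ (α-involutive d)) e }) ld̄ l (sym s) refl
      both : ∀ {v} → lv v ≡ true → v ≡ z ⊎ v ≡ a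
      both lv-v = conn (λ v → v ≡ z ⊎ v ≡ a)
        (λ { l (inj₁ s) → inj₂ (cong (src ∘ α) (at-z l s))
           ; l (inj₂ s) → inj₁ (trans (cong (src ∘ α) (at-a l s)) (cong src (α-involutive d))) })
        (lv-src ld) lv-v (inj₁ refl)

    φd≢d : φ d ≢ d
    φd≢d = φ-≢ ld

    φd̄≢d̄ : φ d̄ ≢ d̄
    φd̄≢d̄ = φ-≢ ld̄

    -- Contraction only shortens face walks. They are made to skip `d` here, and the resulting walks
    -- are made to skip `d̄` in `φ⁻`; the two stages cover the case in which `d` and `d̄` are
    -- consecutive on a face.
    φ₁ : Fin m → Fin m
    φ₁ x = redirect d (φ d) (φ x)

    φ⁻ : Fin m → Fin m
    φ⁻ x = redirect d̄ (φ₁ d̄) (φ₁ x)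

    src⁻ : Fin m → Fin n
    src⁻ x = redirect z a (src x)

    src⁻-≢ : ∀ {x} → src x ≢ z → src⁻ x ≡ src x
    src⁻-≢ = redirect-≢

    src⁻-z : ∀ {x} → src x ≡ z → src⁻ x ≡ a
    src⁻-z e = trans (cong (redirect z a) e) (redirect-≡ z a)

    src⁻-a : ∀ {x} → src x ≡ a → src⁻ x ≡ a
    src⁻-a e = trans (cong (redirect z a) e) (redirect-≢ (λ q → z≢a (sym q)))

    φ₁-≢d : ∀ {x} → φ₁ x ≢ d
    φ₁-≢d = redirect-elim (_≢ d) (λ _ → φd≢d) (λ ne → ne)

    φ₁d̄≢d̄ : φ₁ d̄ ≢ d̄
    φ₁d̄≢d̄ = redirect-elim (_≢ d̄) (λ e e' → ¬isolated-edge e' e) (λ _ → φd̄≢d̄)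

    -- `φ⁻ x` arises from `φ x` by further steps of `φ`, each of which leaves from `d` or from `d̄`,
    -- so a property preserved by these steps carries over.
    φ⁻-elim : ∀ {ℓ} {x} (P : Fin m → Set ℓ) → P (φ x) → (P d → P (φ d)) → (P d̄ → P (φ d̄)) → P (φ⁻ x)
    φ⁻-elim {x = x} P p pd pd̄ = redirect-elim P (λ e → step (pd̄ (subst P e p₁))) (λ _ → p₁)
      where
      step : ∀ {y} → P y → P (redirect d (φ d) y)
      step {y} py = redirect-elim P (λ e → pd (subst P e py)) (λ _ → py)
      p₁ : P (φ₁ x)
      p₁ = step p

    φ⁻-≢d : ∀ {x} → φ⁻ x ≢ d
    φ⁻-≢d = redirect-elim (_≢ d) (λ _ → φ₁-≢d) (λ _ → φ₁-≢d)

    φ⁻-≢d̄ : ∀ {x} → φ⁻ x ≢ d̄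
    φ⁻-≢d̄ = redirect-elim (_≢ d̄) (λ _ → φ₁d̄≢d̄) (λ ne → ne)

    φ⁻-live : ∀ {x} → live x ≡ true → live⁻ (φ⁻ x) ≡ true
    φ⁻-live l = live⁻-intro φ⁻-≢d φ⁻-≢d̄ (φ⁻-elim (λ y → live y ≡ true) (live-φ l) (λ _ → live-φ ld) (λ _ → live-φ ld̄))

    φ⁻-fc : ∀ {x} → live x ≡ true → fc (φ⁻ x) ≡ fc x
    φ⁻-fc {x} l = φ⁻-elim (λ y → fc y ≡ fc x) (fc-φ l) (trans (fc-φ ld)) (trans (fc-φ ld̄))

    φ⁻-src : ∀ {x} → live x ≡ true → src⁻ (φ⁻ x) ≡ src⁻ (α x)
    φ⁻-src {x} l = φ⁻-elim (λ y → src⁻ y ≡ src⁻ (α x)) (cong (redirect z a) (src-φ l))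
      (λ e → trans (src⁻-a φd-src) (trans (sym (src⁻-z refl)) e))
      (λ e → trans (src⁻-z φd̄-src) (trans (sym (src⁻-a refl)) e))

    -- A loop could only come from a second edge between `z` and `a`; this is why parallel edges are
    -- removed before a contraction.
    loopless⁻ : ∀ {x} → live⁻ x ≡ true → src⁻ x ≢ src⁻ (α x)
    loopless⁻ {x} l with live⁻-elim l
    ... | ne , ne' , lx = redirect-elim (_≢ src⁻ (α x))
      (λ s → redirect-elim (a ≢_) (λ t _ → loopless lx (trans s (sym t))) (λ _ t → ne (unique lx s (sym t))))
      (λ s → redirect-elim (src x ≢_)
        (λ t s' → ne' (trans (sym (α-involutive x)) (cong α (unique (live-α lx) t (trans (cong src (α-involutive x)) s')))))
        (λ _ → loopless lx))

    fr-onto⁻ : ∀ {l} → fr l ≡ true → ∃ λ x → live⁻ x ≡ true × fc x ≡ l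
    fr-onto⁻ p with fr-onto p
    ... | x , lx , e = φ⁻ x , φ⁻-live lx , trans (φ⁻-fc lx) e

    module _ (P : Fin m → Set) (closed : ∀ {x} → live⁻ x ≡ true → P x → P (φ⁻ (α x))) where

      -- σ⁻ = φ⁻ ∘ α agrees with σ except that it jumps from z to a, and back, at the
      -- darts preceding d and d̄.
      φ⁻-d : ∀ {y} → φ y ≡ d → φ⁻ y ≡ φ⁻ d
      φ⁻-d e = cong (redirect d̄ (φ₁ d̄)) (trans (cong (redirect d (φ d)) e) (trans (redirect-≡ d _) (sym (redirect-≢ φd≢d))))

      φ⁻-d̄ : ∀ {y} → φ y ≡ d̄ → φ⁻ y ≡ φ⁻ d̄
      φ⁻-d̄ e = trans (cong (redirect d̄ (φ₁ d̄)) (trans (cong (redirect d (φ d)) e) (redirect-≢ (λ q → d≢d̄ (sym q)))))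
                     (trans (redirect-≡ d̄ _) (sym (redirect-≢ φ₁d̄≢d̄)))

      φ⁻-other : ∀ {y} → φ y ≢ d → φ y ≢ d̄ → φ⁻ y ≡ φ y
      φ⁻-other ne ne' = trans (cong (redirect d̄ (φ₁ d̄)) (redirect-≢ ne)) (redirect-≢ ne')

      -- One end c of the contracted edge, c̄ being the other.
      module Side {c c̄ : Fin m} (lc : live c ≡ true) (αc : α c ≡ c̄) (apart : src c ≢ src c̄)
        (jump : ∀ {y} → φ y ≡ c → φ⁻ y ≡ φ⁻ c)
        (stay : ∀ {y} → φ y ≢ c → φ y ≢ c̄ → φ⁻ y ≡ φ y)
        (intro : ∀ {y} → y ≢ c → y ≢ c̄ → live y ≡ true → live⁻ y ≡ true)
        (elim : ∀ {y} → live⁻ y ≡ true → y ≢ c × live y ≡ true) where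

        away : ∀ {y} → src y ≡ src c → y ≢ c̄
        away s e = apart (trans (sym s) (cong src e))

        turn : ∀ {y} → live y ≡ true → src y ≡ src c → y ≢ c → P y → φ (α y) ≢ c → P (φ (α y))
        turn l s y≢c p ne = subst P (stay ne (away (trans (src-φ-α l) s))) (closed (intro y≢c (away s) l) p)

        -- Turn around the vertex until `c` is about to be met: the predicate says that the dart
        -- lies elsewhere, or that `P` holds and `c` is not yet reached, or that the jump has been
        -- made. At `c` itself only the last is possible.
        to : ∀ {x} → live⁻ x ≡ true → src x ≡ src c → P x → P (φ⁻ c)
        to {x} l s p with elim l
        ... | ne , lx = done (vtx Q Q-closed lx lc s (inj₂ (inj₁ (ne , p))))
          where
          Q : Fin m → Set
          Q y = src y ≢ src c ⊎ (y ≢ c × P y) ⊎ P (φ⁻ c)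
          done : Q c → P (φ⁻ c)
          done (inj₁ q) = contradiction refl q
          done (inj₂ (inj₁ q)) = contradiction refl (proj₁ q)
          done (inj₂ (inj₂ q)) = q
          Q-closed : ∀ {y} → live y ≡ true → Q y → Q (φ (α y))
          Q-closed l (inj₁ q) = inj₁ (λ e → q (trans (sym (src-φ-α l)) e))
          Q-closed l (inj₂ (inj₂ q)) = inj₂ (inj₂ q)
          Q-closed {y} l (inj₂ (inj₁ (y≢c , q))) with src y ≟ src c | φ (α y) ≟ c
          ... | no s' | _ = inj₁ (λ e → s' (trans (sym (src-φ-α l)) e))
          ... | yes s' | yes e = inj₂ (inj₂ (subst P (jump e) (closed (intro y≢c (away s') l) q)))
          ... | yes s' | no ne = inj₂ (inj₁ (ne , turn l s' y≢c q ne))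

        from : P (φ⁻ c̄) → ∀ {y} → live⁻ y ≡ true → src y ≡ src c → P y
        from p {y} l s with elim l
        ... | ne , ly = done (vtx Q Q-closed lc ly (sym s) (inj₂ (inj₁ refl)))
          where
          Q : Fin m → Set
          Q y = src y ≢ src c ⊎ y ≡ c ⊎ P y
          done : Q y → P y
          done (inj₁ q) = contradiction s q
          done (inj₂ (inj₁ q)) = contradiction q ne
          done (inj₂ (inj₂ q)) = q
          at-c : ∀ {x} → x ≡ c → φ (α x) ≢ c → P (φ (α x))
          at-c refl ne = subst P (trans (stay (λ e → ne (trans (cong φ αc) e)) (away (trans (sym (cong (src ∘ φ) αc)) (src-φ-α lc)))) (sym (cong φ αc))) p
          Q-closed : ∀ {x} → live x ≡ true → Q x → Q (φ (α x))
          Q-closed {x} l q with src x ≟ src c | φ (α x) ≟ c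
          ... | no s' | _ = inj₁ (λ e → s' (trans (sym (src-φ-α l)) e))
          ... | yes s' | yes e = inj₂ (inj₁ e)
          ... | yes s' | no ne with q | x ≟ c
          ...   | inj₁ q' | _ = contradiction s' q'
          ...   | inj₂ (inj₁ e) | _ = inj₂ (inj₂ (at-c e ne))
          ...   | inj₂ (inj₂ _) | yes e = inj₂ (inj₂ (at-c e ne))
          ...   | inj₂ (inj₂ px) | no x≢c = inj₂ (inj₂ (turn l s' x≢c px ne))

      module Z = Side ld refl z≢a φ⁻-d φ⁻-other live⁻-intro (λ l → proj₁ (live⁻-elim l) , proj₂ (proj₂ (live⁻-elim l)))
      module A = Side ld̄ (α-involutive d) (λ e → z≢a (sym e)) φ⁻-d̄ (λ n n' → φ⁻-other n' n) (λ n n' → live⁻-intro n' n)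
                   (λ l → proj₂ (live⁻-elim l))

      d⇒d̄ : P (φ⁻ d) → P (φ⁻ d̄)
      d⇒d̄ p with φ d ≟ d̄
      ... | yes e = subst P (φ⁻-d̄ e) p
      ... | no ne = A.to (φ⁻-live ld) (trans (cong src (φ⁻-other φd≢d ne)) φd-src) p

      d̄⇒d : P (φ⁻ d̄) → P (φ⁻ d)
      d̄⇒d p with φ d̄ ≟ d
      ... | yes e = subst P (φ⁻-d e) p
      ... | no ne = Z.to (φ⁻-live ld̄) (trans (cong src (φ⁻-other ne φd̄≢d̄)) φd̄-src) p

      -- The rotation at the merged vertex runs through the darts of `z` and those of `a` in turn.
      -- From any of them `P` is carried to `φ⁻ d` and `φ⁻ d̄`, where the two runs start, and from
      -- there to all the others. At other vertices nothing has changed.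
      vtx⁻ : ∀ {x y} → live⁻ x ≡ true → live⁻ y ≡ true → src⁻ x ≡ src⁻ y → P x → P y
      vtx⁻ {x} {y} lx ly s p = cases (src x ≟ z) (src x ≟ a)
        where
        merged : P (φ⁻ d) → src⁻ y ≡ a → P y
        merged q t with src y ≟ z
        ... | yes s' = Z.from (d⇒d̄ q) ly s'
        ... | no s' = A.from q ly (trans (sym (src⁻-≢ s')) t)
        cases : Dec (src x ≡ z) → Dec (src x ≡ a) → P y
        cases (yes e) _ = merged (Z.to lx e p) (trans (sym s) (src⁻-z e))
        cases (no _) (yes e) = merged (d̄⇒d (A.to lx e p)) (trans (sym s) (src⁻-a e))
        cases (no nz) (no na) = done (vtx Q Q-closed (proj₂ (proj₂ (live⁻-elim lx))) (proj₂ (proj₂ (live⁻-elim ly))) src-eq (inj₂ p))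
          where
          y≢z : src y ≢ z
          y≢z e = na (trans (sym (src⁻-≢ nz)) (trans s (src⁻-z e)))
          src-eq : src x ≡ src y
          src-eq = trans (sym (src⁻-≢ nz)) (trans s (src⁻-≢ y≢z))
          Q : Fin m → Set
          Q w = src w ≢ src x ⊎ P w
          done : Q y → P y
          done (inj₁ q) = contradiction (sym src-eq) q
          done (inj₂ q) = q
          Q-closed : ∀ {w} → live w ≡ true → Q w → Q (φ (α w))
          Q-closed {w} l q with src w ≟ src x
          ... | no ne = inj₁ (λ e → ne (trans (sym (src-φ-α l)) e))
          ... | yes e with q
          ...   | inj₁ q' = contradiction e q'
          ...   | inj₂ q' = inj₂ (subst P (φ⁻-other (away nz) (away na)) (closed (live⁻-intro (at nz) (at na) l) q'))
            where
            at : ∀ {c} → src x ≢ src c → w ≢ c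
            at ne e' = ne (trans (sym e) (cong src e'))
            away : ∀ {c} → src x ≢ src c → φ (α w) ≢ c
            away ne e' = ne (trans (sym (trans (src-φ-α l) e)) (cong src e'))

    lv⁻ : Fin n → Bool
    lv⁻ = remove z lv

    src⁻-lv : ∀ {x} → live x ≡ true → lv⁻ (src⁻ x) ≡ true
    src⁻-lv l = redirect-elim (λ v → lv⁻ v ≡ true) (λ _ → remove-intro (λ e → z≢a (sym e)) (lv-src ld̄)) (λ ne → remove-intro ne (lv-src l))

    conn⁻ : (P : Fin n → Set) → (∀ {x} → live⁻ x ≡ true → P (src⁻ x) → P (src⁻ (α x))) →
            ∀ {u v} → lv⁻ u ≡ true → lv⁻ v ≡ true → P u → P v
    conn⁻ P closed {u} {v} lu lw p = subst P (redirect-≢ (proj₁ (remove-elim lw)))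
      (conn (P ∘ redirect z a) closed' (proj₂ (remove-elim lu)) (proj₂ (remove-elim lw)) (subst P (sym (redirect-≢ (proj₁ (remove-elim lu)))) p))
      where
      closed' : ∀ {x} → live x ≡ true → P (src⁻ x) → P (src⁻ (α x))
      closed' {x} l p with x ≟ d | x ≟ d̄
      ... | yes e | _ = subst P (trans (src⁻-z (cong src e)) (sym (src⁻-a (cong (src ∘ α) e)))) p
      ... | no _ | yes e = subst P (trans (src⁻-a (cong src e)) (sym (src⁻-z (trans (cong (src ∘ α) e) (cong src (α-involutive d)))))) p
      ... | no ne | no ne' = closed (live⁻-intro ne ne' l) p

    map⁻ : Map lv⁻
    map⁻ = record
      { live = live⁻ ; src = src⁻ ; φ = φ⁻ ; fc = fc ; fr = fr
      ; live-α = live⁻-α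
      ; live-φ = λ l → φ⁻-live (proj₂ (proj₂ (live⁻-elim l)))
      ; src-φ = λ l → φ⁻-src (proj₂ (proj₂ (live⁻-elim l)))
      ; loopless = loopless⁻
      ; fc-φ = λ l → φ⁻-fc (proj₂ (proj₂ (live⁻-elim l)))
      ; fr-fc = λ l → fr-fc (proj₂ (proj₂ (live⁻-elim l)))
      ; fr-onto = fr-onto⁻
      ; lv-src = λ l → src⁻-lv (proj₂ (proj₂ (live⁻-elim l)))
      ; vtx = vtx⁻
      }

    result : Sphere lv⁻
    result = record { shape = map⁻ ; conn = conn⁻ ; euler = s≤s⁻¹ (s≤s⁻¹ (begin
        suc (suc (# live⁻)) + 4           ≡⟨ cong (_+ 4) #live⁻ ⟨
        # live + 4                        ≤⟨ euler ⟩
        2 * # lv + 2 * # fr               ≡⟨ cong (λ k → 2 * k + 2 * # fr) (#-remove (lv-src ld)) ⟩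
        2 * suc (# lv⁻) + 2 * # fr        ≡⟨ cong (_+ 2 * # fr) (*-suc 2 (# lv⁻)) ⟩
        suc (suc (2 * # lv⁻ + 2 * # fr))  ∎)) }
      where open ≤-Reasoning

-- Euler bounds for the edges and the edge cuts of a simple plane graph

unique-sum : ∀ {n} (w : Fin n → ℕ) {xs} → Unique xs → sum (map w xs) ≤ ∑ w
unique-sum w [] = z≤n
unique-sum w (_∷_ {a} {xs} a∉xs u) = begin
  w a + sum (map w xs)             ≡⟨ cong (w a +_) (same a∉xs) ⟩
  w a + sum (map (except a w) xs)  ≤⟨ +-monoʳ-≤ (w a) (unique-sum (except a w) u) ⟩
  w a + ∑ (except a w)             ≡⟨ ∑-extract a w ⟨
  ∑ w ∎
  where
  open ≤-Reasoning
  same : ∀ {xs} → All (a ≢_) xs → sum (map w xs) ≡ sum (map (except a w) xs)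
  same [] = refl
  same (ne ∷ nes) = cong₂ _+_ (sym (except-≢ w (λ e → ne (sym e)))) (same nes)

simplicity : ∀ {m} {α : Fin m → Fin m} {inv} {n} {lv : Fin n → Bool} → Darts.Sphere α inv lv → Set
simplicity {α = α} S = ∀ {x y} → live x ≡ true → live y ≡ true → src x ≡ src y → src (α x) ≡ src (α y) → x ≡ y
  where open Darts.Sphere S

module Bounds {m : ℕ} {α : Fin m → Fin m} {α-involutive : ∀ x → α (α x) ≡ x} where
  open Darts α α-involutive

  -- Deleting one of two parallel edges loses no adjacency. The number `k` is fuel: each deletion
  -- removes two live darts.
  simplify : ∀ {n} {lv : Fin n → Bool} k (S : Sphere lv) → # (Sphere.live S) ≤ k →
             Σ (Sphere lv) λ S' → simplicity S' × (∀ {u v} → Sphere.Adj S u v → Sphere.Adj S' u v)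
  simplify k S le with any? (λ d → any? (λ e → (live d ∧ live e ∧ not (does (e ≟ d)) ∧ does (src e ≟ src d) ∧ does (src (α e) ≟ src (α d))) ≟ᵇ true))
    where open Sphere S
  ... | no none = S , simple , (λ h → h)
    where
    open Sphere S
    simple : simplicity S
    simple {x} {y} lx ly s t with x ≟ y
    ... | yes e = e
    ... | no ne = contradiction (y , x , ∧-intro ly (∧-intro lx (∧-intro (cong not (dec-false (x ≟ y) ne))
                    (∧-intro (dec-true (src x ≟ src y) s) (dec-true (src (α x) ≟ src (α y)) t))))) none
  simplify k S le | yes (d , e , h) with ∧-elim {Sphere.live S d} h
  ... | ld , h₁ with ∧-elim {Sphere.live S e} h₁
  ...   | le' , h₂ with e ≟ d | Sphere.src S e ≟ Sphere.src S d | Sphere.src S (α e) ≟ Sphere.src S (α d)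
  simplify zero S le | yes (d , e , h) | ld , h₁ | le' , h₂ | no ne | yes s | yes t =
    contradiction (≤-trans (≤-reflexive (sym (RemoveEdge.#live⁻ S d ld))) le) λ ()
  simplify (suc k) S le | yes (d , e , h) | ld , h₁ | le' , h₂ | no ne | yes s | yes t
    with simplify k (Delete.result S d ld e le' ne s t) (≤-trans (n≤1+n _) (s≤s⁻¹ (≤-trans (≤-reflexive (sym (RemoveEdge.#live⁻ S d ld))) le)))
  ... | S' , simple , keep = S' , simple , keep ∘ step
    where
    open Sphere S
    open RemoveEdge S d ld
    le⁻ : live⁻ e ≡ true
    le⁻ = live⁻-intro ne (λ eq → loopless ld (trans (sym s) (cong src eq))) le'
    step : ∀ {u v} → Adj u v → Sphere.Adj (Delete.result S d ld e le' ne s t) u v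
    step (x , lx , su , sv) with x ≟ d | x ≟ d̄
    ... | yes refl | _ = e , le⁻ , trans s su , trans t sv
    ... | no _ | yes refl = α e , live⁻-α le⁻ , trans t su , trans (cong src (α-involutive e)) (trans s (trans (cong src (sym (α-involutive d))) sv))
    ... | no n₁ | no n₂ = x , live⁻-intro n₁ n₂ lx , su , sv

  module _ {n} {lv : Fin n → Bool} (S : Map lv) where
    open Map S

    -- Every label in use is carried by a live dart, whose list of darts with the same label weighs
    -- at least `c`. Summing over the labels counts each dart once, since it has a single label.
    face-weight : ∀ c (w : Fin m → ℕ) → (∀ {x} → live x ≡ true → ∃ λ xs → Unique xs ×
                    All (λ y → live y ≡ true × fc y ≡ fc x) xs × c ≤ sum (map w xs)) →
                  c * # fr ≤ ∑ (λ x → ⟦ live x ⟧ * w x)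
    face-weight c w h = begin
      c * # fr                            ≡⟨ *-distribˡ-∑ c _ ⟩
      ∑ (λ l → c * ⟦ fr l ⟧)              ≤⟨ ∑-mono class ⟩
      ∑ (λ l → ∑ (λ x → W x * δ (fc x) l)) ≡⟨ ∑-comm _ ⟩
      ∑ (λ x → ∑ (λ l → W x * δ (fc x) l)) ≡⟨ ∑-cong (λ x → sym (*-distribˡ-∑ (W x) _)) ⟩
      ∑ (λ x → W x * ∑ (λ l → δ (fc x) l)) ≤⟨ ∑-mono (λ x → ≤-trans (*-monoʳ-≤ (W x) (≤-reflexive (∑-δ (fc x)))) (≤-reflexive (*-identityʳ _))) ⟩
      ∑ W ∎
      where
      open ≤-Reasoning
      W : Fin m → ℕ
      W x = ⟦ live x ⟧ * w x
      weigh : ∀ {l} xs → All (λ y → live y ≡ true × fc y ≡ l) xs → sum (map (λ x → W x * δ (fc x) l) xs) ≡ sum (map w xs)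
      weigh [] [] = refl
      weigh (x ∷ xs) ((lx , refl) ∷ as) rewrite lx | δ-refl (fc x) = cong₂ _+_ (trans (*-identityʳ _) (+-identityʳ _)) (weigh xs as)
      class : ∀ l → c * ⟦ fr l ⟧ ≤ ∑ (λ x → W x * δ (fc x) l)
      class l with fr l in p
      ... | false = ≤-trans (≤-reflexive (*-zeroʳ c)) z≤n
      ... | true with fr-onto p
      ...   | x , lx , refl with h lx
      ...     | xs , u , as , le = begin
        c * 1         ≡⟨ *-identityʳ c ⟩
        c             ≤⟨ le ⟩
        sum (map w xs) ≡⟨ weigh xs as ⟨
        sum (map (λ y → W y * δ (fc y) (fc x)) xs) ≤⟨ unique-sum _ u ⟩
        ∑ (λ y → W y * δ (fc y) (fc x)) ∎

  module _ {n} {lv : Fin n → Bool} (S : Sphere lv) where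
    open Sphere S

    Adj-sym : ∀ {u v} → Adj u v → Adj v u
    Adj-sym (x , l , s , t) = α x , live-α l , t , trans (cong src (α-involutive x)) s

    Adj-≢ : ∀ {u v} → Adj u v → u ≢ v
    Adj-≢ (x , l , refl , t) e = loopless l (trans e (sym t))

    -- Each related pair is realised by some dart, and a dart realises a single ordered pair. The
    -- condition `C` restricts the count to the darts that cross a cut.
    pairs≤darts : (R C : Fin n → Fin n → Bool) → (∀ {u v} → R u v ≡ true → Adj u v × C u v ≡ true) →
                  ∑ (λ u → ∑ (λ v → ⟦ R u v ⟧)) ≤ # (λ x → live x ∧ C (src x) (src (α x)))
    pairs≤darts R C h = begin
      ∑ (λ u → ∑ (λ v → ⟦ R u v ⟧))                    ≤⟨ ∑-mono (λ u → ∑-mono (λ v → bound u v)) ⟩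
      ∑ (λ u → ∑ (λ v → ∑ (λ x → L x * (δ (src x) u * δ (src (α x)) v))))
        ≡⟨ ∑-cong (λ u → ∑-comm _) ⟩
      ∑ (λ u → ∑ (λ x → ∑ (λ v → L x * (δ (src x) u * δ (src (α x)) v))))
        ≡⟨ ∑-comm _ ⟩
      ∑ (λ x → ∑ (λ u → ∑ (λ v → L x * (δ (src x) u * δ (src (α x)) v))))
        ≤⟨ ∑-mono collapse ⟩
      ∑ L ∎
      where
      open ≤-Reasoning
      L : Fin m → ℕ
      L x = ⟦ live x ∧ C (src x) (src (α x)) ⟧
      bound : ∀ u v → ⟦ R u v ⟧ ≤ ∑ (λ x → L x * (δ (src x) u * δ (src (α x)) v))
      bound u v with R u v in r
      ... | false = z≤n
      ... | true with h r
      ...   | (x , lx , refl , refl) , c = ≤-trans (≤-reflexive (sym one)) (term≤∑ _ x)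
        where
        one : L x * (δ (src x) (src x) * δ (src (α x)) (src (α x))) ≡ 1
        one rewrite lx | c | δ-refl (src x) | δ-refl (src (α x)) = refl
      collapse : ∀ x → ∑ (λ u → ∑ (λ v → L x * (δ (src x) u * δ (src (α x)) v))) ≤ L x
      collapse x = begin
        ∑ (λ u → ∑ (λ v → L x * (δ (src x) u * δ (src (α x)) v)))
          ≡⟨ ∑-cong (λ u → sym (*-distribˡ-∑ (L x) _)) ⟩
        ∑ (λ u → L x * ∑ (λ v → δ (src x) u * δ (src (α x)) v))
          ≡⟨ sym (*-distribˡ-∑ (L x) _) ⟩
        L x * ∑ (λ u → ∑ (λ v → δ (src x) u * δ (src (α x)) v))
          ≡⟨ cong (L x *_) (∑-cong (λ u → sym (*-distribˡ-∑ (δ (src x) u) _))) ⟩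
        L x * ∑ (λ u → δ (src x) u * ∑ (λ v → δ (src (α x)) v))
          ≤⟨ *-monoʳ-≤ (L x) (∑-mono (λ u → *-monoʳ-≤ (δ (src x) u) (≤-reflexive (∑-δ (src (α x)))))) ⟩
        L x * ∑ (λ u → δ (src x) u * 1)
          ≡⟨ cong (L x *_) (∑-cong (λ u → *-identityʳ _)) ⟩
        L x * ∑ (λ u → δ (src x) u)
          ≤⟨ *-monoʳ-≤ (L x) (≤-reflexive (∑-δ (src x))) ⟩
        L x * 1 ≡⟨ *-identityʳ _ ⟩
        L x ∎

    module Simple (simple : simplicity S) (three : 3 ≤ # lv) where

      φ-≢ : ∀ {x} → live x ≡ true → φ x ≢ x
      φ-≢ l e = loopless l (trans (sym (cong src e)) (src-φ l))

      φ-src : ∀ {x} → live x ≡ true → src (α x) ≡ src (φ x)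
      φ-src l = sym (src-φ l)

      -- A face of length two would be an isolated edge.
      φφ-≢ : ∀ {x} → live x ≡ true → φ (φ x) ≢ x
      φφ-≢ {x} l e = <⇒≱ three (#-≤2 both)
        where
        φx≡αx : φ x ≡ α x
        φx≡αx = simple (live-φ l) (live-α l) (src-φ l)
          (trans (sym (src-φ (live-φ l))) (trans (cong src e) (cong src (sym (α-involutive x)))))
        at-x : ∀ {y} → live y ≡ true → src y ≡ src x → y ≡ x
        at-x ly s = vtx (_≡ x) (λ { _ refl → trans (cong φ (sym φx≡αx)) e }) l ly (sym s) refl
        at-αx : ∀ {y} → live y ≡ true → src y ≡ src (α x) → y ≡ α x
        at-αx ly s = vtx (_≡ α x) (λ { _ refl → trans (cong φ (α-involutive x)) φx≡αx }) (live-α l) ly (sym s) refl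
        both : ∀ {v} → lv v ≡ true → v ≡ src x ⊎ v ≡ src (α x)
        both lv-v = conn (λ v → v ≡ src x ⊎ v ≡ src (α x))
          (λ { ly (inj₁ s) → inj₂ (cong (src ∘ α) (at-x ly s))
             ; ly (inj₂ s) → inj₁ (trans (cong (src ∘ α) (at-αx ly s)) (cong src (α-involutive x))) })
          (lv-src l) lv-v (inj₁ refl)

      three-darts : ∀ {x} → live x ≡ true → Unique (x ∷ φ x ∷ φ (φ x) ∷ []) × All (λ y → live y ≡ true × fc y ≡ fc x) (x ∷ φ x ∷ φ (φ x) ∷ [])
      three-darts l = ((λ e → φ-≢ l (sym e)) ∷ (λ e → φφ-≢ l (sym e)) ∷ []) ∷ ((λ e → φ-≢ (live-φ l) (sym e)) ∷ []) ∷ [] ∷ [] ,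
        (l , refl) ∷ (live-φ l , fc-φ l) ∷ (live-φ (live-φ l) , trans (fc-φ (live-φ l)) (fc-φ l)) ∷ []

      -- Every face has at least three darts, so 3F is at most the number of darts; this is inserted
      -- into three times Euler's inequality.
      edge-bound : # live + 12 ≤ 6 * # lv
      edge-bound = +-cancelˡ-≤ (2 * # live) _ _ (begin
          2 * # live + (# live + 12)     ≡⟨ +-assoc (2 * # live) _ _ ⟨
          2 * # live + # live + 12       ≡⟨ cong (_+ 12) (+-comm (2 * # live) (# live)) ⟩
          3 * # live + 3 * 4             ≡⟨ *-distribˡ-+ 3 (# live) 4 ⟨
          3 * (# live + 4)               ≤⟨ *-monoʳ-≤ 3 euler ⟩
          3 * (2 * # lv + 2 * # fr)      ≡⟨ *-distribˡ-+ 3 (2 * # lv) (2 * # fr) ⟩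
          3 * (2 * # lv) + 3 * (2 * # fr) ≡⟨ cong₂ _+_ (sym (*-assoc 3 2 (# lv))) (trans (sym (*-assoc 3 2 (# fr))) (*-assoc 2 3 (# fr))) ⟩
          6 * # lv + 2 * (3 * # fr)      ≤⟨ +-monoʳ-≤ (6 * # lv) (*-monoʳ-≤ 2 faces) ⟩
          6 * # lv + 2 * # live          ≡⟨ +-comm (6 * # lv) _ ⟩
          2 * # live + 6 * # lv ∎)
        where
        open ≤-Reasoning
        faces : 3 * # fr ≤ # live
        faces = ≤-trans (face-weight shape 3 (λ _ → 1) (λ {x} l → _ , proj₁ (three-darts l) , proj₂ (three-darts l) , ≤-refl))
                        (≤-reflexive (∑-cong (λ x → *-identityʳ _)))

      -- Around a triangle the number of edges leaving P is even, so that a triangle, like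
      -- any face with at least four darts, has total weight at least four.
      cut-bound : (P : Fin n → Bool) → # (λ x → live x ∧ (P (src x) xor P (src (α x)))) + 8 ≤ 4 * # lv
      cut-bound P = +-cancelʳ-≤ (4 * # fr) _ _ (begin
          # cut + 8 + 4 * # fr          ≡⟨ trans (+-assoc (# cut) 8 _) (trans (cong (# cut +_) (+-comm 8 _)) (sym (+-assoc (# cut) _ 8))) ⟩
          # cut + 4 * # fr + 8          ≤⟨ +-monoˡ-≤ 8 weights ⟩
          2 * # live + 2 * 4            ≡⟨ *-distribˡ-+ 2 (# live) 4 ⟨
          2 * (# live + 4)              ≤⟨ *-monoʳ-≤ 2 euler ⟩
          2 * (2 * # lv + 2 * # fr)     ≡⟨ *-distribˡ-+ 2 (2 * # lv) _ ⟩
          2 * (2 * # lv) + 2 * (2 * # fr) ≡⟨ cong₂ _+_ (sym (*-assoc 2 2 (# lv))) (sym (*-assoc 2 2 (# fr))) ⟩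
          4 * # lv + 4 * # fr ∎)
        where
        open ≤-Reasoning
        c : Fin m → Bool
        c x = P (src x) xor P (src (α x))
        cut : Fin m → Bool
        cut x = live x ∧ c x
        -- The total weight of the live darts is twice their number minus the number of cut darts.
        weight : Bool → ℕ
        weight b = if b then 1 else 2
        weight≥1 : ∀ b → 1 ≤ weight b
        weight≥1 true = ≤-refl
        weight≥1 false = s≤s z≤n
        parity : ∀ p q r → 4 ≤ weight (p xor q) + (weight (q xor r) + (weight (r xor p) + 0))
        parity true true true = ≤ᵇ⇒≤ 4 6 _
        parity true true false = ≤ᵇ⇒≤ 4 4 _
        parity true false true = ≤ᵇ⇒≤ 4 4 _
        parity true false false = ≤ᵇ⇒≤ 4 4 _
        parity false true true = ≤ᵇ⇒≤ 4 4 _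
        parity false true false = ≤ᵇ⇒≤ 4 4 _
        parity false false true = ≤ᵇ⇒≤ 4 4 _
        parity false false false = ≤ᵇ⇒≤ 4 6 _
        face : ∀ {x} → live x ≡ true → ∃ λ xs → Unique xs × All (λ y → live y ≡ true × fc y ≡ fc x) xs × 4 ≤ sum (map (weight ∘ c) xs)
        face {x} l with three-darts l | φ (φ (φ x)) ≟ x
        ... | u , as | yes e = x ∷ φ x ∷ φ (φ x) ∷ [] , u , as , subst (4 ≤_) (sym same) (parity (P (src x)) (P (src (φ x))) (P (src (φ (φ x)))))
          where
          same : sum (map (weight ∘ c) (x ∷ φ x ∷ φ (φ x) ∷ [])) ≡
                 weight (P (src x) xor P (src (φ x))) + (weight (P (src (φ x)) xor P (src (φ (φ x)))) + (weight (P (src (φ (φ x))) xor P (src x)) + 0))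
          same rewrite φ-src l | φ-src (live-φ l) | φ-src (live-φ (live-φ l)) | e = refl
        ... | (a ∷ b ∷ d ∷ []) , (p ∷ q ∷ r ∷ []) | no ne =
          x ∷ φ x ∷ φ (φ x) ∷ φ (φ (φ x)) ∷ [] ,
          (All.∷ʳ⁺ a (λ e → ne (sym e)) ∷ All.∷ʳ⁺ b (λ e → φφ-≢ (live-φ l) (sym e)) ∷ ((λ e → φ-≢ (live-φ (live-φ l)) (sym e)) ∷ []) ∷ [] ∷ []) ,
          (p ∷ q ∷ r ∷ (live-φ (live-φ (live-φ l)) , trans (fc-φ (live-φ (live-φ l))) (proj₂ r)) ∷ []) ,
          +-mono-≤ (weight≥1 (c x)) (+-mono-≤ (weight≥1 (c (φ x))) (+-mono-≤ (weight≥1 (c (φ (φ x)))) (+-mono-≤ (weight≥1 (c (φ (φ (φ x))))) z≤n)))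
        split : ∀ x → ⟦ cut x ⟧ + ⟦ live x ⟧ * weight (c x) ≡ 2 * ⟦ live x ⟧
        split x with live x | c x
        ... | true | true = refl
        ... | true | false = refl
        ... | false | true = refl
        ... | false | false = refl
        weights : # cut + 4 * # fr ≤ 2 * # live
        weights = begin
          # cut + 4 * # fr                                ≤⟨ +-monoʳ-≤ (# cut) (face-weight shape 4 (weight ∘ c) face) ⟩
          # cut + ∑ (λ x → ⟦ live x ⟧ * weight (c x))      ≡⟨ ∑-distrib-+ _ _ ⟨
          ∑ (λ x → ⟦ cut x ⟧ + ⟦ live x ⟧ * weight (c x))  ≡⟨ ∑-cong split ⟩
          ∑ (λ x → 2 * ⟦ live x ⟧)                         ≡⟨ *-distribˡ-∑ 2 _ ⟨
          2 * # live ∎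

-- Minors

record Plane {n} (lv : Fin n → Bool) : Set₁ where
  field
    {size} : ℕ
    α : Fin size → Fin size
    α-involutive : ∀ x → α (α x) ≡ x
    sphere : Darts.Sphere α α-involutive lv
  open Darts.Sphere sphere public

  adj-sym : ∀ {u v} → Adj u v → Adj v u
  adj-sym = Bounds.Adj-sym sphere

  adj-≢ : ∀ {u v} → Adj u v → u ≢ v
  adj-≢ = Bounds.Adj-≢ sphere

  adj-lvˡ : ∀ {u v} → Adj u v → lv u ≡ true
  adj-lvˡ (x , l , refl , _) = lv-src l

  adj-lvʳ : ∀ {u v} → Adj u v → lv v ≡ true
  adj-lvʳ h = adj-lvˡ (adj-sym h)

  adj? : ∀ u v → Dec (Adj u v)
  adj? u v = any? (λ x → (live x ≟ᵇ true) ×-dec (src x ≟ u) ×-dec (src (α x) ≟ v))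

module _ {n : ℕ} where

  edges : (Fin n → Fin n → Bool) → ℕ
  edges R = ∑ (λ u → ∑ (λ v → ⟦ R u v ⟧))

  edge-bound : ∀ {lv : Fin n → Bool} (G : Plane lv) {R} → 3 ≤ # lv →
               (∀ {u v} → R u v ≡ true → Plane.Adj G u v) → edges R + 12 ≤ 6 * # lv
  edge-bound G {R} three h with Bounds.simplify _ (Plane.sphere G) ≤-refl
  ... | S , simple , keep = ≤-trans (+-monoˡ-≤ 12 (≤-trans (Bounds.pairs≤darts S R (λ _ _ → true) (λ r → keep (h r) , refl)) (#-mono (λ x l → proj₁ (∧-elim l)))))
                                    (Bounds.Simple.edge-bound S simple three)

  cut-bound : ∀ {lv : Fin n → Bool} (G : Plane lv) {R} → 3 ≤ # lv → (P : Fin n → Bool) →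
              (∀ {u v} → R u v ≡ true → Plane.Adj G u v × (P u xor P v) ≡ true) → edges R + 8 ≤ 4 * # lv
  cut-bound G {R} three P h with Bounds.simplify _ (Plane.sphere G) ≤-refl
  ... | S , simple , keep = ≤-trans (+-monoˡ-≤ 8 (Bounds.pairs≤darts S R (λ u v → P u xor P v) (λ r → keep (proj₁ (h r)) , proj₂ (h r))))
                                    (Bounds.Simple.cut-bound S simple three P)

  -- The fields assert adjacencies of the minor and never their absence; that is enough to exhibit a
  -- K₃,₃ or too many edges.
  record Contraction-of {lv : Fin n → Bool} (G : Plane lv) (z a : Fin n) : Set₁ where
    field
      minor : Plane (remove z lv)
      kept  : ∀ {u v} → u ≢ z → v ≢ z → Plane.Adj G u v → Plane.Adj minor u v
      moved : ∀ {v} → v ≢ a → Plane.Adj G z v → Plane.Adj minor a v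

  contract : ∀ {lv : Fin n → Bool} (G : Plane lv) {z a} → 3 ≤ # lv → Plane.Adj G z a → Contraction-of G z a
  contract {lv} G three za with Bounds.simplify _ (Plane.sphere G) ≤-refl
  ... | S , simple , keep with keep za
  ...   | d , ld , refl , refl = record
          { minor = record { α = Plane.α G ; α-involutive = Plane.α-involutive G ; sphere = C.result }
          ; kept = λ nu nv h → across nu nv (keep h)
          ; moved = λ na h → shift na (keep h) }
    where
    open Plane G using (α; α-involutive)
    module C = Contraction.Contract α α-involutive S d ld three (λ le s t → simple le ld s t)
    open Darts α α-involutive
    open Sphere S
    open Darts.RemoveEdge α α-involutive S d ld using (live⁻-intro)
    across : ∀ {u v} → u ≢ src d → v ≢ src d → Adj u v → Sphere.Adj C.result u v
    across nu nv (x , l , refl , refl) =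
      x , live⁻-intro (λ e → nu (cong src e)) (λ e → nv (trans (cong (src ∘ α) e) (cong src (α-involutive d)))) l ,
      C.src⁻-≢ nu , C.src⁻-≢ nv
    shift : ∀ {v} → v ≢ src (α d) → Adj (src d) v → Sphere.Adj C.result (src (α d)) v
    shift na (x , l , s , refl) =
      x , live⁻-intro (λ e → na (cong (src ∘ α) e)) (λ e → C.z≢a (trans (sym s) (cong src e))) l ,
      C.src⁻-z s , C.src⁻-≢ (λ e → loopless l (trans s (sym e)))

  -- If no live dart started at `z`, being equal to `z` would be closed along edges, and
  -- connectedness would make `z` the only vertex.
  neighbour : ∀ {lv : Fin n → Bool} (G : Plane lv) {z} → 2 ≤ # lv → lv z ≡ true →
              ∃ λ a → Plane.Adj G z a
  neighbour {lv} G {z} two lz with any? (λ x → (Plane.live G x ∧ does (Plane.src G x ≟ z)) ≟ᵇ true)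
  ... | yes (x , e) = _ , x , l , does⇒ (src x ≟ z) (proj₂ (∧-elim {live x} e)) , refl
    where
    open Plane G
    l : live x ≡ true
    l = proj₁ (∧-elim e)
  neighbour {lv} G {z} two lz | no none = contradiction two (<⇒≱ (s≤s (begin
      # lv                    ≤⟨ #-remove-≤ {a = z} ⟩
      suc (# (remove z lv))   ≡⟨ cong suc (∑-zero none-else) ⟩
      1 ∎)))
    where
    open Plane G
    open ≤-Reasoning
    all-z : ∀ {v} → lv v ≡ true → v ≡ z
    all-z lw = conn (_≡ z) (λ {x} l s → contradiction (x , ∧-intro l (dec-true (src x ≟ z) s)) none) lz lw refl
    none-else : ∀ v → ⟦ remove z lv v ⟧ ≡ 0
    none-else v with remove z lv v in eq
    ... | false = refl
    ... | true with remove-elim {P = lv} eq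
    ...   | ne , lw = contradiction (all-z lw) ne

  #-cong : {P Q : Fin n → Bool} → (∀ v → P v ≡ Q v) → # P ≡ # Q
  #-cong h = ∑-cong (λ v → cong ⟦_⟧ (h v))

  -- Stands in for function extensionality: vertex sets that agree pointwise are exchanged.
  relabel : ∀ {lv lv' : Fin n → Bool} → (∀ v → lv v ≡ lv' v) → (G : Plane lv) →
            Σ (Plane lv') λ G' → ∀ {u v} → Plane.Adj G u v → Plane.Adj G' u v
  relabel {lv} {lv'} eq G = record
    { α = α ; α-involutive = α-involutive
    ; sphere = record
        { shape = record { Darts.Map shape ; lv-src = λ l → trans (sym (eq _)) (lv-src l) }
        ; conn = λ P closed lu lw → conn P closed (trans (eq _) lu) (trans (eq _) lw)
        ; euler = ≤-trans euler (≤-reflexive (cong (λ k → 2 * k + 2 * # fr) (#-cong eq))) } } , (λ h → h)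
    where
    open Plane G

  -- Contract the vertices outside B one at a time, along edges chosen by step, while
  -- maintaining the invariant I.
  eliminate : ∀ {B : Fin n → Bool} (I : ∀ {lv} → Plane lv → Set) → 2 ≤ # B →
              (∀ {lv} (G : Plane lv) → (∀ {v} → B v ≡ true → lv v ≡ true) → 3 ≤ # lv → ∀ {z} → lv z ≡ true → B z ≡ false → I G →
                 Σ (Plane (remove z lv)) λ G' → I G') →
              (∀ {lv lv'} (G : Plane lv) (G' : Plane lv') → (∀ {u v} → Plane.Adj G u v → Plane.Adj G' u v) → I G → I G') →
              ∀ {lv} (G : Plane lv) → (∀ {v} → B v ≡ true → lv v ≡ true) → I G → Σ (Plane B) I
  eliminate {B} I two step transfer {lv} G B⊆ i = go _ ≤-refl G B⊆ i
    where
    go : ∀ k {lv} → # lv ≤ k → (G : Plane lv) → (∀ {v} → B v ≡ true → lv v ≡ true) → I G → Σ (Plane B) I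
    go k {lv} le G B⊆ i with any? (λ v → (lv v ∧ not (B v)) ≟ᵇ true)
    ... | no none = proj₁ same-graph , transfer G (proj₁ same-graph) (proj₂ same-graph) i
      where
      same : ∀ v → lv v ≡ B v
      same v with B v in b | lv v in l
      ... | true | true = refl
      ... | true | false = contradiction (trans (sym (B⊆ b)) l) λ ()
      ... | false | false = refl
      ... | false | true = contradiction (v , ∧-intro l (cong not b)) none
      same-graph = relabel same G
    go k {lv} le G B⊆ i | yes (v , e) with ∧-elim {lv v} e
    ... | l , b with B v in bv
    ...   | false with k
    ...     | zero = contradiction (≤-trans (≤-reflexive (sym (#-remove l))) le) λ ()
    ...     | suc k = go k (s≤s⁻¹ (≤-trans (≤-reflexive (sym (#-remove l))) le)) (proj₁ next) B⊆' (proj₂ next)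
      where
      B⊆' : ∀ {w} → B w ≡ true → remove v lv w ≡ true
      B⊆' w = remove-intro (λ { refl → true≢false w bv }) (B⊆ w)
      three : 3 ≤ # lv
      three = ≤-trans (s≤s (≤-trans two (#-mono (λ i → B⊆')))) (≤-reflexive (sym (#-remove l)))
      next = step G B⊆ three l bv i

≢-sym′ : ∀ {A : Set} {x y : A} → x ≢ y → y ≢ x
≢-sym′ ne e = ne (sym e)

opaque

  image : ∀ {b n} → (Fin b → Fin n) → Fin n → Bool
  image j v = does (any? (λ i → v ≟ j i))

  image-intro : ∀ {b n} (j : Fin b → Fin n) i → image j (j i) ≡ true
  image-intro j i = dec-true (any? (λ k → j i ≟ j k)) (i , refl)

  image-elim : ∀ {b n} (j : Fin b → Fin n) {v} → image j v ≡ true → ∃ λ i → v ≡ j i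
  image-elim j {v} = does⇒ (any? (λ i → v ≟ j i))

#-image-≤ : ∀ {b n} (j : Fin b → Fin n) → # (image j) ≤ b
#-image-≤ {b} j = begin
  # (image j)                       ≤⟨ ∑-mono bound ⟩
  ∑ (λ v → ∑ (λ i → δ (j i) v))     ≡⟨ ∑-comm _ ⟩
  ∑ (λ i → ∑ (λ v → δ (j i) v))     ≤⟨ ∑-≤-const 1 (λ i → ≤-reflexive (∑-δ (j i))) ⟩
  b * 1                             ≡⟨ *-identityʳ b ⟩
  b ∎
  where
  open ≤-Reasoning
  bound : ∀ v → ⟦ image j v ⟧ ≤ ∑ (λ i → δ (j i) v)
  bound v with image j v in e
  ... | false = z≤n
  ... | true with image-elim j e
  ...   | i , refl = ≤-trans (≤-reflexive (sym (δ-refl (j i)))) (term≤∑ (λ k → δ (j k) (j i)) i)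

#-image-≥ : ∀ {b n} (j : Fin b → Fin n) → Injective _≡_ _≡_ j → b ≤ # (image j)
#-image-≥ j inj = ≤-#-of-injection j inj (image-intro j)

module _ {n : ℕ} where

  module K33 (x y : Fin 3 → Fin n) (x-inj : Injective _≡_ _≡_ x) (y-inj : Injective _≡_ _≡_ y) where

    Complete : ∀ {lv} → Plane lv → Set
    Complete G = ∀ i k → Plane.Adj G (x i) (y k)

    j : Fin 6 → Fin n
    j i = [ x , y ]′ (splitAt 3 i)

    module _ {lv : Fin n → Bool} (G : Plane lv) (h : Complete G) where
      open Plane G

      x≢y : ∀ {i k} → x i ≢ y k
      x≢y {i} {k} = adj-≢ (h i k)

      j-inj : Injective _≡_ _≡_ j
      j-inj {i} {i'} e = trans (sym (join-splitAt 3 3 i)) (trans (cong (join 3 3) (split-eq (splitAt 3 i) (splitAt 3 i') e)) (join-splitAt 3 3 i'))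
        where
        split-eq : ∀ s t → [ x , y ]′ s ≡ [ x , y ]′ t → s ≡ t
        split-eq (inj₁ _) (inj₁ _) e = cong inj₁ (x-inj e)
        split-eq (inj₁ _) (inj₂ _) e = contradiction e x≢y
        split-eq (inj₂ _) (inj₁ _) e = contradiction (sym e) x≢y
        split-eq (inj₂ _) (inj₂ _) e = cong inj₂ (y-inj e)

      j-lv : ∀ {v} → image j v ≡ true → lv v ≡ true
      j-lv e with image-elim j e
      ... | i , refl with splitAt 3 i
      ...   | inj₁ a = adj-lvˡ (h a zero)
      ...   | inj₂ b = adj-lvʳ (h zero b)

      R : Fin n → Fin n → Bool
      R u v = (image x u ∧ image y v) ∨ (image y u ∧ image x v)

      ∨-elim : ∀ {a b} → a ∨ b ≡ true → a ≡ true ⊎ b ≡ true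
      ∨-elim {true} _ = inj₁ refl
      ∨-elim {false} e = inj₂ e

      disjoint : ∀ k → image x (y k) ≡ false
      disjoint k with image x (y k) in e
      ... | false = refl
      ... | true with image-elim x e
      ...   | i , e' = contradiction (sym e') x≢y

      R-adj : ∀ {u v} → R u v ≡ true → Adj u v × (image x u xor image x v) ≡ true
      R-adj {u} {v} r with ∨-elim {image x u ∧ image y v} r
      ... | inj₁ r' with image-elim x (proj₁ (∧-elim {image x u} r')) | image-elim y (proj₂ (∧-elim {image x u} r'))
      ...   | i , refl | k , refl = h i k , cong₂ _xor_ (image-intro x i) (disjoint k)
      R-adj {u} {v} r | inj₂ r' with image-elim y (proj₁ (∧-elim {image y u} r')) | image-elim x (proj₂ (∧-elim {image y u} r'))
      ...   | k , refl | i , refl = adj-sym (h i k) , cong₂ _xor_ (disjoint k) (image-intro x i)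

      row : ∀ i → 3 ≤ ∑ (λ v → ⟦ R (j i) v ⟧)
      row i with splitAt 3 i
      ... | inj₁ a = ≤-#-of-injection y y-inj (λ k → cong (_∨ (image y (x a) ∧ image x (y k))) (∧-intro (image-intro x a) (image-intro y k)))
      ... | inj₂ b = ≤-#-of-injection x x-inj (λ k → trans (cong ((image x (y b) ∧ image y (x k)) ∨_) (∧-intro (image-intro y b) (image-intro x k))) (∨-zeroʳ _))

      many : 18 ≤ edges R
      many = begin
        18                                       ≡⟨ sym (∑-const 6 3) ⟩
        ∑ {6} (λ _ → 3)                          ≤⟨ ∑-mono row ⟩
        ∑ (λ i → ∑ (λ v → ⟦ R (j i) v ⟧))        ≤⟨ ∑-injective _ j j-inj ⟩
        edges R ∎
        where open ≤-Reasoning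

      -- All nine edges cross the cut between the two sides, and 18 + 8 exceeds 4 times 6.
      six-impossible : 3 ≤ # lv → # lv ≤ 6 → ⊥
      six-impossible three six = contradiction (≤-trans (+-monoˡ-≤ 8 many) (≤-trans (cut-bound G three (image x) R-adj) (*-monoʳ-≤ 4 six)))
                                   (<⇒≱ (≤ᵇ⇒≤ 25 26 _))

    outside : ∀ {z} → image j z ≡ false → (∀ i → x i ≢ z) × (∀ i → y i ≢ z)
    outside b = (λ { i refl → true≢false (subst (λ v → image j v ≡ true) (cong [ x , y ]′ (splitAt-↑ˡ 3 i 3)) (image-intro j (i ↑ˡ 3))) b }) ,
                (λ { i refl → true≢false (subst (λ v → image j v ≡ true) (cong [ x , y ]′ (splitAt-↑ʳ 3 3 i)) (image-intro j (3 ↑ʳ i))) b })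

    -- A vertex other than the six may be contracted along any edge, because the adjacencies among
    -- the six survive. This leads down to exactly six vertices, where the cut bound fails.
    K33-free : ∀ {lv : Fin n → Bool} (G : Plane lv) → ¬ Complete G
    K33-free {lv} G h = six-impossible (proj₁ small) (proj₂ small) three (#-image-≤ j)
      where
      three : 3 ≤ # (image j)
      three = ≤-trans (≤ᵇ⇒≤ 3 6 _) (#-image-≥ j (j-inj G h))
      small : Σ (Plane (image j)) Complete
      small = eliminate Complete (≤-trans (n≤1+n 2) three)
        (λ G' _ three' lz b k → let a , za = neighbour G' (≤-trans (n≤1+n 2) three') lz
                                    C = contract G' three' za in
           Contraction-of.minor C , λ i i' → Contraction-of.kept C (proj₁ (outside b) i) (proj₂ (outside b) i') (k i i'))
        (λ _ _ t k i i' → t (k i i')) G (j-lv G h) h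

  Distinct₃ : Fin n → Fin n → Fin n → Set
  Distinct₃ a b c = a ≢ b × a ≢ c × b ≢ c

  K33-free′ : ∀ {lv : Fin n → Bool} (G : Plane lv) {a b c p q r} → Distinct₃ a b c → Distinct₃ p q r →
              (let open Plane G in Adj a p × Adj a q × Adj a r) → (let open Plane G in Adj b p × Adj b q × Adj b r) →
              (let open Plane G in Adj c p × Adj c q × Adj c r) → ⊥
  K33-free′ G {a} {b} {c} {p} {q} {r} abc pqr (ap , aq , ar) (bp , bq , br) (cp , cq , cr) =
    K33.K33-free (triple a b c) (triple p q r) (triple-inj abc) (triple-inj pqr) G rows
    where
    triple : Fin n → Fin n → Fin n → Fin 3 → Fin n
    triple a b c zero = a
    triple a b c (suc zero) = b
    triple a b c (suc (suc zero)) = c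
    triple-inj : ∀ {a b c} → Distinct₃ a b c → Injective _≡_ _≡_ (triple a b c)
    triple-inj (ab , ac , bc) {zero} {zero} e = refl
    triple-inj (ab , ac , bc) {zero} {suc zero} e = contradiction e ab
    triple-inj (ab , ac , bc) {zero} {suc (suc zero)} e = contradiction e ac
    triple-inj (ab , ac , bc) {suc zero} {zero} e = contradiction (sym e) ab
    triple-inj (ab , ac , bc) {suc zero} {suc zero} e = refl
    triple-inj (ab , ac , bc) {suc zero} {suc (suc zero)} e = contradiction e bc
    triple-inj (ab , ac , bc) {suc (suc zero)} {zero} e = contradiction (sym e) ac
    triple-inj (ab , ac , bc) {suc (suc zero)} {suc zero} e = contradiction (sym e) bc
    triple-inj (ab , ac , bc) {suc (suc zero)} {suc (suc zero)} e = refl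
    rows : ∀ i k → Plane.Adj G (triple a b c i) (triple p q r k)
    rows zero zero = ap
    rows zero (suc zero) = aq
    rows zero (suc (suc zero)) = ar
    rows (suc zero) zero = bp
    rows (suc zero) (suc zero) = bq
    rows (suc zero) (suc (suc zero)) = br
    rows (suc (suc zero)) zero = cp
    rows (suc (suc zero)) (suc zero) = cq
    rows (suc (suc zero)) (suc (suc zero)) = cr

  -- `F` holds the vertices that are not accepted as common neighbours: vertices such as `w` and
  -- `y`, adjacent to everything under consideration, would make the notion void.
  Linked : (F : Fin n → Set) {lv : Fin n → Bool} → Plane lv → Fin n → Fin n → Set
  Linked F G u v = Plane.Adj G u v ⊎ ∃ λ e → ¬ F e × Plane.Adj G e u × Plane.Adj G e v

  -- Vertices outside B are contracted into T when they have a neighbour there.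
  absorb : ∀ {B : Fin n → Bool} (T : Fin n → Bool) (F : Fin n → Set) → (∀ {v} → T v ≡ true → ¬ F v) → 2 ≤ # B →
           ∀ {lv} (G : Plane lv) → (∀ {v} → B v ≡ true → lv v ≡ true) →
           Σ (Plane B) λ G' → (∀ {u v} → B u ≡ true → B v ≡ true → Plane.Adj G u v → Plane.Adj G' u v) ×
             (∀ {u v} → T u ≡ true → B u ≡ true → B v ≡ true → u ≢ v → Linked F G u v → Linked F G' u v)
  absorb {B} T F T∌F two {lv} G B⊆ = eliminate I two step
      (λ G₁ G₂ t i → (λ bu bv h → t (proj₁ i bu bv h)) , (λ tu bu bv ne l → map-linked {G = G₁} {G₂} t (proj₂ i tu bu bv ne l))) G B⊆ ((λ _ _ h → h) , (λ _ _ _ _ h → h))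
    where
    I : ∀ {lv} → Plane lv → Set
    I G' = (∀ {u v} → B u ≡ true → B v ≡ true → Plane.Adj G u v → Plane.Adj G' u v) ×
           (∀ {u v} → T u ≡ true → B u ≡ true → B v ≡ true → u ≢ v → Linked F G u v → Linked F G' u v)
    map-linked : ∀ {lv lv'} {G : Plane lv} {G' : Plane lv'} → (∀ {u v} → Plane.Adj G u v → Plane.Adj G' u v) → ∀ {u v} → Linked F G u v → Linked F G' u v
    map-linked t (inj₁ h) = inj₁ (t h)
    map-linked t (inj₂ (e , f , h , h')) = inj₂ (e , f , t h , t h')
    step : ∀ {lv} (G : Plane lv) → (∀ {v} → B v ≡ true → lv v ≡ true) → 3 ≤ # lv → ∀ {z} → lv z ≡ true → B z ≡ false → I G →
           Σ (Plane (remove z lv)) I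
    step G₁ B⊆ three {z} lz bz (keep , link) with any? (λ t → (T t ≟ᵇ true) ×-dec Plane.adj? G₁ z t)
    ... | yes (t , Tt , zt) = minor , (λ bu bv h → kept (avoid bu) (avoid bv) (keep bu bv h)) , (λ tu bu bv ne l → relink bu bv ne (link tu bu bv ne l))
      where
      open Contraction-of (contract G₁ three zt)
      avoid : ∀ {u} → B u ≡ true → u ≢ z
      avoid bu refl = true≢false bu bz
      relink : ∀ {u v} → B u ≡ true → B v ≡ true → u ≢ v → Linked F G₁ u v → Linked F minor u v
      relink bu bv ne (inj₁ h) = inj₁ (kept (avoid bu) (avoid bv) h)
      relink {u} {v} bu bv ne (inj₂ (e , f , eu , ev)) with e ≟ z
      ... | no e≢z = inj₂ (e , f , kept e≢z (avoid bu) eu , kept e≢z (avoid bv) ev)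
      ... | yes refl with u ≟ t | v ≟ t
      -- The vanishing witness passes its adjacencies on to `t`. If `t` is one of the two ends, they
      -- become adjacent; otherwise `t` is the new witness, admissible because `T` avoids `F`.
      ...   | yes refl | _ = inj₁ (moved (λ q → ne (sym q)) ev)
      ...   | no _ | yes refl = inj₁ (Plane.adj-sym minor (moved ne eu))
      ...   | no u≢t | no v≢t = inj₂ (t , T∌F Tt , moved u≢t eu , moved v≢t ev)
    ... | no none with neighbour G₁ (≤-trans (n≤1+n 2) three) lz
    ...   | a , za = minor , (λ bu bv h → kept (avoid bu) (avoid bv) (keep bu bv h)) , (λ tu bu bv ne l → relink tu bu bv (link tu bu bv ne l))
      where
      open Contraction-of (contract G₁ three za)
      avoid : ∀ {u} → B u ≡ true → u ≢ z
      avoid bu refl = true≢false bu bz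
      relink : ∀ {u v} → T u ≡ true → B u ≡ true → B v ≡ true → Linked F G₁ u v → Linked F minor u v
      relink tu bu bv (inj₁ h) = inj₁ (kept (avoid bu) (avoid bv) h)
      relink {u} {v} tu bu bv (inj₂ (e , f , eu , ev)) with e ≟ z
      ... | no e≢z = inj₂ (e , f , kept e≢z (avoid bu) eu , kept e≢z (avoid bv) ev)
      -- A witness is adjacent to `u`, which lies in `T`; the vertex contracted here has no
      -- neighbour in `T` and is never a witness.
      ... | yes refl = contradiction (u , tu , eu) none

-- Two forbidden configurations: the fan, and five linked common neighbours

module _ {n : ℕ} where

  #-≥3 : ∀ {P : Fin n → Bool} {a b c} → Distinct₃ a b c → P a ≡ true → P b ≡ true → P c ≡ true → 3 ≤ # P
  #-≥3 {P} {a} {b} {c} (ab , ac , bc) pa pb pc = ≤-trans (s≤s (≤-trans (s≤s one) (≤-reflexive (sym (#-remove {a = b} pb'))))) (≤-reflexive (sym (#-remove {a = a} pa)))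
    where
    pb' = remove-intro {P = P} (≢-sym′ ab) pb
    one : 1 ≤ # (remove b (remove a P))
    one = ≤-trans (≤-reflexive (cong ⟦_⟧ (sym (remove-intro (≢-sym′ bc) (remove-intro {P = P} (≢-sym′ ac) pc))))) (term≤∑ _ c)

  module Fan {lv : Fin n → Bool} (G : Plane lv) {w y a b c : Fin n} (u : Fin 3 → Fin n) (u-inj : Injective _≡_ _≡_ u)
    (w≢y : w ≢ y) (w≢c : w ≢ c) (y≢c : y ≢ c) (y≢b : y ≢ b) (a≢b : a ≢ b)
    (u≢a : ∀ i → u i ≢ a) (u≢b : ∀ i → u i ≢ b) (u≢c : ∀ i → u i ≢ c)
    (wa : Plane.Adj G w a) (wb : Plane.Adj G w b) (wu : ∀ i → Plane.Adj G w (u i))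
    (ya : Plane.Adj G y a) (yu : ∀ i → Plane.Adj G y (u i)) (ca : Plane.Adj G c a) (cb : Plane.Adj G c b) where
    open Plane G

    u≢ : ∀ {i j} → i ≢ j → u i ≢ u j
    u≢ ne e = ne (u-inj e)

    w≢a : w ≢ a
    w≢a = adj-≢ wa
    w≢b : w ≢ b
    w≢b = adj-≢ wb
    c≢a : c ≢ a
    c≢a = adj-≢ ca
    c≢b : c ≢ b
    c≢b = adj-≢ cb

    three : 3 ≤ # lv
    three = #-≥3 (w≢a , w≢b , a≢b) (adj-lvˡ wa) (adj-lvʳ wa) (adj-lvʳ wb)

    -- In this and the next three lemmas one side of the K₃,₃ is `w`, `y` and a third vertex, and
    -- the other is `a` with two of the `u`. The third vertex is `c` here. It is `b` in `bb`, after
    -- `c` is contracted into `a`; `c` in `bc`, after `b` is contracted into `u i`; and `u j` in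
    -- `buu`, after `c` and `b` are both contracted into `a`.
    cc : ∀ {i j} → i ≢ j → Adj c (u i) → Adj c (u j) → ⊥
    cc {i} {j} ne ci cj = K33-free′ G (w≢y , w≢c , y≢c) (≢-sym′ (u≢a i) , ≢-sym′ (u≢a j) , u≢ ne)
      (wa , wu i , wu j) (ya , yu i , yu j) (ca , ci , cj)

    bb : ∀ {i j} → i ≢ j → Adj b (u i) → Adj b (u j) → ⊥
    bb {i} {j} ne bi bj = K33-free′ minor (w≢y , w≢b , y≢b) (≢-sym′ (u≢a i) , ≢-sym′ (u≢a j) , u≢ ne)
      (kept w≢c a≢c wa , kept w≢c (u≢c i) (wu i) , kept w≢c (u≢c j) (wu j))
      (kept y≢c a≢c ya , kept y≢c (u≢c i) (yu i) , kept y≢c (u≢c j) (yu j))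
      (Plane.adj-sym minor (moved (≢-sym′ a≢b) cb) , kept b≢c (u≢c i) bi , kept b≢c (u≢c j) bj)
      where
      open Contraction-of (contract G three ca)
      a≢c = ≢-sym′ c≢a
      b≢c = ≢-sym′ c≢b

    bc : ∀ {i j} → i ≢ j → Adj b (u i) → Adj c (u j) → ⊥
    bc {i} {j} ne bi cj = K33-free′ minor (w≢y , w≢c , y≢c) (≢-sym′ (u≢a i) , ≢-sym′ (u≢a j) , u≢ ne)
      (kept w≢b a≢b wa , kept w≢b (u≢b i) (wu i) , kept w≢b (u≢b j) (wu j))
      (kept y≢b a≢b ya , kept y≢b (u≢b i) (yu i) , kept y≢b (u≢b j) (yu j))
      (kept c≢b a≢b ca , Plane.adj-sym minor (moved (≢-sym′ (u≢c i)) (adj-sym cb)) , kept c≢b (u≢b j) cj)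
      where
      open Contraction-of (contract G three bi)

    buu : ∀ {j i k} → j ≢ i → j ≢ k → i ≢ k → Adj b (u j) → Adj (u j) (u i) → Adj (u j) (u k) → ⊥
    buu {j} {i} {k} ji jk ik bj ui uk = K33-free′ (minor C₂) (w≢y , adj-≢ (wu j) , adj-≢ (yu j)) (≢-sym′ (u≢a i) , ≢-sym′ (u≢a k) , u≢ ik)
      (kept₂ w≢c a≢c w≢b a≢b wa , kept₂ w≢c (u≢c i) w≢b (u≢b i) (wu i) , kept₂ w≢c (u≢c k) w≢b (u≢b k) (wu k))
      (kept₂ y≢c a≢c y≢b a≢b ya , kept₂ y≢c (u≢c i) y≢b (u≢b i) (yu i) , kept₂ y≢c (u≢c k) y≢b (u≢b k) (yu k))
      (Plane.adj-sym (minor C₂) (moved C₂ (u≢a j) (kept C₁ b≢c (u≢c j) bj)) , kept₂ (u≢c j) (u≢c i) (u≢b j) (u≢b i) ui , kept₂ (u≢c j) (u≢c k) (u≢b j) (u≢b k) uk)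
      where
      open Contraction-of
      a≢c = ≢-sym′ c≢a
      b≢c = ≢-sym′ c≢b
      C₁ = contract G three ca
      wa₁ = kept C₁ w≢c a≢c wa
      wb₁ = kept C₁ w≢c b≢c wb
      C₂ = contract (minor C₁) (#-≥3 (w≢a , w≢b , a≢b) (Plane.adj-lvˡ (minor C₁) wa₁) (Plane.adj-lvʳ (minor C₁) wa₁) (Plane.adj-lvʳ (minor C₁) wb₁))
             (Plane.adj-sym (minor C₁) (moved C₁ (≢-sym′ a≢b) cb))
      kept₂ : ∀ {p q} → p ≢ c → q ≢ c → p ≢ b → q ≢ b → Adj p q → Plane.Adj (minor C₂) p q
      kept₂ pc qc pb qb h = kept C₂ pb qb (kept C₁ pc qc h)

    -- By `cc` at most one of the `u` is adjacent to `c`, so some `u j` is adjacent to `b`. Then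
    -- `bb` and `bc` leave the other two only the possibility of being adjacent to `u j`, which
    -- `buu` refutes.
    impossible : ¬ (∀ i → Adj b (u i) ⊎ Adj c (u i) ⊎ ∃ λ j → Adj b (u j) × Adj (u j) (u i))
    impossible cover with some-b
      where
      some-b : ∃ λ j → Adj b (u j)
      some-b with cover zero | cover (suc zero)
      ... | inj₁ h | _ = zero , h
      ... | inj₂ (inj₂ (j , h , _)) | _ = j , h
      ... | inj₂ (inj₁ _) | inj₁ h = suc zero , h
      ... | inj₂ (inj₁ _) | inj₂ (inj₂ (j , h , _)) = j , h
      ... | inj₂ (inj₁ h) | inj₂ (inj₁ h') = ⊥-elim (cc (λ ()) h h')
    ... | j , bj = buu {j} {punchIn j zero} {punchIn j (suc zero)} (≢-sym′ (punchInᵢ≢i j zero)) (≢-sym′ (punchInᵢ≢i j (suc zero)))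
                     (λ e → contradiction (punchIn-injective j zero (suc zero) e) λ ()) bj
                     (only-j (≢-sym′ (punchInᵢ≢i j zero))) (only-j (≢-sym′ (punchInᵢ≢i j (suc zero))))
      where
      only-j : ∀ {i} → j ≢ i → Adj (u j) (u i)
      only-j {i} ne with cover i
      ... | inj₁ h = ⊥-elim (bb ne bj h)
      ... | inj₂ (inj₁ h) = ⊥-elim (bc ne bj h)
      ... | inj₂ (inj₂ (k , bk , h)) with j ≟ k
      ...   | yes refl = h
      ...   | no ne' = ⊥-elim (bb ne' bj bk)

  -- Four neighbours a, u₀, u₁, u₂ of w and y, a neighbour b of w joined to a through c,
  -- and links between b and each uᵢ force a K₃,₃-minor.
  fan : ∀ {lv : Fin n → Bool} (G : Plane lv) {w y a b c : Fin n} (u : Fin 3 → Fin n) → Injective _≡_ _≡_ u →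
    w ≢ y → w ≢ c → y ≢ c → y ≢ b → a ≢ b → (∀ i → u i ≢ a) → (∀ i → u i ≢ b) → (∀ i → u i ≢ c) →
    (let open Plane G in Adj w a × Adj w b × (∀ i → Adj w (u i)) × Adj y a × (∀ i → Adj y (u i)) × Adj c a × Adj c b) →
    ¬ (∀ i → Linked (λ e → e ≡ w ⊎ e ≡ y ⊎ e ≡ a) G (u i) b)
  fan {lv} G {w} {y} {a} {b} {c} u u-inj w≢y w≢c y≢c y≢b a≢b u≢a u≢b u≢c (wa , wb , wu , ya , yu , ca , cb) links =
    finish absorbed
    where
    j : Fin 8 → Fin n
    j = lookup (w ∷ y ∷ a ∷ b ∷ c ∷ u zero ∷ u (suc zero) ∷ u (suc (suc zero)) ∷ [])
    B = image j
    Bw : B w ≡ true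
    Bw = image-intro j zero
    By : B y ≡ true
    By = image-intro j (suc zero)
    Ba : B a ≡ true
    Ba = image-intro j (suc (suc zero))
    Bb : B b ≡ true
    Bb = image-intro j (suc (suc (suc zero)))
    Bc : B c ≡ true
    Bc = image-intro j (suc (suc (suc (suc zero))))
    Bu : ∀ i → B (u i) ≡ true
    Bu zero = image-intro j (suc (suc (suc (suc (suc zero)))))
    Bu (suc zero) = image-intro j (suc (suc (suc (suc (suc (suc zero))))))
    Bu (suc (suc zero)) = image-intro j (suc (suc (suc (suc (suc (suc (suc zero)))))))
    F : Fin n → Set
    F e = e ≡ w ⊎ e ≡ y ⊎ e ≡ a
    B-elim : ∀ {v} → B v ≡ true → F v ⊎ v ≡ b ⊎ v ≡ c ⊎ ∃ λ i → v ≡ u i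
    B-elim e with image-elim j e
    ... | zero , q = inj₁ (inj₁ q)
    ... | suc zero , q = inj₁ (inj₂ (inj₁ q))
    ... | suc (suc zero) , q = inj₁ (inj₂ (inj₂ q))
    ... | suc (suc (suc zero)) , q = inj₂ (inj₁ q)
    ... | suc (suc (suc (suc zero))) , q = inj₂ (inj₂ (inj₁ q))
    ... | suc (suc (suc (suc (suc zero)))) , q = inj₂ (inj₂ (inj₂ (zero , q)))
    ... | suc (suc (suc (suc (suc (suc zero))))) , q = inj₂ (inj₂ (inj₂ (suc zero , q)))
    ... | suc (suc (suc (suc (suc (suc (suc zero)))))) , q = inj₂ (inj₂ (inj₂ (suc (suc zero) , q)))
    open Plane G using (adj-lvˡ; adj-lvʳ; adj-≢)
    B⊆ : ∀ {v} → B v ≡ true → lv v ≡ true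
    B⊆ e with B-elim e
    ... | inj₁ (inj₁ refl) = adj-lvˡ wa
    ... | inj₁ (inj₂ (inj₁ refl)) = adj-lvˡ ya
    ... | inj₁ (inj₂ (inj₂ refl)) = adj-lvʳ wa
    ... | inj₂ (inj₁ refl) = adj-lvʳ wb
    ... | inj₂ (inj₂ (inj₁ refl)) = adj-lvˡ ca
    ... | inj₂ (inj₂ (inj₂ (i , refl))) = adj-lvʳ (wu i)
    F∌u : ∀ {v} → image u v ≡ true → ¬ F v
    F∌u e f with image-elim u e
    F∌u e (inj₁ q) | i , refl = adj-≢ (wu i) (sym q)
    F∌u e (inj₂ (inj₁ q)) | i , refl = adj-≢ (yu i) (sym q)
    F∌u e (inj₂ (inj₂ q)) | i , refl = u≢a i q
    absorbed = absorb {B = B} (image u) F F∌u (≤-trans (n≤1+n 2) (#-≥3 {P = B} (adj-≢ wa , adj-≢ wb , a≢b) Bw Ba Bb)) G B⊆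
    finish : Σ (Plane B) (λ G' → (∀ {u v} → B u ≡ true → B v ≡ true → Plane.Adj G u v → Plane.Adj G' u v) ×
             (∀ {t v} → image u t ≡ true → B t ≡ true → B v ≡ true → t ≢ v → Linked F G t v → Linked F G' t v)) → ⊥
    finish (G' , keep , link) = Fan.impossible G' u u-inj w≢y w≢c y≢c y≢b a≢b u≢a u≢b u≢c
      (keep Bw Ba wa) (keep Bw Bb wb) (λ i → keep Bw (Bu i) (wu i)) (keep By Ba ya) (λ i → keep By (Bu i) (yu i)) (keep Bc Ba ca) (keep Bc Bb cb) cover
      where
      -- Only the eight chosen vertices are left, and `F` rules out `w`, `y` and `a`; hence a
      -- witness is `c` or another of the `u`.
      cover : ∀ i → Plane.Adj G' b (u i) ⊎ Plane.Adj G' c (u i) ⊎ ∃ λ j → Plane.Adj G' b (u j) × Plane.Adj G' (u j) (u i)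
      cover i with link (image-intro u i) (Bu i) Bb (u≢b i) (links i)
      ... | inj₁ h = inj₁ (Plane.adj-sym G' h)
      ... | inj₂ (e , f , eu , eb) with B-elim (Plane.adj-lvˡ G' eu)
      ...   | inj₁ f' = contradiction f' f
      ...   | inj₂ (inj₁ refl) = contradiction refl (Plane.adj-≢ G' eb)
      ...   | inj₂ (inj₂ (inj₁ refl)) = inj₂ (inj₁ eu)
      ...   | inj₂ (inj₂ (inj₂ (k , refl))) = inj₂ (inj₂ (k , Plane.adj-sym G' eb , eu))

square≤double : ∀ {d} → d ≤ 2 → d * d ≤ 2 * d
square≤double {d} le = *-monoˡ-≤ d le

module _ {n : ℕ} where

  -- Five common neighbours of w and y, pairwise linked, together with one further common
  -- neighbour x: then each of the five has at most two neighbours among them, and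
  -- contracting x makes w and y adjacent, so that they span at most four edges.
  module Five {lv : Fin n → Bool} (G : Plane lv) {w y x : Fin n} (t : Fin 5 → Fin n) (t-inj : Injective _≡_ _≡_ t)
    (w≢y : w ≢ y) (t≢x : ∀ i → t i ≢ x) (wt : ∀ i → Plane.Adj G w (t i)) (yt : ∀ i → Plane.Adj G y (t i))
    (wx : Plane.Adj G w x) (yx : Plane.Adj G y x) where
    open Plane G

    h : Fin 5 → Fin 5 → Bool
    h i k = does (adj? (t i) (t k))

    d : Fin 5 → ℕ
    d i = # (h i)

    s : Fin 5 → Bool
    s i = does (adj? x (t i))

    -- Three neighbours of `v` among the `t` would form a K₃,₃ together with `w`, `y` and `v`.
    at-most-two : ∀ v → w ≢ v → y ≢ v → # (λ i → does (adj? v (t i))) ≤ 2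
    at-most-two v w≢v y≢v with # (λ i → does (adj? v (t i))) ≤? 2
    ... | yes le = le
    ... | no gt with pick (λ i → does (adj? v (t i))) 3 (≰⇒> gt)
    ...   | k , k-inj , vk = ⊥-elim (K33-free′ G (w≢y , w≢v , y≢v)
        ((λ e → contradiction (k-inj {zero} {suc zero} (t-inj e)) λ ()) , (λ e → contradiction (k-inj {zero} {suc (suc zero)} (t-inj e)) λ ()) ,
         (λ e → contradiction (k-inj {suc zero} {suc (suc zero)} (t-inj e)) λ ()))
        (wt _ , wt _ , wt _) (yt _ , yt _ , yt _) (at zero , at (suc zero) , at (suc (suc zero))))
      where
      at : ∀ i → Adj v (t (k i))
      at i = does⇒ (adj? v (t (k i))) (vk i)

    d≤2 : ∀ i → d i ≤ 2
    d≤2 i = at-most-two (t i) (adj-≢ (wt i)) (adj-≢ (yt i))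

    s≤2 : # s ≤ 2
    s≤2 = at-most-two x (adj-≢ wx) (adj-≢ yx)

    h-sym : ∀ i k → h i k ≡ true → h k i ≡ true
    h-sym i k e = dec-true (adj? (t k) (t i)) (adj-sym (does⇒ (adj? (t i) (t k)) e))

    module _ (links : ∀ i k → i ≢ k → h i k ≡ true ⊎ (s i ≡ true × s k ≡ true) ⊎ ∃ λ l → h l i ≡ true × h l k ≡ true) where

      common : Fin 5 → Fin 5 → ℕ
      common i k = ∑ (λ l → ⟦ h l i ⟧ * ⟦ h l k ⟧)

      ⟦⟧-square : ∀ b → ⟦ b ⟧ * ⟦ b ⟧ ≡ ⟦ b ⟧
      ⟦⟧-square true = refl
      ⟦⟧-square false = refl

      -- Off the diagonal this is the linking hypothesis; the diagonal terms cancel.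
      pair : ∀ i k → 1 + δ i k * (⟦ s i ⟧ + ∑ (λ l → ⟦ h l i ⟧)) ≤ δ i k + (⟦ h i k ⟧ + (⟦ s i ⟧ * ⟦ s k ⟧ + common i k))
      pair i k with i ≟ k
      ... | yes refl = s≤s (≤-trans (≤-reflexive (trans (+-identityʳ _) (sym (cong₂ _+_ (⟦⟧-square (s i)) (∑-cong (λ l → ⟦⟧-square (h l i))))))) (m≤n+m (⟦ s i ⟧ * ⟦ s i ⟧ + common i i) ⟦ h i i ⟧))
      ... | no ne with links i k ne
      ...   | inj₁ e rewrite e = s≤s z≤n
      ...   | inj₂ (inj₁ (e , e')) rewrite e | e' = ≤-trans (s≤s z≤n) (m≤n+m (1 + common i k) ⟦ h i k ⟧)
      ...   | inj₂ (inj₂ (l , e , e')) = ≤-trans (≤-trans (≤-reflexive one) (term≤∑ (λ l → ⟦ h l i ⟧ * ⟦ h l k ⟧) l)) (≤-trans (m≤n+m (common i k) (⟦ s i ⟧ * ⟦ s k ⟧)) (m≤n+m (⟦ s i ⟧ * ⟦ s k ⟧ + common i k) ⟦ h i k ⟧))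
        where
        one : 1 ≡ ⟦ h l i ⟧ * ⟦ h l k ⟧
        one rewrite e | e' = refl

      column : ∀ i → ∑ (λ l → ⟦ h l i ⟧) ≡ d i
      column i = ∑-cong (λ l → cong ⟦_⟧ (same l))
        where
        same : ∀ l → h l i ≡ h i l
        same l with h l i in e | h i l in e'
        ... | true | true = refl
        ... | false | false = refl
        ... | true | false = contradiction (trans (sym (h-sym l i e)) e') λ ()
        ... | false | true = contradiction (trans (sym (h-sym i l e')) e) λ ()

      D = ∑ d

      count : 25 + (# s + D) ≤ 5 + (D + (# s * # s + ∑ (λ l → d l * d l)))
      count = begin
        25 + (# s + D)
          ≡⟨ cong₂ _+_ refl (sym (trans (∑-cong (λ i → ∑-δ* i (⟦ s i ⟧ + ∑ (λ l → ⟦ h l i ⟧)))) (trans (∑-distrib-+ _ _) (cong (# s +_) (∑-cong column))))) ⟩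
        25 + ∑∑ (λ i k → δ i k * (⟦ s i ⟧ + ∑ (λ l → ⟦ h l i ⟧)))
          ≡⟨ cong (_+ ∑∑ (λ i k → δ i k * (⟦ s i ⟧ + ∑ (λ l → ⟦ h l i ⟧)))) (sym (trans (∑-cong {5} (λ _ → ∑-const 5 1)) (∑-const 5 5))) ⟩
        ∑∑ (λ _ _ → 1) + ∑∑ (λ i k → δ i k * (⟦ s i ⟧ + ∑ (λ l → ⟦ h l i ⟧)))
          ≡⟨ ∑∑-distrib-+ _ _ ⟨
        ∑∑ (λ i k → 1 + δ i k * (⟦ s i ⟧ + ∑ (λ l → ⟦ h l i ⟧)))
          ≤⟨ ∑-mono (λ i → ∑-mono (λ k → pair i k)) ⟩
        ∑∑ (λ i k → δ i k + (⟦ h i k ⟧ + (⟦ s i ⟧ * ⟦ s k ⟧ + common i k)))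
          ≡⟨ trans (∑∑-distrib-+ _ _) (cong₂ _+_ deltas (trans (∑∑-distrib-+ _ _) (cong (D +_) (trans (∑∑-distrib-+ _ _) (cong₂ _+_ (∑∑-product _) commons))))) ⟩
        5 + (D + (# s * # s + ∑ (λ l → d l * d l))) ∎
        where
        open ≤-Reasoning
        deltas : ∑∑ {5} δ ≡ 5
        deltas = trans (∑-cong ∑-δ) (∑-const 5 1)
        commons : ∑∑ common ≡ ∑ (λ l → d l * d l)
        commons = trans (∑-cong (λ i → ∑-comm (λ k l → ⟦ h l i ⟧ * ⟦ h l k ⟧))) (trans (∑-comm _) (∑-cong (λ l → ∑∑-product (λ i → ⟦ h l i ⟧))))

      -- As `# s` and all `d l` are at most 2, each square in `count` is at most the double. What
      -- remains is 20 ≤ `# s` + 2 `D`, with `# s` at most 2.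
      crowded : 9 ≤ D
      crowded with 9 ≤? D
      ... | yes le = le
      ... | no gt = contradiction (begin
          25 + (# s + D)                                    ≤⟨ count ⟩
          5 + (D + (# s * # s + ∑ (λ l → d l * d l)))       ≤⟨ +-monoʳ-≤ 5 (+-monoʳ-≤ D (+-mono-≤ (square≤double s≤2) squares)) ⟩
          5 + (D + (2 * # s + 2 * D))                       ≡⟨ shuffle (# s) D ⟩
          5 + (# s + 2 * D) + (# s + D)                     ≤⟨ +-monoˡ-≤ (# s + D) (+-monoʳ-≤ 5 (+-mono-≤ s≤2 (*-monoʳ-≤ 2 (≤-pred (≰⇒> gt))))) ⟩
          23 + (# s + D) ∎) (<⇒≱ (+-monoˡ-< (# s + D) (≤ᵇ⇒≤ 24 25 _)))
        where
        open ≤-Reasoning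
        squares : ∑ (λ l → d l * d l) ≤ 2 * D
        squares = ≤-trans (∑-mono (λ l → square≤double (d≤2 l))) (≤-reflexive (sym (*-distribˡ-∑ 2 d)))
        shuffle : ∀ a b → 5 + (b + (2 * a + 2 * b)) ≡ 5 + (a + 2 * b) + (a + b)
        shuffle = solve 2 (λ a b → con 5 :+ (b :+ (con 2 :* a :+ con 2 :* b)) := con 5 :+ (a :+ con 2 :* b) :+ (a :+ b)) refl

    vertices : Fin 7 → Fin n
    vertices zero = w
    vertices (suc zero) = y
    vertices (suc (suc i)) = t i

    vertices-inj : Injective _≡_ _≡_ vertices
    vertices-inj {zero} {zero} e = refl
    vertices-inj {zero} {suc zero} e = contradiction e w≢y
    vertices-inj {zero} {suc (suc k)} e = contradiction e (adj-≢ (wt k))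
    vertices-inj {suc zero} {zero} e = contradiction (sym e) w≢y
    vertices-inj {suc zero} {suc zero} e = refl
    vertices-inj {suc zero} {suc (suc k)} e = contradiction e (adj-≢ (yt k))
    vertices-inj {suc (suc i)} {zero} e = contradiction (sym e) (adj-≢ (wt i))
    vertices-inj {suc (suc i)} {suc zero} e = contradiction (sym e) (adj-≢ (yt i))
    vertices-inj {suc (suc i)} {suc (suc k)} e = cong (λ k → suc (suc k)) (t-inj e)

    three : 3 ≤ # lv
    three = #-≥3 (w≢y , adj-≢ wx , adj-≢ yx) (adj-lvˡ wx) (adj-lvˡ yx) (adj-lvʳ wx)

    module _ (eight : # lv ≤ 8) where
      open Contraction-of (contract G three (adj-sym wx))

      R : Fin n → Fin n → Bool
      R u v = does (Plane.adj? minor u v)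

      sparse : edges R ≤ 30
      sparse = +-cancelʳ-≤ 12 _ _ (≤-trans (edge-bound minor
          (#-≥3 (w≢y , adj-≢ (wt zero) , adj-≢ (yt zero)) (alive (adj-≢ wx) (adj-lvˡ wx)) (alive (adj-≢ yx) (adj-lvˡ yx)) (alive (t≢x zero) (adj-lvʳ (wt zero))))
          (λ {u} {v} → does⇒ (Plane.adj? minor u v)))
        (*-monoʳ-≤ 6 (≤-pred (≤-trans (≤-reflexive (sym (#-remove (adj-lvʳ wx)))) eight))))
        where
        alive : ∀ {v} → v ≢ x → lv v ≡ true → remove x lv v ≡ true
        alive = remove-intro

      row : ∀ v → ⟦ R v w ⟧ + (⟦ R v y ⟧ + ∑ (λ i → ⟦ R v (t i) ⟧)) ≤ ∑ (λ u → ⟦ R v u ⟧)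
      row v = ≤-trans (≤-reflexive (sym (trans (∑-suc _) (cong (⟦ R v w ⟧ +_) (∑-suc _))))) (∑-injective (λ u → ⟦ R v u ⟧) vertices vertices-inj)

      true-R : ∀ {u v} → Plane.Adj minor u v → R u v ≡ true
      true-R {u} {v} = dec-true (Plane.adj? minor u v)

      keep : ∀ {u v} → u ≢ x → v ≢ x → Adj u v → R u v ≡ true
      keep nu nv e = true-R (kept nu nv e)

      wy : Plane.Adj minor w y
      wy = moved (≢-sym′ w≢y) (adj-sym yx)

      row-w : 6 ≤ ∑ (λ u → ⟦ R w u ⟧)
      row-w = ≤-trans (≤-trans (≤-trans (≤-reflexive (cong₂ (λ b c → ⟦ b ⟧ + c) (sym (true-R wy)) (sym (trans (∑-cong (λ i → cong ⟦_⟧ (keep (adj-≢ wx) (t≢x i) (wt i)))) (∑-const 5 1))))) (m≤n+m _ ⟦ R w w ⟧)) (row w)) ≤-refl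

      row-y : 6 ≤ ∑ (λ u → ⟦ R y u ⟧)
      row-y = ≤-trans (+-mono-≤ (≤-reflexive (cong ⟦_⟧ (sym (true-R (Plane.adj-sym minor wy)))))
        (≤-trans (≤-reflexive (sym (trans (∑-cong (λ i → cong ⟦_⟧ (keep (adj-≢ yx) (t≢x i) (yt i)))) (∑-const 5 1)))) (m≤n+m _ ⟦ R y y ⟧))) (row y)

      row-t : ∀ i → 2 + d i ≤ ∑ (λ u → ⟦ R (t i) u ⟧)
      row-t i = ≤-trans (+-mono-≤ (≤-reflexive (cong ⟦_⟧ (sym (keep (t≢x i) (adj-≢ wx) (adj-sym (wt i))))))
        (+-mono-≤ (≤-reflexive (cong ⟦_⟧ (sym (keep (t≢x i) (adj-≢ yx) (adj-sym (yt i))))))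
          (#-mono (λ k e → keep (t≢x i) (t≢x k) (does⇒ (adj? (t i) (t k)) e))))) (row (t i))

      -- Seven vertices allow 6 times 7 minus 12, that is 30, ordered adjacent pairs. Those
      -- involving `w` or `y` number at least 6 + 6 + 5 times 2, that is 22.
      few : ∑ d ≤ 8
      few = +-cancelˡ-≤ 22 _ _ (begin
        22 + ∑ d                                            ≡⟨ cong (λ k → 6 + (6 + (k + ∑ d))) (sym (∑-const 5 2)) ⟩
        6 + (6 + (∑ {5} (λ _ → 2) + ∑ d))                    ≡⟨ cong (λ k → 6 + (6 + k)) (sym (∑-distrib-+ {5} (λ _ → 2) d)) ⟩
        6 + (6 + ∑ (λ i → 2 + d i))                          ≤⟨ +-mono-≤ row-w (+-mono-≤ row-y (∑-mono row-t)) ⟩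
        r w + (r y + ∑ (λ i → r (t i)))                      ≡⟨ trans (∑-suc (r ∘ vertices)) (cong (r w +_) (∑-suc _)) ⟨
        ∑ (λ i → r (vertices i))                             ≤⟨ ∑-injective r vertices vertices-inj ⟩
        edges R                                              ≤⟨ sparse ⟩
        30 ∎)
        where
        open ≤-Reasoning
        r : Fin n → ℕ
        r v = ∑ (λ u → ⟦ R v u ⟧)

  -- Absorption reduces to the eight vertices `w`, `y`, `x` and `t i`, after which the witness of a
  -- link is `x` or another `t l`. Then `crowded` and `few` contradict each other.
  five-linked : ∀ {lv : Fin n → Bool} (G : Plane lv) {w y x : Fin n} (t : Fin 5 → Fin n) → Injective _≡_ _≡_ t →
    w ≢ y → (∀ i → t i ≢ x) →
    (let open Plane G in (∀ i → Adj w (t i)) × (∀ i → Adj y (t i)) × Adj w x × Adj y x) →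
    ¬ (∀ i k → i ≢ k → Linked (λ e → e ≡ w ⊎ e ≡ y) G (t i) (t k))
  five-linked {lv} G {w} {y} {x} t t-inj w≢y t≢x (wt , yt , wx , yx) links = finish absorbed
    where
    open Plane G using (adj-lvˡ; adj-lvʳ; adj-≢)
    j : Fin 8 → Fin n
    j zero = w
    j (suc zero) = y
    j (suc (suc zero)) = x
    j (suc (suc (suc i))) = t i
    B = image j
    Bw : B w ≡ true
    Bw = image-intro j zero
    By : B y ≡ true
    By = image-intro j (suc zero)
    Bx : B x ≡ true
    Bx = image-intro j (suc (suc zero))
    Bt : ∀ i → B (t i) ≡ true
    Bt i = image-intro j (suc (suc (suc i)))
    F : Fin n → Set
    F e = e ≡ w ⊎ e ≡ y
    B-elim : ∀ {v} → B v ≡ true → F v ⊎ v ≡ x ⊎ ∃ λ i → v ≡ t i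
    B-elim e with image-elim j e
    ... | zero , q = inj₁ (inj₁ q)
    ... | suc zero , q = inj₁ (inj₂ q)
    ... | suc (suc zero) , q = inj₂ (inj₁ q)
    ... | suc (suc (suc i)) , q = inj₂ (inj₂ (i , q))
    B⊆ : ∀ {v} → B v ≡ true → lv v ≡ true
    B⊆ e with B-elim e
    ... | inj₁ (inj₁ refl) = adj-lvˡ wx
    ... | inj₁ (inj₂ refl) = adj-lvˡ yx
    ... | inj₂ (inj₁ refl) = adj-lvʳ wx
    ... | inj₂ (inj₂ (i , refl)) = adj-lvʳ (wt i)
    F∌t : ∀ {v} → image t v ≡ true → ¬ F v
    F∌t e f with image-elim t e
    F∌t e (inj₁ q) | i , refl = adj-≢ (wt i) (sym q)
    F∌t e (inj₂ q) | i , refl = adj-≢ (yt i) (sym q)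
    absorbed = absorb {B = B} (image t) F F∌t (≤-trans (n≤1+n 2) (#-≥3 {P = B} (w≢y , adj-≢ wx , adj-≢ yx) Bw By Bx)) G B⊆
    finish : Σ (Plane B) (λ G' → (∀ {u v} → B u ≡ true → B v ≡ true → Plane.Adj G u v → Plane.Adj G' u v) ×
             (∀ {p v} → image t p ≡ true → B p ≡ true → B v ≡ true → p ≢ v → Linked F G p v → Linked F G' p v)) → ⊥
    finish (G' , keep , link) = contradiction (T.crowded cover) (<⇒≱ (s≤s (T.few (#-image-≤ j))))
      where
      module T = Five G' t t-inj w≢y t≢x (λ i → keep Bw (Bt i) (wt i)) (λ i → keep By (Bt i) (yt i)) (keep Bw Bx wx) (keep By Bx yx)
      cover : ∀ i k → i ≢ k → T.h i k ≡ true ⊎ (T.s i ≡ true × T.s k ≡ true) ⊎ ∃ λ l → T.h l i ≡ true × T.h l k ≡ true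
      cover i k ne with link (image-intro t i) (Bt i) (Bt k) (λ e → ne (t-inj e)) (links i k ne)
      ... | inj₁ e = inj₁ (dec-true (Plane.adj? G' (t i) (t k)) e)
      ... | inj₂ (e , f , ei , ek) with B-elim (Plane.adj-lvˡ G' ei)
      ...   | inj₁ f' = contradiction f' f
      ...   | inj₂ (inj₁ refl) = inj₂ (inj₁ (dec-true (Plane.adj? G' x (t i)) ei , dec-true (Plane.adj? G' x (t k)) ek))
      ...   | inj₂ (inj₂ (l , refl)) = inj₂ (inj₂ (l , dec-true (Plane.adj? G' (t l) (t i)) ei , dec-true (Plane.adj? G' (t l) (t k)) ek))

-- Classes without a dominating vertex

module _ {n : ℕ} where

  opaque

    -- Mirrors the contraction of `z` into `a` on an explicit relation, for which, unlike for the
    -- adjacency of the minor, it stays known which pairs are unrelated.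
    merge : Fin n → Fin n → (Fin n → Fin n → Bool) → Fin n → Fin n → Bool
    merge z a R u v = not (does (u ≟ v)) ∧ not (does (u ≟ z)) ∧ not (does (v ≟ z)) ∧
                      (R u v ∨ (does (u ≟ a) ∧ R z v) ∨ (does (v ≟ a) ∧ R u z))

  module _ {z a : Fin n} {R : Fin n → Fin n → Bool} where

    data Merged (u v : Fin n) : Set where
      old : R u v ≡ true → Merged u v
      at-left  : u ≡ a → R z v ≡ true → Merged u v
      at-right : v ≡ a → R u z ≡ true → Merged u v

    opaque
      unfolding merge

      merge-elim : ∀ {u v} → merge z a R u v ≡ true → u ≢ v × u ≢ z × v ≢ z × Merged u v
      merge-elim {u} {v} e with u ≟ v | u ≟ z | v ≟ z
      ... | no ne | no uz | no vz with R u v in r | u ≟ a | R z v in r₁ | v ≟ a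
      ...   | true | _ | _ | _ = ne , uz , vz , old r
      ...   | false | yes eq | true | _ = ne , uz , vz , at-left eq r₁
      ...   | false | yes eq | false | yes eq' = ne , uz , vz , at-right eq' e
      ...   | false | no _ | _ | yes eq' = ne , uz , vz , at-right eq' e

      merge-intro : ∀ {u v} → u ≢ v → u ≢ z → v ≢ z → Merged u v → merge z a R u v ≡ true
      merge-intro {u} {v} ne uz vz h rewrite dec-false (u ≟ v) ne | dec-false (u ≟ z) uz | dec-false (v ≟ z) vz = cases h
        where
        cases : Merged u v → R u v ∨ (does (u ≟ a) ∧ R z v) ∨ (does (v ≟ a) ∧ R u z) ≡ true
        cases (old r) = cong (_∨ ((does (u ≟ a) ∧ R z v) ∨ (does (v ≟ a) ∧ R u z))) r
        cases (at-left e r) = trans (cong (λ b → R u v ∨ b ∨ (does (v ≟ a) ∧ R u z)) (∧-intro (dec-true (u ≟ a) e) r)) (∨-zeroʳ _)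
        cases (at-right e r) = trans (cong (λ b → R u v ∨ (does (u ≟ a) ∧ R z v) ∨ b) (∧-intro (dec-true (v ≟ a) e) r))
                                 (trans (cong (R u v ∨_) (∨-zeroʳ _)) (∨-zeroʳ _))

  -- The relation `R` lies inside the adjacency without being equal to it: `miss` asserts that a
  -- pair is unrelated, and only an explicit relation gives control over this under contraction.
  record Undominated (w : Fin n) (S : Fin n → Bool) {lv : Fin n → Bool} (G : Plane lv) : Set where
    field
      R    : Fin n → Fin n → Bool
      emb  : ∀ {u v} → R u v ≡ true → Plane.Adj G u v
      symm : ∀ {u v} → R u v ≡ true → R v u ≡ true
      star : ∀ {u} → S u ≡ true → R w u ≡ true
      link : ∀ {u v} → S u ≡ true → S v ≡ true → u ≢ v → R u v ≡ true ⊎ ∃ λ e → e ≢ w × R e u ≡ true × R e v ≡ true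
      miss : ∀ y → y ≢ w → ∃ λ b → S b ≡ true × b ≢ y × R y b ≡ false

    N : Fin n → Fin n → Bool
    N y v = S v ∧ R y v

    ≢-of : ∀ {u v} → R u v ≡ true → u ≢ v
    ≢-of r = Plane.adj-≢ G (emb r)

    w∉S : ∀ {u} → S u ≡ true → w ≢ u
    w∉S s = ≢-of (star s)

    link-to : ∀ {u b} → S u ≡ true → S b ≡ true → u ≢ b → R u b ≡ false → ∃ λ c → c ≢ w × R c u ≡ true × R c b ≡ true
    link-to su sb ne r with link su sb ne
    ... | inj₁ r' = ⊥-elim (true≢false r' r)
    ... | inj₂ h = h

    separate : ∀ {y a b} → R y a ≡ true → R y b ≡ false → a ≢ b
    separate p q refl = true≢false p q

    -- A witness linking `u i` to `b` differs from `w` by `link`, and from `y` and `a` because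
    -- neither is related to `b`; so it is admissible in `fan`.
    no-fan : ∀ {y a b c} → S a ≡ true → S b ≡ true → R y a ≡ true → R y b ≡ false → R a b ≡ false → b ≢ y → y ≢ w →
             c ≢ w → R c a ≡ true → R c b ≡ true →
             (u : Fin 3 → Fin n) → Injective _≡_ _≡_ u → (∀ i → S (u i) ≡ true × R y (u i) ≡ true × u i ≢ a × u i ≢ c) → ⊥
    no-fan {y} {a} {b} {c} sa sb ya yb ab b≢y y≢w c≢w ca cb u u-inj h =
      fan G u u-inj (≢-sym′ y≢w) (≢-sym′ c≢w) (λ { refl → true≢false cb yb }) (≢-sym′ b≢y) (separate ya yb)
        (λ i → proj₁ (proj₂ (proj₂ (h i)))) (λ i → separate (proj₁ (proj₂ (h i))) yb) (λ i → proj₂ (proj₂ (proj₂ (h i))))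
        (emb (star sa) , emb (star sb) , (λ i → emb (star (proj₁ (h i)))) , emb ya , (λ i → emb (proj₁ (proj₂ (h i)))) , emb ca , emb cb)
        links
      where
      links : ∀ i → Linked (λ e → e ≡ w ⊎ e ≡ y ⊎ e ≡ a) G (u i) b
      links i with link (proj₁ (h i)) sb (separate (proj₁ (proj₂ (h i))) yb)
      ... | inj₁ r = inj₁ (emb r)
      ... | inj₂ (e , e≢w , eu , eb) = inj₂ (e , (λ { (inj₁ q) → e≢w q ; (inj₂ (inj₁ refl)) → true≢false eb yb ; (inj₂ (inj₂ refl)) → true≢false eb ab }) , emb eu , emb eb)

    -- Take five neighbours of `y` in `S` and a vertex `b` of `S` missed by `y`. If `b` is adjacent
    -- to all five, three of them form a K₃,₃ with `w`, `y` and `b`. Otherwise some `t i` is joined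
    -- to `b` only through a vertex `c`, and three of the five differ from `t i` and `c`, which
    -- gives a fan.
    N≤4 : ∀ y → y ≢ w → # (N y) ≤ 4
    N≤4 y y≢w with # (N y) ≤? 4 | miss y y≢w
    ... | yes le | _ = le
    ... | no gt | b , sb , b≢y , yb with pick (N y) 5 (≰⇒> gt)
    ...   | t , t-inj , Nt with any? (λ i → R (t i) b ≟ᵇ false)
    ...     | no none = ⊥-elim (K33-free′ G (≢-sym′ y≢w , w∉S sb , ≢-sym′ b≢y) (distinct (λ ()) , distinct (λ ()) , distinct (λ ()))
                (wt zero , wt (suc zero) , wt (suc (suc zero))) (yt zero , yt (suc zero) , yt (suc (suc zero))) (bt zero , bt (suc zero) , bt (suc (suc zero))))
      where
      distinct : ∀ {i k} → i ≢ k → t i ≢ t k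
      distinct ne e = ne (t-inj e)
      wt : ∀ i → Plane.Adj G w (t i)
      wt i = emb (star (proj₁ (∧-elim (Nt i))))
      yt : ∀ i → Plane.Adj G y (t i)
      yt i = emb (proj₂ (∧-elim {S (t i)} (Nt i)))
      bt : ∀ i → Plane.Adj G b (t i)
      bt i with R (t i) b in e
      ... | true = emb (symm e)
      ... | false = contradiction (i , e) none
    ...     | yes (i , ab) with link-to (proj₁ (∧-elim (Nt i))) sb (separate (proj₂ (∧-elim {S (t i)} (Nt i))) yb) ab
    ...       | c , c≢w , ca , cb with pick (remove c (remove (t i) (N y))) 3 (≤-pred (≤-pred (≤-trans (≰⇒> gt) (≤-trans #-remove-≤ (s≤s #-remove-≤)))))
    ...         | u , u-inj , hu = ⊥-elim (no-fan (proj₁ (∧-elim (Nt i))) sb (proj₂ (∧-elim {S (t i)} (Nt i))) yb ab b≢y y≢w c≢w ca cb u u-inj unpack)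
      where
      unpack : ∀ k → S (u k) ≡ true × R y (u k) ≡ true × u k ≢ t i × u k ≢ c
      unpack k with remove-elim {P = remove (t i) (N y)} (hu k)
      ... | u≢c , r with remove-elim {P = N y} r
      ...   | u≢a , s with ∧-elim {S (u k)} s
      ...     | su , yu = su , yu , u≢a , u≢c

  module LargeSet {w : Fin n} {S : Fin n → Bool} (eleven : 11 ≤ # S) where

    base : Fin n → Bool
    base v = S v ∨ does (v ≟ w)

    S⊆base : ∀ {v} → S v ≡ true → base v ≡ true
    S⊆base s = cong (_∨ _) s

    w∈base : base w ≡ true
    w∈base = trans (cong (S w ∨_) (dec-true (w ≟ w) refl)) (∨-zeroʳ _)

    base-elim : ∀ {v} → base v ≡ true → S v ≡ true ⊎ v ≡ w
    base-elim {v} e with S v | v ≟ w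
    ... | true | _ = inj₁ refl
    ... | false | yes q = inj₂ q

    contract-step : ∀ {lv} (G : Plane lv) → 3 ≤ # lv → ∀ {z a} → base z ≡ false → Plane.Adj G z a →
      (U : Undominated w S G) → (∀ {u} → S u ≡ true → Undominated.R U z u ≡ true → a ≢ w) →
      Σ (Plane (remove z lv)) (Undominated w S)
    contract-step G three {z} {a} z∉ za U a∈ = minor , record
        { R = R' ; emb = emb' ; symm = symm' ; star = star' ; link = link' ; miss = miss' }
      where
      open Undominated U
      open Contraction-of (contract G three za)
      R' : Fin n → Fin n → Bool
      R' = merge z a R
      S≢z : ∀ {u} → S u ≡ true → u ≢ z
      S≢z s refl = true≢false (S⊆base s) z∉
      w≢z : w ≢ z
      w≢z e = true≢false w∈base (trans (cong base e) z∉)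
      emb' : ∀ {u v} → R' u v ≡ true → Plane.Adj minor u v
      emb' {u} {v} r with merge-elim {R = R} r
      ... | ne , uz , vz , old q = kept uz vz (emb q)
      ... | ne , uz , vz , at-left refl q = moved (≢-sym′ ne) (emb q)
      ... | ne , uz , vz , at-right refl q = Plane.adj-sym minor (moved ne (emb (symm q)))
      symm' : ∀ {u v} → R' u v ≡ true → R' v u ≡ true
      symm' {u} {v} r with merge-elim {R = R} r
      ... | ne , uz , vz , old q = merge-intro {R = R} (≢-sym′ ne) vz uz (old (symm q))
      ... | ne , uz , vz , at-left e q = merge-intro {R = R} (≢-sym′ ne) vz uz (at-right e (symm q))
      ... | ne , uz , vz , at-right e q = merge-intro {R = R} (≢-sym′ ne) vz uz (at-left e (symm q))
      star' : ∀ {u} → S u ≡ true → R' w u ≡ true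
      star' s = merge-intro {R = R} (w∉S s) w≢z (S≢z s) (old (star s))
      link' : ∀ {u v} → S u ≡ true → S v ≡ true → u ≢ v → R' u v ≡ true ⊎ ∃ λ e → e ≢ w × R' e u ≡ true × R' e v ≡ true
      link' {u} {v} su sv ne with link su sv ne
      ... | inj₁ r = inj₁ (merge-intro {R = R} ne (S≢z su) (S≢z sv) (old r))
      ... | inj₂ (e , e≢w , eu , ev) with e ≟ z
      ...   | no e≢z = inj₂ (e , e≢w , merge-intro {R = R} (≢-of eu) e≢z (S≢z su) (old eu) , merge-intro {R = R} (≢-of ev) e≢z (S≢z sv) (old ev))
      ...   | yes refl with u ≟ a | v ≟ a
      ...     | yes q | _ = inj₁ (merge-intro {R = R} ne (S≢z su) (S≢z sv) (at-left q ev))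
      ...     | no _ | yes q = inj₁ (merge-intro {R = R} ne (S≢z su) (S≢z sv) (at-right q (symm eu)))
      ...     | no u≢a | no v≢a = inj₂ (a , a∈ su eu , merge-intro {R = R} (≢-sym′ u≢a) (≢-sym′ (Plane.adj-≢ G za)) (S≢z su) (at-left refl eu)
                                                     , merge-intro {R = R} (≢-sym′ v≢a) (≢-sym′ (Plane.adj-≢ G za)) (S≢z sv) (at-left refl ev))
      -- A vertex `y` that dominates after the merging would cover `S` by `y`, `a` and the
      -- neighbours in `S` of `y` and of `z`: at most 1 + 1 + 4 + 4 vertices. The threshold eleven
      -- comes from here.
      miss' : ∀ y → y ≢ w → ∃ λ b → S b ≡ true × b ≢ y × R' y b ≡ false
      miss' y y≢w with any? (λ b → (S b ∧ not (does (b ≟ y)) ∧ not (R' y b)) ≟ᵇ true)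
      ... | yes (b , e) with ∧-elim {S b} e
      ...   | sb , e₁ with ∧-elim {not (does (b ≟ y))} e₁
      ...     | b≢y , e₂ = b , sb , (λ q → true≢false (dec-true (b ≟ y) q) (not-true b≢y)) , not-true e₂
      miss' y y≢w | no none = contradiction eleven (<⇒≱ (s≤s (begin
          # S                                                                         ≤⟨ ∑-mono cover ⟩
          ∑ (λ v → δ y v + (δ a v + (⟦ N y v ⟧ + ⟦ N z v ⟧)))                           ≡⟨ trans (∑-distrib-+ _ _) (cong (∑ (δ y) +_) (trans (∑-distrib-+ _ _) (cong (∑ (δ a) +_) (∑-distrib-+ _ _)))) ⟩
          ∑ (δ y) + (∑ (δ a) + (# (N y) + # (N z)))                                    ≤⟨ +-mono-≤ (one y) (+-mono-≤ (one a) (+-mono-≤ (N≤4 y y≢w) (N≤4 z (≢-sym′ w≢z)))) ⟩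
          10 ∎)))
        where
        open ≤-Reasoning
        one : ∀ (y : Fin n) → ∑ (δ y) ≤ 1
        one y = ≤-reflexive (∑-δ y)
        cover : ∀ v → ⟦ S v ⟧ ≤ δ y v + (δ a v + (⟦ N y v ⟧ + ⟦ N z v ⟧))
        cover v with S v in sv
        ... | false = z≤n
        ... | true with y ≟ v
        ...   | yes _ = s≤s z≤n
        ...   | no y≢v with R' y v in r
        ...     | false = contradiction (v , ∧-intro sv (∧-intro (cong not (dec-false (v ≟ y) (≢-sym′ y≢v))) (cong not r))) none
        ...     | true with merge-elim {R = R} r
        ...       | _ , _ , _ , old q rewrite q = ≤-trans (s≤s z≤n) (m≤n+m _ (δ a v))
        ...       | _ , _ , _ , at-left _ q rewrite q = ≤-trans (≤-trans (s≤s z≤n) (m≤n+m 1 ⟦ R y v ⟧)) (m≤n+m _ (δ a v))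
        ...       | _ , _ , _ , at-right refl q = ≤-trans (≤-reflexive (sym (δ-refl v))) (m≤m+n _ _)

    -- A vertex with a neighbour in `S` is contracted into such a neighbour, so that the links
    -- through it pass to a vertex other than `w`. A vertex without one witnesses no link and may be
    -- contracted anywhere, even into `w`.
    step : ∀ {lv} (G : Plane lv) → (∀ {v} → base v ≡ true → lv v ≡ true) → 3 ≤ # lv → ∀ {z} → lv z ≡ true → base z ≡ false →
           Undominated w S G → Σ (Plane (remove z lv)) (Undominated w S)
    step G _ three {z} lz z∉ U with any? (λ a → (S a ∧ Undominated.R U z a) ≟ᵇ true)
    ... | yes (a , e) = contract-step G three z∉ (Undominated.emb U (proj₂ (∧-elim {S a} e))) U (λ _ _ → ≢-sym′ (Undominated.w∉S U (proj₁ (∧-elim e))))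
    ... | no none = contract-step G three z∉ (proj₂ (neighbour G (≤-trans (n≤1+n 2) three) lz)) U (λ su r → contradiction (_ , ∧-intro su r) none)

    transfer : ∀ {lv lv'} (G : Plane lv) (G' : Plane lv') → (∀ {u v} → Plane.Adj G u v → Plane.Adj G' u v) → Undominated w S G → Undominated w S G'
    transfer G G' t U = record { Undominated U ; emb = λ r → t (Undominated.emb U r) }

    three-base : 3 ≤ # base
    three-base = ≤-trans (≤ᵇ⇒≤ 3 11 _) (≤-trans eleven (#-mono (λ v → S⊆base)))

    module Final (G : Plane base) (U : Undominated w S G) where
      open Undominated U

      d : Fin n → ℕ
      d v = # (N v)

      #base : # base ≤ 1 + # S
      #base = begin
        # base                          ≤⟨ ∑-mono le ⟩
        ∑ (λ v → δ w v + ⟦ S v ⟧)        ≡⟨ ∑-distrib-+ _ _ ⟩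
        ∑ (δ w) + # S                   ≤⟨ +-monoˡ-≤ (# S) (≤-reflexive (∑-δ w)) ⟩
        1 + # S ∎
        where
        open ≤-Reasoning
        le : ∀ v → ⟦ base v ⟧ ≤ δ w v + ⟦ S v ⟧
        le v with S v | v ≟ w | w ≟ v
        ... | true | _ | _ = m≤n+m _ _
        ... | false | no _ | _ = z≤n
        ... | false | yes _ | yes _ = s≤s z≤n
        ... | false | yes e | no ne = contradiction (sym e) ne

      w∉ : S w ≡ false
      w∉ with S w in e
      ... | false = refl
      ... | true = contradiction refl (w∉S e)

      -- On the at most `# S` + 1 vertices there are at most 6 (`# S` + 1) - 12 ordered pairs, of
      -- which the edges at `w` take 2 `# S`.
      degrees : ∑ (λ v → ⟦ S v ⟧ * d v) + 6 ≤ 4 * # S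
      degrees = +-cancelˡ-≤ (2 * # S + 6) _ _ (begin
          2 * # S + 6 + (Σd + 6)                                        ≡⟨ solve 2 (λ s x → con 2 :* s :+ con 6 :+ (x :+ con 6) := s :+ (s :+ x) :+ con 12) refl (# S) Σd ⟩
          # S + (# S + Σd) + 12                                         ≡⟨ cong (_+ 12) (sym expand) ⟩
          ∑ (λ u → δ w u * # S + (⟦ S u ⟧ + ⟦ S u ⟧ * d u)) + 12         ≤⟨ +-monoˡ-≤ 12 (∑-mono row) ⟩
          edges R + 12                                                  ≤⟨ edge-bound G three-base emb ⟩
          6 * # base                                                    ≤⟨ *-monoʳ-≤ 6 #base ⟩
          6 * (1 + # S)                                                 ≡⟨ solve 1 (λ s → con 6 :* (con 1 :+ s) := con 2 :* s :+ con 6 :+ con 4 :* s) refl (# S) ⟩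
          2 * # S + 6 + 4 * # S ∎)
        where
        open ≤-Reasoning
        Σd = ∑ (λ v → ⟦ S v ⟧ * d v)
        expand : ∑ (λ u → δ w u * # S + (⟦ S u ⟧ + ⟦ S u ⟧ * d u)) ≡ # S + (# S + Σd)
        expand = trans (∑-distrib-+ _ _) (cong₂ _+_ (∑-δ* w (# S)) (∑-distrib-+ _ _))
        row : ∀ u → δ w u * # S + (⟦ S u ⟧ + ⟦ S u ⟧ * d u) ≤ ∑ (λ v → ⟦ R u v ⟧)
        row u with w ≟ u
        ... | yes refl rewrite w∉ = ≤-trans (≤-reflexive (trans (+-identityʳ _) (+-identityʳ _))) (#-mono (λ v → star))
        ... | no _ with S u in su
        ...   | false = z≤n
        ...   | true = begin
                1 + (d u + 0)                  ≡⟨ cong suc (+-identityʳ _) ⟩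
                1 + d u                        ≡⟨ cong (_+ d u) (sym (∑-δ w)) ⟩
                ∑ (δ w) + d u                  ≡⟨ ∑-distrib-+ _ _ ⟨
                ∑ (λ v → δ w v + ⟦ N u v ⟧)     ≤⟨ ∑-mono le ⟩
                ∑ (λ v → ⟦ R u v ⟧) ∎
          where
          le : ∀ v → δ w v + ⟦ N u v ⟧ ≤ ⟦ R u v ⟧
          le v with w ≟ v
          ... | yes refl rewrite w∉ | symm (star su) = ≤-refl
          ... | no _ with S v
          ...   | true = ≤-refl
          ...   | false = z≤n

      small-degree : ∃ λ a → S a ≡ true × d a ≤ 3
      small-degree with any? (λ a → (S a ≟ᵇ true) ×-dec (d a ≤? 3))
      ... | yes h = h
      ... | no none = contradiction degrees (<⇒≱ (begin-strict
          4 * # S                          ≡⟨ *-distribˡ-∑ 4 _ ⟩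
          ∑ (λ v → 4 * ⟦ S v ⟧)             ≤⟨ ∑-mono le ⟩
          ∑ (λ v → ⟦ S v ⟧ * d v)           <⟨ m<m+n _ (s≤s z≤n) ⟩
          ∑ (λ v → ⟦ S v ⟧ * d v) + 6 ∎))
        where
        open ≤-Reasoning
        le : ∀ v → 4 * ⟦ S v ⟧ ≤ ⟦ S v ⟧ * d v
        le v with S v in sv
        ... | false = z≤n
        ... | true with d v ≤? 3
        ...   | yes l = contradiction (v , sv , l) none
        ...   | no l = ≤-trans (≰⇒> l) (≤-reflexive (sym (+-identityʳ _)))

      module _ {a : Fin n} (sa : S a ≡ true) (da : d a ≤ 3) where

        X : Fin n → Fin n → Bool
        X y v = (S v ∧ R y v) ∧ not (does (v ≟ a)) ∧ not (R a v)

        -- Only `w` and `S` are left, so each vertex of `S` away from `a` is linked to `a` through a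
        -- neighbour of `a` in `S`. If each of these at most three neighbours reached at most two
        -- such vertices, `S` would have at most 1 + 3 + 6 elements.
        spread : ∃ λ y → N a y ≡ true × 3 ≤ # (X y)
        spread with any? (λ y → (N a y ≟ᵇ true) ×-dec (3 ≤? # (X y)))
        ... | yes h = h
        ... | no none = contradiction eleven (<⇒≱ (s≤s (begin
            # S                                                                  ≤⟨ ∑-mono cover ⟩
            ∑ (λ v → δ a v + (⟦ N a v ⟧ + ∑ (λ y → ⟦ N a y ⟧ * ⟦ X y v ⟧)))        ≡⟨ trans (∑-distrib-+ _ _) (cong (∑ (δ a) +_) (∑-distrib-+ _ _)) ⟩
            ∑ (δ a) + (d a + ∑ (λ v → ∑ (λ y → ⟦ N a y ⟧ * ⟦ X y v ⟧)))            ≡⟨ cong (λ k → ∑ (δ a) + (d a + k)) (trans (∑-comm _) (∑-cong (λ y → sym (*-distribˡ-∑ ⟦ N a y ⟧ _)))) ⟩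
            ∑ (δ a) + (d a + ∑ (λ y → ⟦ N a y ⟧ * # (X y)))                        ≤⟨ +-monoʳ-≤ (∑ (δ a)) (+-monoʳ-≤ (d a) (∑-mono few)) ⟩
            ∑ (δ a) + (d a + ∑ (λ y → 2 * ⟦ N a y ⟧))                              ≡⟨ cong (λ k → ∑ (δ a) + (d a + k)) (sym (*-distribˡ-∑ 2 _)) ⟩
            ∑ (δ a) + (d a + 2 * d a)                                             ≤⟨ +-mono-≤ (≤-reflexive (∑-δ a)) (+-mono-≤ da (*-monoʳ-≤ 2 da)) ⟩
            10 ∎)))
          where
          open ≤-Reasoning
          few : ∀ y → ⟦ N a y ⟧ * # (X y) ≤ 2 * ⟦ N a y ⟧
          few y with N a y in e
          ... | false = z≤n
          ... | true with 3 ≤? # (X y)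
          ...   | yes l = contradiction (y , e , l) none
          ...   | no l = ≤-trans (≤-reflexive (+-identityʳ _)) (≤-pred (≰⇒> l))
          cover : ∀ v → ⟦ S v ⟧ ≤ δ a v + (⟦ N a v ⟧ + ∑ (λ y → ⟦ N a y ⟧ * ⟦ X y v ⟧))
          cover v with S v in sv
          ... | false = z≤n
          ... | true with a ≟ v
          ...   | yes _ = s≤s z≤n
          ...   | no a≢v with R a v in r
          ...     | true = s≤s z≤n
          ...     | false with link-to sa sv a≢v r
          ...       | c , c≢w , ca , cv with base-elim (Plane.adj-lvˡ G (emb ca))
          ...         | inj₂ e = contradiction e c≢w
          ...         | inj₁ sc = ≤-trans (≤-reflexive (sym one)) (term≤∑ (λ y → ⟦ N a y ⟧ * ⟦ (true ∧ R y v) ∧ not (does (v ≟ a)) ∧ true ⟧) c)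
            where
            one : ⟦ S c ∧ R a c ⟧ * ⟦ (true ∧ R c v) ∧ not (does (v ≟ a)) ∧ true ⟧ ≡ 1
            one rewrite sc | symm ca | cv | dec-false (v ≟ a) (≢-sym′ a≢v) = refl

        -- The vertex `a`, its neighbours and those of `y` make up at most 1 + 3 + 4 elements of
        -- `S`, so some `b` lies outside them and is linked to `a` through some `c`. Three vertices
        -- of `X y` complete a fan; being unrelated to `a`, they differ from `c`.
        absurd : ⊥
        absurd with spread
        ... | y , ay , X≥3 with #-exists {P = S} {Q = λ v → does (v ≟ a) ∨ (N a v ∨ N y v)} (≤-trans (s≤s few) (≤-trans (≤ᵇ⇒≤ 9 11 _) eleven))
          where
          y≢w : y ≢ w
          y≢w = ≢-sym′ (w∉S (proj₁ (∧-elim ay)))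
          few : # (λ v → does (v ≟ a) ∨ (N a v ∨ N y v)) ≤ 8
          few = begin
            # (λ v → does (v ≟ a) ∨ (N a v ∨ N y v))                ≤⟨ ∑-mono le ⟩
            ∑ (λ v → δ a v + (⟦ N a v ⟧ + ⟦ N y v ⟧))               ≡⟨ trans (∑-distrib-+ _ _) (cong (∑ (δ a) +_) (∑-distrib-+ _ _)) ⟩
            ∑ (δ a) + (d a + d y)                                  ≤⟨ +-mono-≤ (≤-reflexive (∑-δ a)) (+-mono-≤ da (N≤4 y y≢w)) ⟩
            8 ∎
            where
            open ≤-Reasoning
            le : ∀ v → ⟦ does (v ≟ a) ∨ (N a v ∨ N y v) ⟧ ≤ δ a v + (⟦ N a v ⟧ + ⟦ N y v ⟧)
            le v with v ≟ a | a ≟ v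
            ... | yes e | no ne = contradiction (sym e) ne
            ... | yes _ | yes _ = s≤s z≤n
            ... | no _ | _ with N a v
            ...   | true = ≤-trans (s≤s z≤n) (m≤n+m _ _)
            ...   | false = m≤n+m _ _
        ...   | b , sb , e with pick (X y) 3 X≥3
        ...     | u , u-inj , Xu with ∧-elim {S y} ay
        ...       | sy , Ray = fan-at (link-to sa sb (≢-sym′ (proj₁ away)) (proj₁ (proj₂ away)))
          where
          away : b ≢ a × R a b ≡ false × R y b ≡ false
          away with b ≟ a | S b | R a b | R y b
          ... | no ne | true | false | false = ne , refl , refl
          fan-at : (∃ λ c → c ≢ w × R c a ≡ true × R c b ≡ true) → ⊥
          fan-at (c , c≢w , ca , cb) = no-fan sa sb (symm Ray) (proj₂ (proj₂ away)) (proj₁ (proj₂ away))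
            (λ q → true≢false Ray (trans (cong (R a) (sym q)) (proj₁ (proj₂ away)))) (≢-sym′ (w∉S sy)) c≢w ca cb u u-inj unpack
            where
            unpack : ∀ i → S (u i) ≡ true × R y (u i) ≡ true × u i ≢ a × u i ≢ c
            unpack i with ∧-elim {S (u i) ∧ R y (u i)} (Xu i)
            ... | p , q with ∧-elim {S (u i)} p | ∧-elim {not (does (u i ≟ a))} q
            ...   | su , yu | u≢a , au = su , yu , (λ e → true≢false (dec-true (u i ≟ a) e) (not-true u≢a)) ,
                      (λ e → true≢false (symm ca) (trans (cong (R a) (sym e)) (not-true au)))

      impossible : ⊥
      impossible = absurd (proj₁ (proj₂ small-degree)) (proj₂ (proj₂ small-degree))

    undominated-small : ∀ {lv} (G : Plane lv) → lv w ≡ true → ¬ Undominated w S G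
    undominated-small {lv} G lw U = finish (eliminate (Undominated w S) (≤-trans (n≤1+n 2) three-base) step transfer G base⊆ U)
      where
      base⊆ : ∀ {v} → base v ≡ true → lv v ≡ true
      base⊆ e with base-elim e
      ... | inj₁ s = Plane.adj-lvʳ G (Undominated.emb U (Undominated.star U s))
      ... | inj₂ refl = lw
      finish : ¬ Σ (Plane base) (Undominated w S)
      finish (G' , U') = Final.impossible G' U'

-- Counting pairs

module Clique {p k : ℕ} (lab : Fin k → Fin k → Maybe (Fin p)) (G : Plane {k} (λ _ → true))
  (emb : ∀ {u v} → is-just (lab u v) ≡ true → Plane.Adj G u v)
  (symm : ∀ {u v} → is-just (lab u v) ≡ true → is-just (lab v u) ≡ true)
  (sees : ∀ {u v} → u ≢ v → is-just (lab u v) ≡ true ⊎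
          ∃ λ w → ∃ λ a → ∃ λ b → a ≢ b × lab w u ≡ just a × lab w v ≡ just b) where

  R : Fin k → Fin k → Bool
  R u v = is-just (lab u v)

  opaque

    S : Fin k → Fin p → Fin k → Bool
    S w c v = does (Maybe.≡-dec _≟_ (lab w v) (just c))

    S-elim : ∀ {w c v} → S w c v ≡ true → lab w v ≡ just c
    S-elim {w} {c} {v} = does⇒ (Maybe.≡-dec _≟_ (lab w v) (just c))

    S-intro : ∀ {w c v} → lab w v ≡ just c → S w c v ≡ true
    S-intro {w} {c} {v} = dec-true (Maybe.≡-dec _≟_ (lab w v) (just c))

  S⇒R : ∀ {w c v} → S w c v ≡ true → R w v ≡ true
  S⇒R s = cong is-just (S-elim s)

  label : ∀ {u v} → R u v ≡ true → ∃ λ c → lab u v ≡ just c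
  label {u} {v} r with lab u v
  ... | just c = c , refl

  -- A separating vertex gives `u` and `v` different labels and so is none of those that give them
  -- the same one. This is asserted for all such vertices at once, since `w` and `y` must both be
  -- avoided.
  joined : ∀ {w c u v} → S w c u ≡ true → S w c v ≡ true → u ≢ v →
           R u v ≡ true ⊎ ∃ λ e → (∀ {w c} → S w c u ≡ true → S w c v ≡ true → e ≢ w) × R e u ≡ true × R e v ≡ true
  joined su sv ne with sees ne
  ... | inj₁ r = inj₁ r
  ... | inj₂ (e , a , b , a≢b , ea , eb) = inj₂ (e , differs , cong is-just ea , cong is-just eb)
    where
    differs : ∀ {w c} → S w c _ ≡ true → S w c _ ≡ true → e ≢ w
    differs su sv refl = a≢b (just-injective (trans (sym ea) (trans (S-elim su) (trans (sym (S-elim sv)) eb))))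

  ∑-labels : ∀ w v → ∑ (λ c → ⟦ S w c v ⟧) ≡ ⟦ R w v ⟧
  ∑-labels w v with lab w v in e
  ... | nothing = ∑-zero none
    where
    none : ∀ c → ⟦ S w c v ⟧ ≡ 0
    none c with S w c v in s
    ... | false = refl
    ... | true = contradiction (trans (sym e) (S-elim s)) λ ()
  ... | just a = trans (∑-cong one) (∑-only a (λ _ → 1))
    where
    one : ∀ c → ⟦ S w c v ⟧ ≡ only a (λ _ → 1) c
    one c with c ≟ a | S w c v in s
    ... | yes _ | true = refl
    ... | no _ | false = refl
    ... | yes refl | false = ⊥-elim (true≢false (S-intro e) s)
    ... | no ne | true = contradiction (just-injective (trans (sym (S-elim s)) e)) ne

  module _ {w : Fin k} {c : Fin p} {y : Fin k} (y≢w : y ≢ w) (dom : ∀ b → S w c b ≡ true → b ≢ y → R y b ≡ true) (many : 11 ≤ # (S w c)) where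

    S' : Fin k → Bool
    S' = remove y (S w c)

    both : Fin p → Fin k → Bool
    both c' v = S' v ∧ S y c' v

    -- Vertices with a common label at `w` and a common label at `y` are linked outside `w` and `y`.
    -- As the class has at least ten elements besides `y`, a further common neighbour of `w` and `y`
    -- exists, and `five-linked` applies to any five.
    both≤4 : ∀ c' → # (both c') ≤ 4
    both≤4 c' with # (both c') ≤? 4
    ... | yes le = le
    ... | no gt with pick (both c') 5 (≰⇒> gt)
    ...   | t , t-inj , ht with #-exists {P = S'} {Q = image t} (≤-trans (s≤s (#-image-≤ t)) (≤-trans (≤ᵇ⇒≤ 6 10 _) (≤-pred (≤-trans many #-remove-≤))))
    ...     | x , sx , x∉ = ⊥-elim (five-linked G t t-inj (≢-sym′ y≢w) (λ i e → true≢false (trans (cong (image t) (sym e)) (image-intro t i)) x∉)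
                ((λ i → emb (S⇒R (proj₂ (in-S i)))) , (λ i → emb (S⇒R (in-Sy i))) , emb (S⇒R (proj₂ (remove-elim sx))) ,
                 emb (dom x (proj₂ (remove-elim sx)) (proj₁ (remove-elim sx)))) links)
      where
      in-S : ∀ i → t i ≢ y × S w c (t i) ≡ true
      in-S i = remove-elim (proj₁ (∧-elim {S' (t i)} (ht i)))
      in-Sy : ∀ i → S y c' (t i) ≡ true
      in-Sy i = proj₂ (∧-elim {S' (t i)} (ht i))
      links : ∀ i j → i ≢ j → Linked (λ e → e ≡ w ⊎ e ≡ y) G (t i) (t j)
      links i j ne with joined (in-Sy i) (in-Sy j) (λ e → ne (t-inj e))
      ... | inj₁ r = inj₁ (emb r)
      ... | inj₂ (e , avoid , ei , ej) = inj₂ (e , (λ { (inj₁ q) → avoid (proj₂ (in-S i)) (proj₂ (in-S j)) q ; (inj₂ q) → avoid (in-Sy i) (in-Sy j) q }) , emb ei , emb ej)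

    dominated-small : # (S w c) ≤ 1 + p * 4
    dominated-small = begin
      # (S w c)                                   ≤⟨ #-remove-≤ ⟩
      1 + # S'                                    ≤⟨ s≤s (∑-mono cover) ⟩
      1 + ∑ (λ v → ∑ (λ c' → ⟦ both c' v ⟧))       ≡⟨ cong suc (∑-comm _) ⟩
      1 + ∑ (λ c' → # (both c'))                  ≤⟨ s≤s (∑-≤-const 4 both≤4) ⟩
      1 + p * 4 ∎
      where
      open ≤-Reasoning
      cover : ∀ v → ⟦ S' v ⟧ ≤ ∑ (λ c' → ⟦ both c' v ⟧)
      cover v with S' v in s
      ... | false = z≤n
      ... | true with remove-elim {P = S w c} s
      ...   | v≢y , sv with label (dom v sv v≢y)
      ...     | c' , e = ≤-trans (≤-reflexive (cong ⟦_⟧ (sym (S-intro e)))) (term≤∑ (λ c' → ⟦ S y c' v ⟧) c')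

  class-bound : ∀ {σ} → 10 ≤ σ → 1 + p * 4 ≤ σ → ∀ w c → # (S w c) ≤ σ
  class-bound {σ} ten σ-large w c with 11 ≤? # (S w c)
  ... | no few = ≤-trans (≤-pred (≰⇒> few)) ten
  ... | yes many with any? (λ y → ¬? (y ≟ w) ×-dec all? (λ b → (S w c b ≟ᵇ true) →-dec (¬? (b ≟ y) →-dec (R y b ≟ᵇ true))))
  ...   | yes (y , y≢w , dom) = ≤-trans (dominated-small y≢w dom many) σ-large
  ...   | no none = contradiction undominated (LargeSet.undominated-small many G refl)
    where
    undominated : Undominated w (S w c) G
    undominated = record
      { R = R ; emb = emb ; symm = symm ; star = S⇒R ; link = link ; miss = miss }
      where
      link : ∀ {u v} → S w c u ≡ true → S w c v ≡ true → u ≢ v → R u v ≡ true ⊎ ∃ λ e → e ≢ w × R e u ≡ true × R e v ≡ true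
      link su sv ne with joined su sv ne
      ... | inj₁ r = inj₁ r
      ... | inj₂ (e , avoid , eu , ev) = inj₂ (e , avoid su sv , eu , ev)
      miss : ∀ y → y ≢ w → ∃ λ b → S w c b ≡ true × b ≢ y × R y b ≡ false
      miss y y≢w with any? (λ b → (S w c b ≟ᵇ true) ×-dec ¬? (b ≟ y) ×-dec (R y b ≟ᵇ false))
      ... | yes h = h
      ... | no none' = contradiction (y , y≢w , dom) none
        where
        dom : ∀ b → S w c b ≡ true → b ≢ y → R y b ≡ true
        dom b sb ne with R y b in r
        ... | true = refl
        ... | false = contradiction (b , sb , ne , r) none'

  d : Fin k → ℕ
  d w = # (R w)

  d-split : ∀ w → ∑ (λ c → # (S w c)) ≡ d w
  d-split w = trans (∑-comm _) (∑-cong (∑-labels w))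

  split-pair : Fin k → Fin k → Fin k → ℕ
  split-pair w u v = ⟦ R w u ∧ R w v ∧ not (does (Maybe.≡-dec _≟_ (lab w u) (lab w v))) ⟧

  same-pair : Fin k → Fin k → Fin k → ℕ
  same-pair w u v = ∑ (λ c → ⟦ S w c u ⟧ * ⟦ S w c v ⟧)

  pairs-at : ∀ w u v → split-pair w u v + same-pair w u v ≤ ⟦ R w u ⟧ * ⟦ R w v ⟧
  pairs-at w u v with lab w u in eu | lab w v in ev
  ... | nothing | _ = ≤-reflexive (∑-zero (λ c → cong (_* ⟦ S w c v ⟧) (empty c)))
    where
    empty : ∀ c → ⟦ S w c u ⟧ ≡ 0
    empty c with S w c u in s
    ... | false = refl
    ... | true = contradiction (trans (sym eu) (S-elim s)) λ ()
  ... | just a | nothing = ≤-reflexive (∑-zero (λ c → trans (cong (⟦ S w c u ⟧ *_) (empty c)) (*-zeroʳ ⟦ S w c u ⟧)))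
    where
    empty : ∀ c → ⟦ S w c v ⟧ ≡ 0
    empty c with S w c v in s
    ... | false = refl
    ... | true = contradiction (trans (sym ev) (S-elim s)) λ ()
  ... | just a | just b with a ≟ b
  ...   | yes refl = ≤-trans (∑-mono le) (≤-reflexive (trans (∑-labels w u) (cong (⟦_⟧ ∘ is-just) eu)))
    where
    le : ∀ c → ⟦ S w c u ⟧ * ⟦ S w c v ⟧ ≤ ⟦ S w c u ⟧
    le c = ≤-trans (*-monoʳ-≤ ⟦ S w c u ⟧ ⟦ S w c v ⟧≤1) (≤-reflexive (*-identityʳ _))
  ...   | no a≢b = ≤-reflexive (cong suc (∑-zero none))
    where
    none : ∀ c → ⟦ S w c u ⟧ * ⟦ S w c v ⟧ ≡ 0
    none c with S w c u in s | S w c v in s'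
    ... | false | _ = refl
    ... | true | false = refl
    ... | true | true = contradiction (just-injective (trans (sym eu) (trans (S-elim s) (trans (sym (S-elim s')) ev)))) a≢b

  ∑∑-swap : ∀ {m} (f : Fin m → Fin k → Fin k → ℕ) → ∑∑ (λ u v → ∑ (λ c → f c u v)) ≡ ∑ (λ c → ∑∑ (f c))
  ∑∑-swap f = trans (∑-cong (λ u → ∑-comm (λ v c → f c u v))) (∑-comm _)

  T : Fin k → ℕ
  T w = ∑∑ (split-pair w)

  squares : Fin k → ℕ
  squares w = ∑ (λ c → # (S w c) * # (S w c))

  T+squares : ∀ w → T w + squares w ≤ d w * d w
  T+squares w = begin
    T w + squares w                                               ≡⟨ cong (T w +_) (∑-cong (λ c → sym (∑∑-product (λ u → ⟦ S w c u ⟧)))) ⟩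
    T w + ∑ (λ c → ∑∑ (λ u v → ⟦ S w c u ⟧ * ⟦ S w c v ⟧))      ≡⟨ cong (T w +_) (sym (∑∑-swap (λ c u v → ⟦ S w c u ⟧ * ⟦ S w c v ⟧))) ⟩
    T w + ∑∑ (same-pair w)                                    ≡⟨ ∑∑-distrib-+ _ _ ⟨
    ∑∑ (λ u v → split-pair w u v + same-pair w u v)           ≤⟨ ∑-mono (λ u → ∑-mono (λ v → pairs-at w u v)) ⟩
    ∑∑ (λ u v → ⟦ R w u ⟧ * ⟦ R w v ⟧)                          ≡⟨ ∑∑-product (λ u → ⟦ R w u ⟧) ⟩
    d w * d w ∎
    where open ≤-Reasoning

  2ab≤a²+b² : ∀ a b → 2 * (a * b) ≤ a * a + b * b
  2ab≤a²+b² a b with ≤-total a b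
  ... | inj₁ le with m≤n⇒∃[o]m+o≡n le
  ...   | o , refl = ≤-trans (m≤m+n _ (o * o)) (≤-reflexive (solve 2 (λ a o → con 2 :* (a :* (a :+ o)) :+ o :* o := a :* a :+ (a :+ o) :* (a :+ o)) refl a o))
  2ab≤a²+b² a b | inj₂ le with m≤n⇒∃[o]m+o≡n le
  ...   | o , refl = ≤-trans (m≤m+n _ (o * o)) (≤-reflexive (solve 2 (λ b o → con 2 :* ((b :+ o) :* b) :+ o :* o := (b :+ o) :* (b :+ o) :+ b :* b) refl b o))

  cauchy : ∀ {m} (f : Fin m → ℕ) → ∑ f * ∑ f ≤ m * ∑ (λ c → f c * f c)
  cauchy {m} f = *-cancelˡ-≤ 2 (begin
    2 * (∑ f * ∑ f)                                        ≡⟨ cong (2 *_) (*-distribˡ-∑ (∑ f) f) ⟩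
    2 * ∑ (λ c → ∑ f * f c)                                ≡⟨ *-distribˡ-∑ 2 _ ⟩
    ∑ (λ c → 2 * (∑ f * f c))                              ≡⟨ ∑-cong (λ c → trans (cong (2 *_) (trans (*-comm (∑ f) (f c)) (*-distribˡ-∑ (f c) f))) (*-distribˡ-∑ 2 _)) ⟩
    ∑ (λ c → ∑ (λ c' → 2 * (f c * f c')))                  ≤⟨ ∑-mono (λ c → ∑-mono (λ c' → 2ab≤a²+b² (f c) (f c'))) ⟩
    ∑ (λ c → ∑ (λ c' → f c * f c + f c' * f c'))           ≡⟨ ∑-cong (λ c → trans (∑-distrib-+ _ _) (cong (_+ Q) (∑-const m (f c * f c)))) ⟩
    ∑ (λ c → m * (f c * f c) + Q)                          ≡⟨ trans (∑-distrib-+ _ _) (cong₂ _+_ (sym (*-distribˡ-∑ m _)) (∑-const m Q)) ⟩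
    m * Q + m * Q                                          ≡⟨ cong (m * Q +_) (sym (+-identityʳ (m * Q))) ⟩
    2 * (m * Q) ∎)
    where
    open ≤-Reasoning
    Q = ∑ (λ c → f c * f c)

  all-pairs : k * k ≤ k + (edges R + ∑ T)
  all-pairs = begin
    k * k                                                              ≡⟨ trans (cong (k *_) (sym (*-identityʳ k))) (sym (trans (∑-cong {k} (λ _ → ∑-const k 1)) (∑-const k (k * 1)))) ⟩
    ∑∑ (λ _ _ → 1)                                                 ≤⟨ ∑-mono (λ u → ∑-mono (λ v → pair u v)) ⟩
    ∑∑ (λ u v → δ u v + (⟦ R u v ⟧ + ∑ (λ w → split-pair w u v)))   ≡⟨ trans (∑∑-distrib-+ _ _) (cong (∑∑ δ +_) (trans (∑∑-distrib-+ _ _) (cong (edges R +_) (∑∑-swap split-pair)))) ⟩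
    ∑∑ δ + (edges R + ∑ T)                                         ≤⟨ +-monoˡ-≤ (edges R + ∑ T) (≤-trans (∑-≤-const 1 (λ u → ≤-reflexive (∑-δ u))) (≤-reflexive (*-identityʳ k))) ⟩
    k + (edges R + ∑ T) ∎
    where
    open ≤-Reasoning
    pair : ∀ u v → 1 ≤ δ u v + (⟦ R u v ⟧ + ∑ (λ w → split-pair w u v))
    pair u v with u ≟ v
    ... | yes _ = s≤s z≤n
    ... | no ne with sees ne
    ...   | inj₁ r = ≤-trans (≤-reflexive (cong ⟦_⟧ (sym r))) (m≤m+n _ _)
    ...   | inj₂ (w , a , b , a≢b , ea , eb) = ≤-trans (≤-trans (≤-reflexive (sym one)) (term≤∑ (λ w → split-pair w u v) w)) (m≤n+m _ ⟦ R u v ⟧)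
      where
      one : split-pair w u v ≡ 1
      one rewrite ea | eb | dec-false (a ≟ b) a≢b = refl

  module _ (three : 3 ≤ k) where

    #-all : # {k} (λ _ → true) ≡ k
    #-all = trans (∑-const k 1) (*-identityʳ k)

    three-all : 3 ≤ # {k} (λ _ → true)
    three-all = ≤-trans three (≤-reflexive (sym #-all))

    few-edges : edges R + 12 ≤ 6 * k
    few-edges = ≤-trans (edge-bound G three-all emb) (≤-reflexive (cong (6 *_) #-all))

    -- The vertices A of degree more than 6 have at most 2k - 4 edges to the other vertices and
    -- at most 3|A| edges among themselves.
    excess : ∑ (λ w → d w ∸ 6) + 4 ≤ 2 * k
    excess = *-cancelˡ-≤ 2 (begin
        2 * (∑ (λ w → d w ∸ 6) + 4)                  ≤⟨ *-monoʳ-≤ 2 (+-monoˡ-≤ 4 excess≤out) ⟩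
        2 * (out + 4)                                ≡⟨ *-distribˡ-+ 2 out 4 ⟩
        2 * out + 8                                  ≡⟨ cong (_+ 8) (trans (cong (out +_) (+-identityʳ out)) (cong (out +_) out≡in)) ⟩
        out + in' + 8                                ≡⟨ cong (_+ 8) (sym (∑∑-distrib-+ _ _)) ⟩
        ∑∑ (λ u v → ⟦ A u ∧ not (A v) ∧ R u v ⟧ + ⟦ not (A u) ∧ A v ∧ R u v ⟧) + 8  ≡⟨ cong (_+ 8) (∑-cong (λ u → ∑-cong (λ v → cut≡ u v))) ⟩
        edges (λ u v → R u v ∧ (A u xor A v)) + 8     ≤⟨ cut-bound G three-all A (λ {u} r → emb (proj₁ (∧-elim r)) , proj₂ (∧-elim {R u _} r)) ⟩
        4 * # {k} (λ _ → true)                       ≡⟨ trans (cong (4 *_) #-all) (*-assoc 2 2 k) ⟩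
        2 * (2 * k) ∎)
      where
      open ≤-Reasoning
      A : Fin k → Bool
      A w = does (7 ≤? d w)
      out in' inner : ℕ
      out = ∑∑ (λ u v → ⟦ A u ∧ not (A v) ∧ R u v ⟧)
      in' = ∑∑ (λ u v → ⟦ not (A u) ∧ A v ∧ R u v ⟧)
      inner = edges (λ u v → A u ∧ A v ∧ R u v)
      cut≡ : ∀ u v → ⟦ A u ∧ not (A v) ∧ R u v ⟧ + ⟦ not (A u) ∧ A v ∧ R u v ⟧ ≡ ⟦ R u v ∧ (A u xor A v) ⟧
      cut≡ u v with A u | A v | R u v
      ... | true | true | true = refl
      ... | true | true | false = refl
      ... | true | false | true = refl
      ... | true | false | false = refl
      ... | false | true | true = refl
      ... | false | true | false = refl
      ... | false | false | true = refl
      ... | false | false | false = refl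
      out≡in : out ≡ in'
      out≡in = trans (∑-comm _) (∑-cong (λ v → ∑-cong (λ u → swap u v)))
        where
        R-swap : ∀ u v → R u v ≡ R v u
        R-swap u v with R u v in e | R v u in e'
        ... | true | true = refl
        ... | false | false = refl
        ... | true | false = ⊥-elim (true≢false (symm e) e')
        ... | false | true = ⊥-elim (true≢false (symm e') e)
        swap : ∀ u v → ⟦ A u ∧ not (A v) ∧ R u v ⟧ ≡ ⟦ not (A v) ∧ A u ∧ R v u ⟧
        swap u v rewrite R-swap u v with A u | A v
        ... | true | true = refl
        ... | true | false = refl
        ... | false | true = refl
        ... | false | false = refl
      inner≤ : inner ≤ 6 * # A
      inner≤ with 3 ≤? # A
      -- With an empty target set, `absorb` contracts everything else away; unlike deletion this
      -- keeps the graph connected, and the adjacencies within `A` survive.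
      ... | yes three-A with absorb {B = A} (λ _ → false) (λ _ → ⊥) (λ ()) (≤-trans (n≤1+n 2) three-A) G (λ _ → refl)
      ...   | G' , keep , _ = ≤-trans (m≤m+n _ 12) (edge-bound G' three-A within)
        where
        within : ∀ {u v} → A u ∧ A v ∧ R u v ≡ true → Plane.Adj G' u v
        within {u} {v} r with ∧-elim {A u} r
        ... | au , r' with ∧-elim {A v} r'
        ...   | av , r'' = keep au av (emb r'')
      inner≤ | no few = begin
          inner                             ≤⟨ ∑-mono row ⟩
          ∑ (λ u → # A * ⟦ A u ⟧)            ≡⟨ *-distribˡ-∑ (# A) _ ⟨
          # A * # A                         ≤⟨ *-monoˡ-≤ (# A) (≤-trans (≤-pred (≰⇒> few)) (≤ᵇ⇒≤ 2 6 _)) ⟩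
          6 * # A ∎
        where
        row : ∀ u → ∑ (λ v → ⟦ A u ∧ A v ∧ R u v ⟧) ≤ # A * ⟦ A u ⟧
        row u with A u
        ... | false = ≤-trans (≤-reflexive (∑-zero {k} (λ _ → refl))) z≤n
        ... | true = ≤-trans (#-mono {P = λ v → A v ∧ R u v} {Q = A} (λ v e → proj₁ (∧-elim e))) (≤-reflexive (sym (*-identityʳ _)))
      excess≤out : ∑ (λ w → d w ∸ 6) ≤ out
      excess≤out = +-cancelʳ-≤ (6 * # A) _ _ (begin
          ∑ (λ w → d w ∸ 6) + 6 * # A                  ≡⟨ cong (∑ (λ w → d w ∸ 6) +_) (*-distribˡ-∑ 6 _) ⟩
          ∑ (λ w → d w ∸ 6) + ∑ (λ w → 6 * ⟦ A w ⟧)     ≡⟨ ∑-distrib-+ _ _ ⟨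
          ∑ (λ w → (d w ∸ 6) + 6 * ⟦ A w ⟧)             ≤⟨ ∑-mono at ⟩
          ∑ (λ u → ∑ (λ v → ⟦ A u ∧ not (A v) ∧ R u v ⟧ + ⟦ A u ∧ A v ∧ R u v ⟧))  ≡⟨ ∑∑-distrib-+ _ _ ⟩
          out + inner                                  ≤⟨ +-monoʳ-≤ out inner≤ ⟩
          out + 6 * # A ∎)
        where
        at : ∀ u → (d u ∸ 6) + 6 * ⟦ A u ⟧ ≤ ∑ (λ v → ⟦ A u ∧ not (A v) ∧ R u v ⟧ + ⟦ A u ∧ A v ∧ R u v ⟧)
        at u with A u in e
        ... | false = ≤-trans (≤-reflexive (trans (+-identityʳ (d u ∸ 6)) (m≤n⇒m∸n≡0 (≤-pred (≰⇒> (λ high → true≢false (dec-true (7 ≤? d u) high) e)))))) z≤n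
        ... | true = ≤-trans (≤-reflexive (m∸n+n≡m (≤-trans (n≤1+n 6) (does⇒ (7 ≤? d u) e)))) (∑-mono split)
          where
          split : ∀ v → ⟦ R u v ⟧ ≤ ⟦ not (A v) ∧ R u v ⟧ + ⟦ A v ∧ R u v ⟧
          split v with A v
          ... | true = ≤-refl
          ... | false = m≤m+n _ 0

    module _ {σ : ℕ} (σ-bound : ∀ w c → # (S w c) ≤ σ) where

      d≤ : ∀ w → d w ≤ p * σ
      d≤ w = ≤-trans (≤-reflexive (sym (d-split w))) (∑-≤-const σ (σ-bound w))

      -- Only the part of the degree above 6 is charged at the maximal degree, because its total is
      -- bounded by `excess`.
      d²≤ : ∀ w → d w * d w ≤ 6 * d w + (p * σ) * (d w ∸ 6)
      d²≤ w with d w ≤? 6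
      ... | yes le = ≤-trans (*-monoˡ-≤ (d w) le) (m≤m+n _ _)
      ... | no gt = begin
        d w * d w                             ≡⟨ cong (d w *_) (sym (m+[n∸m]≡n six≤)) ⟩
        d w * (6 + (d w ∸ 6))                 ≡⟨ *-distribˡ-+ (d w) 6 _ ⟩
        d w * 6 + d w * (d w ∸ 6)             ≤⟨ +-mono-≤ (≤-reflexive (*-comm (d w) 6)) (*-monoˡ-≤ (d w ∸ 6) (d≤ w)) ⟩
        6 * d w + p * σ * (d w ∸ 6) ∎
        where
        open ≤-Reasoning
        six≤ : 6 ≤ d w
        six≤ = ≤-trans (n≤1+n 6) (≰⇒> gt)

      -- By Cauchy the pairs within the classes of `w` are at least a fraction 1/p of all pairs of
      -- neighbours, which leaves at most a fraction (p - 1)/p to be separated; everything is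
      -- multiplied by `p` to avoid division.
      pT≤ : ∀ {q} → p ≡ suc q → ∀ w → p * T w ≤ q * (d w * d w)
      pT≤ {q} refl w = +-cancelˡ-≤ (d w * d w) _ _ (begin
        d w * d w + p * T w               ≡⟨ cong (_+ p * T w) (cong₂ _*_ (sym (d-split w)) (sym (d-split w))) ⟩
        ∑ s * ∑ s + p * T w               ≤⟨ +-monoˡ-≤ (p * T w) (cauchy s) ⟩
        p * squares w + p * T w           ≡⟨ *-distribˡ-+ p (squares w) (T w) ⟨
        p * (squares w + T w)             ≡⟨ cong (p *_) (+-comm (squares w) (T w)) ⟩
        p * (T w + squares w)             ≤⟨ *-monoʳ-≤ p (T+squares w) ⟩
        p * (d w * d w) ∎)
        where
        open ≤-Reasoning
        s : Fin p → ℕ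
        s c = # (S w c)

      total : ∀ {q} → p ≡ suc q → p * (k * k) ≤ p * k + (p * edges R + q * (6 * edges R + p * σ * ∑ (λ w → d w ∸ 6)))
      total {q} eq = begin
        p * (k * k)                                      ≤⟨ *-monoʳ-≤ p all-pairs ⟩
        p * (k + (edges R + ∑ T))                        ≡⟨ trans (*-distribˡ-+ p k _) (cong (p * k +_) (*-distribˡ-+ p (edges R) (∑ T))) ⟩
        p * k + (p * edges R + p * ∑ T)                  ≤⟨ +-monoʳ-≤ (p * k) (+-monoʳ-≤ (p * edges R) bound) ⟩
        p * k + (p * edges R + q * (6 * edges R + p * σ * ∑ (λ w → d w ∸ 6))) ∎
        where
        open ≤-Reasoning
        bound : p * ∑ T ≤ q * (6 * edges R + p * σ * ∑ (λ w → d w ∸ 6))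
        bound = begin
          p * ∑ T                                       ≡⟨ *-distribˡ-∑ p T ⟩
          ∑ (λ w → p * T w)                             ≤⟨ ∑-mono (λ w → ≤-trans (pT≤ eq w) (*-monoʳ-≤ q (d²≤ w))) ⟩
          ∑ (λ w → q * (6 * d w + p * σ * (d w ∸ 6)))    ≡⟨ *-distribˡ-∑ q _ ⟨
          q * ∑ (λ w → 6 * d w + p * σ * (d w ∸ 6))      ≡⟨ cong (q *_) (trans (∑-distrib-+ _ _) (cong₂ _+_ (sym (*-distribˡ-∑ 6 d)) (sym (*-distribˡ-∑ (p * σ) _)))) ⟩
          q * (6 * edges R + p * σ * ∑ (λ w → d w ∸ 6)) ∎

-- The hypotheses give 2k² + 176 ≤ 90k with 176 = 8 times 12 + 20 times 4. This fails at 43 and 44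
-- by computation, and from 45 on because 2k² is already at least 90k.
no-solution-2 : ∀ {k e x} → e + 12 ≤ 6 * k → x + 4 ≤ 2 * k → 43 ≤ k →
                ¬ (2 * (k * k) ≤ 2 * k + (2 * e + 1 * (6 * e + 2 * 10 * x)))
no-solution-2 {k} {e} {x} he hx hk le = cases (m≤n⇒m<n∨m≡n hk)
  where
  collect : ∀ a b → 2 * k + (2 * e + 1 * (6 * e + 2 * 10 * x)) + (8 * a + 20 * b) ≡ 2 * k + (8 * (e + a) + 20 * (x + b))
  collect = solve 5 (λ k e x a b → con 2 :* k :+ (con 2 :* e :+ con 1 :* (con 6 :* e :+ con 2 :* con 10 :* x)) :+ (con 8 :* a :+ con 20 :* b) :=
                                   con 2 :* k :+ (con 8 :* (e :+ a) :+ con 20 :* (x :+ b))) refl k e x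
  sum-up : 2 * k + (8 * (6 * k) + 20 * (2 * k)) ≡ 90 * k
  sum-up = solve 1 (λ k → con 2 :* k :+ (con 8 :* (con 6 :* k) :+ con 20 :* (con 2 :* k)) := con 90 :* k) refl k
  bound : 2 * (k * k) + 176 ≤ 90 * k
  bound = ≤-trans (+-monoˡ-≤ 176 le) (≤-trans (≤-reflexive (collect 12 4))
            (≤-trans (+-monoʳ-≤ (2 * k) (+-mono-≤ (*-monoʳ-≤ 8 he) (*-monoʳ-≤ 20 hx))) (≤-reflexive sum-up)))
  cases : 43 < k ⊎ 43 ≡ k → ⊥
  cases (inj₂ refl) = ≤⇒≤ᵇ bound
  cases (inj₁ hk') with m≤n⇒m<n∨m≡n hk'
  ... | inj₂ refl = ≤⇒≤ᵇ bound
  ... | inj₁ hk″ = m+1+n≰m (90 * k) (≤-trans (+-monoˡ-≤ 176 (≤-trans (≤-reflexive (*-assoc 2 45 k)) (*-monoʳ-≤ 2 (*-monoˡ-≤ k hk″)))) bound)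

no-solution-3 : ∀ r {k e x} → let p = 3 + r in e ≤ 6 * k → x ≤ 2 * k → 9 * (p * p) + 2 * p + 3 ≤ k →
                ¬ (p * (k * k) ≤ p * k + (p * e + (2 + r) * (6 * e + p * (1 + p * 4) * x)))
no-solution-3 r {k} {e} {x} he hx hk le = <⇒≱ smaller (begin
    k * (p * k)                                                   ≡⟨ solve 2 (λ k p → k :* (p :* k) := p :* (k :* k)) refl k p ⟩
    p * (k * k)                                                   ≤⟨ le ⟩
    p * k + (p * e + q * (6 * e + p * (1 + p * 4) * x))           ≤⟨ +-monoʳ-≤ (p * k) (+-mono-≤ (*-monoʳ-≤ p he) (*-monoʳ-≤ q (+-mono-≤ (*-monoʳ-≤ 6 he) (*-monoʳ-≤ (p * (1 + p * 4)) hx)))) ⟩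
    p * k + (p * (6 * k) + q * (6 * (6 * k) + p * (1 + p * 4) * (2 * k)))
      ≡⟨ solve 3 (λ k p q → p :* k :+ (p :* (con 6 :* k) :+ q :* (con 6 :* (con 6 :* k) :+ p :* (con 1 :+ p :* con 4) :* (con 2 :* k))) :=
                  k :* (con 7 :* p :+ q :* (con 36 :+ con 2 :* (p :* (con 1 :+ p :* con 4))))) refl k p q ⟩
    k * (7 * p + q * (36 + 2 * (p * (1 + p * 4)))) ∎)
  where
  open ≤-Reasoning
  p = 3 + r
  q = 2 + r
  k>0 : 0 < k
  k>0 = ≤-trans (≤-trans (s≤s z≤n) (m≤n+m 3 (9 * (p * p) + 2 * p))) hk
  gap : 7 * p + q * (36 + 2 * (p * (1 + p * 4))) < p * k
  gap = begin-strict
    -- The exact difference of the two sides, written in r = p - 3 so that its coefficients are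
    -- positive. It vanishes at p = 2, which is therefore treated apart.
    7 * p + q * (36 + 2 * (p * (1 + p * 4)))              <⟨ m<m+n _ {21 + (37 * r + (17 * (r * r) + r * (r * r)))} (s≤s z≤n) ⟩
    7 * p + q * (36 + 2 * (p * (1 + p * 4))) + (21 + (37 * r + (17 * (r * r) + r * (r * r))))
      ≡⟨ solve 1 (λ r → let p = con 3 :+ r ; q = con 2 :+ r in
           con 7 :* p :+ q :* (con 36 :+ con 2 :* (p :* (con 1 :+ p :* con 4))) :+ (con 21 :+ (con 37 :* r :+ (con 17 :* (r :* r) :+ r :* (r :* r)))) :=
           p :* (con 9 :* (p :* p) :+ con 2 :* p :+ con 3)) refl r ⟩
    p * (9 * (p * p) + 2 * p + 3)                         ≤⟨ *-monoʳ-≤ p hk ⟩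
    p * k ∎
  smaller : k * (7 * p + q * (36 + 2 * (p * (1 + p * 4)))) < k * (p * k)
  smaller = *-monoʳ-< k {{>-nonZero k>0}} gap

module _ {p k : ℕ} (lab : Fin k → Fin k → Maybe (Fin p)) (G : Plane {k} (λ _ → true))
  (emb : ∀ {u v} → is-just (lab u v) ≡ true → Plane.Adj G u v)
  (symm : ∀ {u v} → is-just (lab u v) ≡ true → is-just (lab v u) ≡ true)
  (sees : ∀ {u v} → u ≢ v → is-just (lab u v) ≡ true ⊎
          ∃ λ w → ∃ λ a → ∃ λ b → a ≢ b × lab w u ≡ just a × lab w v ≡ just b) where
  open Clique lab G emb symm sees

  order-bound : 2 ≤ p → k ≤ 9 * (p * p) + 2 * p + 2
  order-bound two with k ≤? 9 * (p * p) + 2 * p + 2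
  ... | yes le = le
  ... | no gt = ⊥-elim (large p refl two)
    where
    big : 9 * (p * p) + 2 * p + 3 ≤ k
    big = ≤-trans (≤-reflexive (+-suc (9 * (p * p) + 2 * p) 2)) (≰⇒> gt)
    three : 3 ≤ k
    three = ≤-trans (m≤n+m 3 _) big
    large : ∀ p' → p ≡ p' → 2 ≤ p' → ⊥
    large zero _ ()
    large (suc zero) _ (s≤s ())
    -- Here `1 + p * 4` is 9, so the bound 10 for undominated classes is the larger one; from three
    -- labels on it is the other way round.
    large (suc (suc zero)) refl _ = no-solution-2 (few-edges three) (excess three) big
      (total three (class-bound ≤-refl (≤ᵇ⇒≤ 9 10 _)) refl)
    large (suc (suc (suc r))) refl _ = no-solution-3 r (≤-trans (m≤m+n _ 12) (few-edges three)) (≤-trans (m≤m+n _ 4) (excess three)) big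
      (total three (class-bound (≤-trans (≤ᵇ⇒≤ 10 13 _) (s≤s (*-monoˡ-≤ 4 (m≤m+n 3 r)))) ≤-refl) refl)

-- From rotation systems to connected plane multigraphs

module Bridging {m : ℕ} {α : Fin m → Fin m} {α-involutive : ∀ x → α (α x) ≡ x} where
  open Darts α α-involutive

  -- A new edge between the vertices of x₁ and x₂ merges the face labels of their corners.
  module AddEdge {n} {lv : Fin n → Bool} (S : Map lv) (d : Fin m)
    (d-dead : Map.live S d ≡ false) (d̄-dead : Map.live S (α d) ≡ false)
    (apart : Map.src S d ≢ Map.src S (α d))
    {x₁ x₂ : Fin m} (l₁ : Map.live S x₁ ≡ true) (l₂ : Map.live S x₂ ≡ true)
    (s₁ : Map.src S x₁ ≡ Map.src S d) (s₂ : Map.src S x₂ ≡ Map.src S (α d)) where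
    open Map S

    d̄ = α d
    f₁ = fc (α x₁)
    f₂ = fc (α x₂)

    d≢d̄ : d ≢ d̄
    d≢d̄ e = apart (cong src e)

    data Live⁺ (x : Fin m) : Set where
      is-d  : x ≡ d → Live⁺ x
      is-d̄ : x ≡ d̄ → Live⁺ x
      was   : live x ≡ true → Live⁺ x

    opaque

      live⁺ : Fin m → Bool
      live⁺ x = does (x ≟ d) ∨ does (x ≟ d̄) ∨ live x

      live⁺-elim : ∀ {x} → live⁺ x ≡ true → Live⁺ x
      live⁺-elim {x} e with x ≟ d | x ≟ d̄
      ... | yes q | _ = is-d q
      ... | no _ | yes q = is-d̄ q
      ... | no _ | no _ = was e

      live⁺-intro : ∀ {x} → Live⁺ x → live⁺ x ≡ true
      live⁺-intro {x} (is-d q) rewrite dec-true (x ≟ d) q = refl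
      live⁺-intro {x} (is-d̄ q) rewrite dec-true (x ≟ d̄) q = ∨-zeroʳ _
      live⁺-intro {x} (was l) rewrite l = trans (cong (does (x ≟ d) ∨_) (∨-zeroʳ _)) (∨-zeroʳ _)

    ≢d : ∀ {x} → live x ≡ true → x ≢ d
    ≢d l refl = true≢false l d-dead

    ≢d̄ : ∀ {x} → live x ≡ true → x ≢ d̄
    ≢d̄ l refl = true≢false l d̄-dead

    #live⁺ : # live⁺ ≤ 2 + # live
    #live⁺ = begin
      # live⁺                                    ≤⟨ ∑-mono le ⟩
      ∑ (λ x → δ d x + (δ d̄ x + ⟦ live x ⟧))      ≡⟨ trans (∑-distrib-+ _ _) (cong (∑ (δ d) +_) (∑-distrib-+ _ _)) ⟩
      ∑ (δ d) + (∑ (δ d̄) + # live)               ≤⟨ +-mono-≤ (one d) (+-monoˡ-≤ (# live) (one d̄)) ⟩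
      2 + # live ∎
      where
      open ≤-Reasoning
      one : ∀ (y : Fin m) → ∑ (δ y) ≤ 1
      one y = ≤-reflexive (∑-δ y)
      le : ∀ x → ⟦ live⁺ x ⟧ ≤ δ d x + (δ d̄ x + ⟦ live x ⟧)
      le x with live⁺ x in e
      ... | false = z≤n
      ... | true with live⁺-elim e
      ...   | is-d refl = ≤-trans (≤-reflexive (sym (δ-refl d))) (m≤m+n _ _)
      ...   | is-d̄ refl = ≤-trans (≤-trans (≤-reflexive (sym (δ-refl d̄))) (m≤m+n _ ⟦ live d̄ ⟧)) (m≤n+m _ (δ d d̄))
      ...   | was l = ≤-trans (≤-trans (≤-reflexive (cong ⟦_⟧ (sym l))) (m≤n+m _ (δ d̄ x))) (m≤n+m _ (δ d x))

    opaque

      -- The new dart `d` is inserted right after `x₁` in the rotation, and `d̄` right after `x₂`.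
      -- The dart following `x` around its vertex is the one that a face walk takes after `α x`,
      -- hence the case distinction at `α x₁` and `α x₂`.
      φ⁺ : Fin m → Fin m
      φ⁺ y = if does (y ≟ α x₁) then d else if does (y ≟ α x₂) then d̄ else
             if does (y ≟ d) then φ (α x₂) else if does (y ≟ d̄) then φ (α x₁) else φ y

      φ⁺-1 : φ⁺ (α x₁) ≡ d
      φ⁺-1 rewrite dec-true (α x₁ ≟ α x₁) refl = refl

      φ⁺-2 : φ⁺ (α x₂) ≡ d̄
      φ⁺-2 rewrite dec-true (α x₂ ≟ α x₂) refl | dec-false (α x₂ ≟ α x₁) (λ e → apart (trans (sym s₁) (trans (cong src (trans (sym (α-involutive x₁)) (trans (cong α (sym e)) (α-involutive x₂)))) s₂))) = refl

      φ⁺-d : φ⁺ d ≡ φ (α x₂)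
      φ⁺-d rewrite dec-false (d ≟ α x₁) (≢-sym′ (≢d (live-α l₁))) | dec-false (d ≟ α x₂) (≢-sym′ (≢d (live-α l₂))) | dec-true (d ≟ d) refl = refl

      φ⁺-d̄ : φ⁺ d̄ ≡ φ (α x₁)
      φ⁺-d̄ rewrite dec-false (d̄ ≟ α x₁) (≢-sym′ (≢d̄ (live-α l₁))) | dec-false (d̄ ≟ α x₂) (≢-sym′ (≢d̄ (live-α l₂)))
                  | dec-false (d̄ ≟ d) (≢-sym′ d≢d̄) | dec-true (d̄ ≟ d̄) refl = refl

      φ⁺-old : ∀ {y} → live y ≡ true → y ≢ α x₁ → y ≢ α x₂ → φ⁺ y ≡ φ y
      φ⁺-old {y} l n₁ n₂ rewrite dec-false (y ≟ α x₁) n₁ | dec-false (y ≟ α x₂) n₂ | dec-false (y ≟ d) (≢d l) | dec-false (y ≟ d̄) (≢d̄ l) = refl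

    φ⁺-elim : ∀ (P : Fin m → Fin m → Set) → P (α x₁) d → P (α x₂) d̄ → P d (φ (α x₂)) → P d̄ (φ (α x₁)) →
              (∀ {y} → live y ≡ true → P y (φ y)) → ∀ {y} → live⁺ y ≡ true → P y (φ⁺ y)
    φ⁺-elim P p₁ p₂ pd pd̄ po {y} l with live⁺-elim l
    ... | is-d refl = subst (P d) (sym φ⁺-d) pd
    ... | is-d̄ refl = subst (P d̄) (sym φ⁺-d̄) pd̄
    ... | was ly with y ≟ α x₁ | y ≟ α x₂
    ...   | yes refl | _ = subst (P (α x₁)) (sym φ⁺-1) p₁
    ...   | no _ | yes refl = subst (P (α x₂)) (sym φ⁺-2) p₂
    ...   | no n₁ | no n₂ = subst (P y) (sym (φ⁺-old ly n₁ n₂)) (po ly)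

    fc⁺ : Fin m → Fin m
    fc⁺ y = if does (y ≟ d) ∨ does (y ≟ d̄) then f₁ else redirect f₂ f₁ (fc y)

    fc⁺-d : fc⁺ d ≡ f₁
    fc⁺-d rewrite dec-true (d ≟ d) refl = refl

    fc⁺-d̄ : fc⁺ d̄ ≡ f₁
    fc⁺-d̄ rewrite dec-true (d̄ ≟ d̄) refl | ∨-zeroʳ (does (d̄ ≟ d)) = refl

    fc⁺-old : ∀ {y} → live y ≡ true → fc⁺ y ≡ redirect f₂ f₁ (fc y)
    fc⁺-old {y} l rewrite dec-false (y ≟ d) (≢d l) | dec-false (y ≟ d̄) (≢d̄ l) = refl

    fc⁺-f₁ : ∀ {y} → live y ≡ true → fc y ≡ f₁ → fc⁺ y ≡ f₁
    fc⁺-f₁ l e = trans (fc⁺-old l) (redirect-elim (_≡ f₁) (λ _ → refl) (λ _ → e))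

    fc⁺-f₂ : ∀ {y} → live y ≡ true → fc y ≡ f₂ → fc⁺ y ≡ f₁
    fc⁺-f₂ l e = trans (fc⁺-old l) (trans (cong (redirect f₂ f₁) e) (redirect-≡ f₂ f₁))

    opaque

      fr⁺ : Fin m → Bool
      fr⁺ l = if does (f₁ ≟ f₂) then fr l else remove f₂ fr l

      #fr⁺ : # fr ≤ suc (# fr⁺)
      #fr⁺ with f₁ ≟ f₂
      ... | yes e = n≤1+n _
      ... | no ne = #-remove-≤

      fr⁺-f₁ : fr⁺ f₁ ≡ true
      fr⁺-f₁ with f₁ ≟ f₂
      ... | yes _ = fr-fc (live-α l₁)
      ... | no ne = remove-intro ne (fr-fc (live-α l₁))

      fr⁺-intro : ∀ {l} → (l ≡ f₂ → f₁ ≡ f₂) → fr l ≡ true → fr⁺ l ≡ true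
      fr⁺-intro h p with f₁ ≟ f₂
      ... | yes _ = p
      ... | no ne = remove-intro (λ e → ne (h e)) p

      fr⁺-elim : ∀ {l} → fr⁺ l ≡ true → fr l ≡ true × (l ≡ f₂ → f₁ ≡ f₂)
      fr⁺-elim p with f₁ ≟ f₂
      ... | yes e = p , (λ _ → e)
      ... | no ne with remove-elim p
      ...   | ne' , q = q , (λ e → contradiction e ne')

    fr⁺-fc : ∀ {x} → live⁺ x ≡ true → fr⁺ (fc⁺ x) ≡ true
    fr⁺-fc l with live⁺-elim l
    ... | is-d refl = trans (cong fr⁺ fc⁺-d) fr⁺-f₁
    ... | is-d̄ refl = trans (cong fr⁺ fc⁺-d̄) fr⁺-f₁
    ... | was lx = trans (cong fr⁺ (fc⁺-old lx)) (redirect-elim (λ y → fr⁺ y ≡ true) (λ _ → fr⁺-f₁) other)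
      where
      other : fc _ ≢ f₂ → fr⁺ (fc _) ≡ true
      other ne = fr⁺-intro (λ e → contradiction e ne) (fr-fc lx)

    fr⁺-onto : ∀ {l} → fr⁺ l ≡ true → ∃ λ x → live⁺ x ≡ true × fc⁺ x ≡ l
    fr⁺-onto p with fr⁺-elim p
    ... | q , h with fr-onto q
    ...   | x , lx , refl = x , live⁺-intro (was lx) , trans (fc⁺-old lx) (redirect-elim (_≡ fc x) (λ e → trans (h e) (sym e)) (λ _ → refl))

    src-φα : ∀ {x} → live x ≡ true → src (φ (α x)) ≡ src x
    src-φα {x} l = trans (src-φ (live-α l)) (cong src (α-involutive x))

    vtx⁺ : (P : Fin m → Set) → (∀ {x} → live⁺ x ≡ true → P x → P (φ⁺ (α x))) →
           ∀ {x y} → live⁺ x ≡ true → live⁺ y ≡ true → src x ≡ src y → P x → P y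
    vtx⁺ P closed {x} {y} lx ly s p with live⁺-elim lx | live⁺-elim ly
    ... | is-d refl | is-d refl = p
    ... | is-d̄ refl | is-d̄ refl = p
    ... | is-d refl | is-d̄ refl = contradiction s apart
    ... | is-d̄ refl | is-d refl = contradiction (sym s) apart
    ... | lx' | ly' = to ly' (from lx' p)
      where
      P-x₁ : P x₁ → P d
      P-x₁ q = subst P φ⁺-1 (closed (live⁺-intro (was l₁)) q)
      P-x₂ : P x₂ → P d̄
      P-x₂ q = subst P φ⁺-2 (closed (live⁺-intro (was l₂)) q)
      P-d : P d → P (φ (α x₁))
      P-d q = subst P φ⁺-d̄ (closed (live⁺-intro (is-d refl)) q)
      P-d̄ : P d̄ → P (φ (α x₂))
      P-d̄ q = subst P (trans (cong φ⁺ (α-involutive d)) φ⁺-d) (closed (live⁺-intro (is-d̄ refl)) q)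
      closed-old : ∀ {z} → live z ≡ true → P z → P (φ (α z))
      closed-old {z} l q with z ≟ x₁ | z ≟ x₂
      ... | yes refl | _ = P-d (P-x₁ q)
      ... | no _ | yes refl = P-d̄ (P-x₂ q)
      ... | no n₁ | no n₂ = subst P (φ⁺-old (live-α l) (α-≢′ n₁) (α-≢′ n₂)) (closed (live⁺-intro (was l)) q)
      Old : Set
      Old = ∃ λ z → live z ≡ true × src z ≡ src y × P z
      from : Live⁺ x → P x → Old
      from (is-d refl) q = φ (α x₁) , live-φ (live-α l₁) , trans (src-φα l₁) (trans s₁ s) , P-d q
      from (is-d̄ refl) q = φ (α x₂) , live-φ (live-α l₂) , trans (src-φα l₂) (trans s₂ s) , P-d̄ q
      from (was l) q = x , l , s , q
      to : Live⁺ y → Old → P y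
      to (is-d refl) (z , lz , sz , q) = P-x₁ (vtx P closed-old lz l₁ (trans sz (sym s₁)) q)
      to (is-d̄ refl) (z , lz , sz , q) = P-x₂ (vtx P closed-old lz l₂ (trans sz (sym s₂)) q)
      to (was l) (z , lz , sz , q) = vtx P closed-old lz l sz q

    result : Map lv
    result = record
      { live = live⁺ ; src = src ; φ = φ⁺ ; fc = fc⁺ ; fr = fr⁺
      ; live-α = λ l → live-α⁺ (live⁺-elim l)
      ; live-φ = φ⁺-elim (λ _ y → live⁺ y ≡ true) (live⁺-intro (is-d refl)) (live⁺-intro (is-d̄ refl))
          (live⁺-intro (was (live-φ (live-α l₂)))) (live⁺-intro (was (live-φ (live-α l₁)))) (λ l → live⁺-intro (was (live-φ l)))
      ; src-φ = φ⁺-elim (λ x y → src y ≡ src (α x)) (trans (sym s₁) (cong src (sym (α-involutive x₁)))) (trans (sym s₂) (cong src (sym (α-involutive x₂))))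
          (trans (src-φα l₂) s₂) (trans (src-φα l₁) (trans s₁ (cong src (sym (α-involutive d))))) src-φ
      ; loopless = λ l → loopless⁺ (live⁺-elim l)
      ; fc-φ = φ⁺-elim (λ x y → fc⁺ y ≡ fc⁺ x) (trans fc⁺-d (sym (fc⁺-f₁ (live-α l₁) refl))) (trans fc⁺-d̄ (sym (fc⁺-f₂ (live-α l₂) refl)))
          (trans (fc⁺-f₂ (live-φ (live-α l₂)) (fc-φ (live-α l₂))) (sym fc⁺-d)) (trans (fc⁺-f₁ (live-φ (live-α l₁)) (fc-φ (live-α l₁))) (sym fc⁺-d̄))
          (λ l → trans (fc⁺-old (live-φ l)) (trans (cong (redirect f₂ f₁) (fc-φ l)) (sym (fc⁺-old l))))
      ; fr-fc = fr⁺-fc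
      ; fr-onto = fr⁺-onto
      ; lv-src = λ l → lv-src⁺ (live⁺-elim l)
      ; vtx = vtx⁺
      }
      where
      live-α⁺ : ∀ {x} → Live⁺ x → live⁺ (α x) ≡ true
      live-α⁺ (is-d refl) = live⁺-intro (is-d̄ refl)
      live-α⁺ (is-d̄ refl) = live⁺-intro (is-d (α-involutive d))
      live-α⁺ (was l) = live⁺-intro (was (live-α l))
      loopless⁺ : ∀ {x} → Live⁺ x → src x ≢ src (α x)
      loopless⁺ (is-d refl) = apart
      loopless⁺ (is-d̄ refl) e = apart (sym (trans e (cong src (α-involutive d))))
      loopless⁺ (was l) = loopless l
      lv-src⁺ : ∀ {x} → Live⁺ x → lv (src x) ≡ true
      lv-src⁺ (is-d refl) = trans (cong lv (sym s₁)) (lv-src l₁)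
      lv-src⁺ (is-d̄ refl) = trans (cong lv (sym s₂)) (lv-src l₂)
      lv-src⁺ (was l) = lv-src l

-- Sums over pairs, searches in lists, and iteration

opaque
  unfolding ∑

  ∑-++ : ∀ a {b} (f : Fin (a + b) → ℕ) → ∑ f ≡ ∑ (λ i → f (i ↑ˡ b)) + ∑ (λ i → f (a ↑ʳ i))
  ∑-++ zero f = refl
  ∑-++ (suc a) f = trans (cong (f zero +_) (∑-++ a (f ∘ suc))) (sym (+-assoc (f zero) _ _))

  ∑-combine : ∀ a {b} (f : Fin (a * b) → ℕ) → ∑ f ≡ ∑ (λ (i : Fin a) → ∑ (λ (j : Fin b) → f (combine i j)))
  ∑-combine zero f = refl
  ∑-combine (suc a) {b} f = trans (∑-++ b f) (cong (∑ (λ j → f (j ↑ˡ (a * b))) +_) (∑-combine a (λ i → f (b ↑ʳ i))))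

  sum-tabulate : ∀ {n} (f : Fin n → ℕ) → sum (tabulate f) ≡ ∑ f
  sum-tabulate {zero} f = refl
  sum-tabulate {suc n} f = cong (f zero +_) (sum-tabulate (f ∘ suc))

sum-allFin : ∀ {n} (f : Fin n → ℕ) → sum (map f (allFin n)) ≡ ∑ f
sum-allFin f = trans (cong sum (map-tabulate (λ i → i) f)) (sum-tabulate f)

any-elim : ∀ {A : Set} (p : A → Bool) xs → any p xs ≡ true → ∃ λ x → p x ≡ true
any-elim p (x ∷ xs) e with p x in q
... | true = x , q
... | false = any-elim p xs e

any-intro : ∀ {A : Set} (p : A → Bool) {x xs} → x ∈ xs → p x ≡ true → any p xs ≡ true
any-intro p {xs = _ ∷ xs} (here refl) q = cong (_∨ any p xs) q
any-intro p (there {x = y} i) q = trans (cong (p y ∨_) (any-intro p i q)) (∨-zeroʳ _)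

all-elim : ∀ {A : Set} (p : A → Bool) {x xs} → all p xs ≡ true → x ∈ xs → p x ≡ true
all-elim p {xs = x ∷ xs} e (here refl) = proj₁ (∧-elim e)
all-elim p {xs = x ∷ xs} e (there i) = all-elim p (proj₂ (∧-elim {p x} e)) i

all-intro : ∀ {A : Set} (p : A → Bool) xs → (∀ {x} → x ∈ xs → p x ≡ true) → all p xs ≡ true
all-intro p [] h = refl
all-intro p (x ∷ xs) h = ∧-intro (h (here refl)) (all-intro p xs (h ∘ there))

argmin : (g : ℕ → ℕ) → ∀ n → ∃ λ k → k ≤ n × (∀ {i} → i ≤ n → g k ≤ g i)
argmin g zero = 0 , z≤n , (λ { z≤n → ≤-refl })
argmin g (suc n) with argmin g n
... | k , k≤ , min with ≤-total (g k) (g (suc n))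
...   | inj₁ le = k , ≤-trans k≤ (n≤1+n n) , below
  where
  below : ∀ {i} → i ≤ suc n → g k ≤ g i
  below {i} i≤ with m≤n⇒m<n∨m≡n i≤
  ... | inj₁ lt = min (≤-pred lt)
  ... | inj₂ refl = le
...   | inj₂ ge = suc n , ≤-refl , below
  where
  below : ∀ {i} → i ≤ suc n → g (suc n) ≤ g i
  below {i} i≤ with m≤n⇒m<n∨m≡n i≤
  ... | inj₁ lt = ≤-trans ge (min (≤-pred lt))
  ... | inj₂ refl = ≤-refl

iter-+ : ∀ {A : Set} (f : A → A) a b x → iter f (a + b) x ≡ iter f a (iter f b x)
iter-+ f zero b x = refl
iter-+ f (suc a) b x = cong f (iter-+ f a b x)

iter-fixed : ∀ {A : Set} (f : A → A) t x → iter f t x ≡ x → ∀ q → iter f (q * t) x ≡ x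
iter-fixed f t x e zero = refl
iter-fixed f t x e (suc q) = trans (iter-+ f t (q * t) x) (trans (cong (iter f t) (iter-fixed f t x e q)) e)

module Encoding (N : ℕ) where

  opaque

    enc : Fin N → Fin N → Fin (N * N)
    enc = combine

    fst snd : Fin (N * N) → Fin N
    fst x = proj₁ (remQuot {N} N x)
    snd x = proj₂ (remQuot {N} N x)

    fst-enc : ∀ u v → fst (enc u v) ≡ u
    fst-enc u v = cong proj₁ (remQuot-combine u v)

    snd-enc : ∀ u v → snd (enc u v) ≡ v
    snd-enc u v = cong proj₂ (remQuot-combine u v)

    enc-pair : ∀ x → enc (fst x) (snd x) ≡ x
    enc-pair = combine-remQuot {N} N

    -- The numbering agrees with `code`, so the representative chosen by `faceRep` is the least dart
    -- of the face as a number.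
    toℕ-enc : ∀ u v → toℕ (enc u v) ≡ toℕ u * N + toℕ v
    toℕ-enc u v = trans (toℕ-combine u v) (cong (_+ toℕ v) (*-comm N (toℕ u)))

    ∑-enc : ∀ (f : Fin (N * N) → ℕ) → ∑ f ≡ ∑ (λ u → ∑ (λ v → f (enc u v)))
    ∑-enc = ∑-combine N

  pair : Fin (N * N) → Fin N × Fin N
  pair x = fst x , snd x

  pair-enc : ∀ u v → pair (enc u v) ≡ (u , v)
  pair-enc u v = cong₂ _,_ (fst-enc u v) (snd-enc u v)

  pair-injective : ∀ {x y} → fst x ≡ fst y → snd x ≡ snd y → x ≡ y
  pair-injective {x} {y} e e' = trans (sym (enc-pair x)) (trans (cong₂ enc e e') (enc-pair y))

  reverse : Fin (N * N) → Fin (N * N)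
  reverse x = enc (snd x) (fst x)

  reverse-involutive : ∀ x → reverse (reverse x) ≡ x
  reverse-involutive x = trans (cong₂ enc (snd-enc _ _) (fst-enc _ _)) (enc-pair x)

module FromGraph {N : ℕ} (Γ : Graph N) (ρ : Fin N → Fin N → Fin N) (rotation : IsRotation Γ ρ) where
  open Encoding N
  open Darts reverse reverse-involutive

  ρ-adj = proj₁ rotation
  ρ-injective = proj₁ (proj₂ rotation)
  ρ-transitive = proj₂ (proj₂ rotation)

  adj-symm : ∀ {u v} → adj Γ u v ≡ true → adj Γ v u ≡ true
  adj-symm {u} {v} a = trans (sym (Graph.sym Γ u v)) a

  dart : Fin (N * N) → Bool
  dart x = adj Γ (fst x) (snd x)

  next : Fin (N * N) → Fin (N * N)
  next x = enc (snd x) (ρ (snd x) (fst x))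

  dart-enc : ∀ {u v} → adj Γ u v ≡ true → dart (enc u v) ≡ true
  dart-enc {u} {v} a = trans (cong₂ (adj Γ) (fst-enc u v) (snd-enc u v)) a

  dart-next : ∀ {x} → dart x ≡ true → dart (next x) ≡ true
  dart-next a = dart-enc (ρ-adj _ _ (adj-symm a))

  next-injective : ∀ {x y} → dart x ≡ true → dart y ≡ true → next x ≡ next y → x ≡ y
  next-injective {x} {y} lx ly e = pair-injective
      (ρ-injective (snd x) (fst x) (fst y) (adj-symm lx) (adj-symm (trans (cong (adj Γ (fst y)) s) ly))
        (trans (sym (snd-enc _ _)) (trans (cong snd e) (trans (snd-enc _ _) (cong (λ v → ρ v (fst y)) (sym s)))))) s
    where
    s : snd x ≡ snd y
    s = trans (sym (fst-enc _ _)) (trans (cong fst e) (fst-enc _ _))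

  pair-iter : ∀ k x → pair (iter next k x) ≡ iter (Defs.φ Γ ρ) k (pair x)
  pair-iter zero x = refl
  pair-iter (suc k) x = trans (pair-enc _ _) (cong (Defs.φ Γ ρ) (pair-iter k x))

  code-pair : ∀ x → Defs.code Γ ρ (pair x) ≡ toℕ x
  code-pair x = trans (sym (toℕ-enc (fst x) (snd x))) (cong toℕ (enc-pair x))

  iter-dart : ∀ k {x} → dart x ≡ true → dart (iter next k x) ≡ true
  iter-dart zero l = l
  iter-dart (suc k) l = dart-next (iter-dart k l)

  cancel : ∀ i {t x} → dart x ≡ true → iter next i x ≡ iter next (i + t) x → x ≡ iter next t x
  cancel zero l e = e
  cancel (suc i) {t} l e = cancel i l (next-injective (iter-dart i l) (iter-dart (i + t) l) e)

  -- Two iterates agree by the pigeonhole principle, and since `next` is injective on darts their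
  -- common initial part cancels: every orbit is a cycle.
  period : ∀ {x} → dart x ≡ true → ∃ λ t → suc t ≤ N * N × iter next (suc t) x ≡ x
  period {x} l with pigeonhole (n<1+n (N * N)) (λ i → iter next (toℕ i) x)
  ... | i , j , i<j , e with m≤n⇒∃[o]m+o≡n i<j
  ...   | t , q = t , ≤-trans (m≤n+m (suc t) (toℕ i)) (≤-trans (≤-reflexive (trans (+-suc (toℕ i) t) q)) (≤-pred (toℕ<n j))) ,
                  sym (cancel (toℕ i) l (trans e (cong (λ k → iter next k x) (sym (trans (+-suc (toℕ i) t) q)))))

  -- `faceRep` inspects fewer than `N * N` iterates; reducing `k` modulo the period shows that these
  -- are the whole orbit.
  wrap : ∀ {x} → dart x ≡ true → ∀ k → ∃ λ i → i < N * N × iter next i x ≡ iter next k x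
  wrap {x} l k with period l
  ... | t , t≤ , e = k % suc t , ≤-trans (m%n<n k (suc t)) t≤ ,
        sym (trans (cong (λ k → iter next k x) (m≡m%n+[m/n]*n k (suc t)))
          (trans (iter-+ next (k % suc t) _ x) (cong (iter next (k % suc t)) (iter-fixed next (suc t) x e (k / suc t)))))

  record Least (x y : Fin (N * N)) : Set where
    field
      index : ∃ λ k → iter next k x ≡ y
      least : ∀ k → toℕ y ≤ toℕ (iter next k x)

  opaque

    -- The label of a dart is the least dart of its face, so that the labels in use are exactly the
    -- darts counted by `numFaces`.
    face : Fin (N * N) → Fin (N * N)
    face x = iter next (proj₁ (argmin (λ k → toℕ (iter next k x)) (N * N))) x

    face-least : ∀ {x} → dart x ≡ true → Least x (face x)
    face-least {x} l = record { index = proj₁ (argmin (λ k → toℕ (iter next k x)) (N * N)) , refl ; least = below }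
      where
      below : ∀ k → toℕ (face x) ≤ toℕ (iter next k x)
      below k with wrap l k
      ... | i , i< , e = ≤-trans (proj₂ (proj₂ (argmin (λ k → toℕ (iter next k x)) (N * N))) (<⇒≤ i<)) (≤-reflexive (cong toℕ e))

  face-unique : ∀ {x y} → dart x ≡ true → Least x y → face x ≡ y
  face-unique {x} {y} l h = toℕ-injective (≤-antisym
      (≤-trans (Least.least (face-least l) (proj₁ (Least.index h))) (≤-reflexive (cong toℕ (proj₂ (Least.index h)))))
      (≤-trans (Least.least h (proj₁ (Least.index (face-least l)))) (≤-reflexive (cong toℕ (proj₂ (Least.index (face-least l)))))))

  iter-next : ∀ k x → iter next k (next x) ≡ iter next (suc k) x
  iter-next k x = trans (sym (iter-+ next k 1 x)) (cong (λ i → iter next i x) (+-comm k 1))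

  face-next : ∀ {x} → dart x ≡ true → face (next x) ≡ face x
  face-next {x} l = sym (face-unique l (record { index = index' ; least = least' }))
    where
    open Least (face-least (dart-next l))
    index' : ∃ λ k → iter next k x ≡ face (next x)
    index' = suc (proj₁ index) , trans (sym (iter-next (proj₁ index) x)) (proj₂ index)
    least' : ∀ k → toℕ (face (next x)) ≤ toℕ (iter next k x)
    least' (suc k) = ≤-trans (least k) (≤-reflexive (cong toℕ (iter-next k x)))
    least' zero with period l
    ... | t , _ , e = ≤-trans (least t) (≤-reflexive (cong toℕ (trans (iter-next t x) e)))

  isFace : Fin (N * N) → Bool
  isFace x = faceRep Γ ρ (pair x)

  isFace-face : ∀ {x} → dart x ≡ true → isFace (face x) ≡ true
  isFace-face {x} l = ∧-intro (trans (cong dart (sym (proj₂ index))) (iter-dart (proj₁ index) l)) (all-intro _ (upTo (N * N)) (λ {k} _ → below k))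
    where
    open Least (face-least l)
    below : ∀ k → (Defs.code Γ ρ (pair (face x)) ≤ᵇ Defs.code Γ ρ (iter (Defs.φ Γ ρ) k (pair (face x)))) ≡ true
    below k rewrite sym (pair-iter k (face x)) | code-pair (face x) | code-pair (iter next k (face x)) =
      T⇒≡ (≤⇒≤ᵇ (≤-trans (least (k + proj₁ index)) (≤-reflexive (cong toℕ (trans (iter-+ next k (proj₁ index) x) (cong (iter next k) (proj₂ index)))))))

  face-isFace : ∀ {x} → isFace x ≡ true → dart x ≡ true × face x ≡ x
  face-isFace {x} f = proj₁ (∧-elim f) , face-unique (proj₁ (∧-elim f)) (record { index = 0 , refl ; least = below })
    where
    below : ∀ k → toℕ x ≤ toℕ (iter next k x)
    below k with wrap (proj₁ (∧-elim f)) k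
    ... | i , i< , e = ≤-trans (≤ᵇ⇒≤ _ _ (subst IsTrue (sym le) _)) (≤-reflexive (cong toℕ e))
      where
      le : (toℕ x ≤ᵇ toℕ (iter next i x)) ≡ true
      le = trans (cong₂ _≤ᵇ_ (sym (code-pair x)) (sym (trans (cong (Defs.code Γ ρ) (sym (pair-iter i x))) (code-pair _))))
                 (all-elim _ (proj₂ (∧-elim {dart x} f)) (∈-upTo⁺ i<))

  -- Isolated vertices carry no dart and are left out; the planarity equation accounts for them by a
  -- separate term.
  lv : Fin N → Bool
  lv u = any (λ v → adj Γ u v) (allFin N)

  lv-intro : ∀ {u v} → adj Γ u v ≡ true → lv u ≡ true
  lv-intro {u} {v} a = any-intro (adj Γ u) (∈-allFin v) a

  shape : Map lv
  shape = record
    { live = dart ; src = fst ; φ = next ; fc = face ; fr = isFace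
    ; live-α = λ l → dart-enc (adj-symm l)
    ; live-φ = dart-next
    ; src-φ = λ _ → trans (fst-enc _ _) (sym (fst-enc _ _))
    ; loopless = λ {x} l e → true≢false l (trans (cong (adj Γ (fst x)) (sym (trans e (fst-enc _ _)))) (irrefl Γ (fst x)))
    ; fc-φ = face-next
    ; fr-fc = isFace-face
    ; fr-onto = λ {l} f → l , face-isFace f
    ; lv-src = lv-intro
    ; vtx = vtx
    }
    where
    vtx : (P : Fin (N * N) → Set) → (∀ {x} → dart x ≡ true → P x → P (next (reverse x))) →
          ∀ {x y} → dart x ≡ true → dart y ≡ true → fst x ≡ fst y → P x → P y
    vtx P closed {x} {y} lx ly e p = subst P (trans (cong₂ enc e (proj₂ around)) (enc-pair y)) (turn (proj₁ around))
      where
      around : ∃ λ k → iter (ρ (fst x)) k (snd x) ≡ snd y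
      around = ρ-transitive (fst x) (snd x) (snd y) lx (trans (cong (λ u → adj Γ u (snd y)) e) ly)
      alive : ∀ k → adj Γ (fst x) (iter (ρ (fst x)) k (snd x)) ≡ true
      alive zero = lx
      alive (suc k) = ρ-adj _ _ (alive k)
      turn : ∀ k → P (enc (fst x) (iter (ρ (fst x)) k (snd x)))
      turn zero = subst P (sym (enc-pair x)) p
      turn (suc k) = subst P (trans (cong₂ enc (snd-enc _ _) (cong₂ ρ (snd-enc _ _) (fst-enc _ _))) (cong₂ enc (fst-enc _ _) (cong₂ ρ (fst-enc _ _) (snd-enc _ _))))
                             (closed (dart-enc (alive k)) (turn k))

  #isFace : # isFace ≡ numFaces Γ ρ
  #isFace = trans (∑-enc _) (sym (trans (sum-allFin _) (∑-cong (λ u → trans (sum-allFin _) (∑-cong (λ v → cong (λ d → ⟦ faceRep Γ ρ d ⟧) (sym (pair-enc u v))))))))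

  #dart : # dart ≡ darts Γ
  #dart = trans (∑-enc _) (sym (trans (sum-allFin _) (∑-cong (λ u → trans (sum-allFin _) (∑-cong (λ v → cong ⟦_⟧ (sym (cong₂ (adj Γ) (fst-enc u v) (snd-enc u v)))))))))

-- Components and their joining

module Components {N : ℕ} (Γ : Graph N) (ρ : Fin N → Fin N → Fin N) (rotation : IsRotation Γ ρ) where
  open Encoding N
  open Darts reverse reverse-involutive
  open FromGraph Γ ρ rotation

  Closed : (Fin N → Set) → Set
  Closed P = ∀ {u v} → adj Γ u v ≡ true → P u → P v

  -- Lying in one component means satisfying the same closed predicates, in accordance with `conn`.
  Together : Fin N → Fin N → Set₁
  Together u v = ∀ P → Closed P → (P u → P v) × (P v → P u)

  reach-together : ∀ k {u v} → reachIn Γ k u v ≡ true → Together u v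
  reach-together zero {u} {v} e P closed with u ≟ v
  ... | yes refl = (λ p → p) , (λ p → p)
  reach-together (suc k) {u} {v} e P closed with reachIn Γ k u v in r
  ... | true = reach-together k r P closed
  ... | false with any-elim (λ w → reachIn Γ k u w ∧ adj Γ w v) (allFin N) e
  ...   | w , h with ∧-elim {reachIn Γ k u w} h
  ...     | r' , a = (λ p → closed a (proj₁ (reach-together k r' P closed) p)) , (λ p → proj₂ (reach-together k r' P closed) (closed (adj-symm a) p))

  isRoot : Fin N → Bool
  isRoot u = not (any (λ v → reach Γ u v ∧ (toℕ v <ᵇ toℕ u)) (allFin N))

  <ᵇ-elim : ∀ {a b} → (a <ᵇ b) ≡ true → a < b
  <ᵇ-elim {a} {b} e = <ᵇ⇒< a b (subst IsTrue (sym e) _)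

  -- Descent through smaller reachable vertices stops at a root, and each step of the descent stays
  -- within the component by soundness of the search `reach`.
  root : ∀ v → Acc _<_ (toℕ v) → ∃ λ r → isRoot r ≡ true × (∀ P → Closed P → (P v → P r) × (P r → P v))
  root v (acc rec) with isRoot v in e
  ... | true = v , e , (λ _ _ → (λ p → p) , (λ p → p))
  ... | false with any-elim (λ u → reach Γ v u ∧ (toℕ u <ᵇ toℕ v)) (allFin N) (not-false e)
  ...   | u , h with ∧-elim {reach Γ v u} h
  ...     | r , lt with root u (rec (<ᵇ-elim lt))
  ...       | w , rw , t = w , rw , (λ P closed → (λ p → proj₁ (t P closed) (proj₁ (reach-together N r P closed) p)) ,
                                                  (λ p → proj₂ (reach-together N r P closed) (proj₂ (t P closed) p)))

  liveRoot : Fin N → Bool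
  liveRoot u = isRoot u ∧ lv u

  lv-elim : ∀ {u} → lv u ≡ true → ∃ λ v → adj Γ u v ≡ true
  lv-elim {u} e = any-elim (adj Γ u) (allFin N) e

  lv-closed : Closed (λ u → lv u ≡ true)
  lv-closed a _ = lv-intro (adj-symm a)

  live-root : ∀ {v} → lv v ≡ true → ∃ λ r → liveRoot r ≡ true × (∀ P → Closed P → (P v → P r) × (P r → P v))
  live-root {v} lw with root v (<-wellFounded (toℕ v))
  ... | r , ir , t = r , ∧-intro ir (proj₁ (t (λ u → lv u ≡ true) lv-closed) lw) , t

  #isRoot : # isRoot ≡ components Γ
  #isRoot = sym (sum-allFin _)

  #isolated : # (λ u → not (lv u)) ≡ isolated Γ
  #isolated = sym (sum-allFin _)

  isolated-root : ∀ u → lv u ≡ false → isRoot u ≡ true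
  isolated-root u e with isRoot u in q
  ... | true = refl
  ... | false with any-elim (λ v → reach Γ u v ∧ (toℕ v <ᵇ toℕ u)) (allFin N) (not-false q)
  ...   | v , h with ∧-elim {reach Γ u v} h
  ...     | r , lt = contradiction (<ᵇ-elim lt) (<-irrefl (cong toℕ (proj₁ (reach-together N r (_≡ u) alone) refl)))
    where
    alone : Closed (_≡ u)
    alone a refl = ⊥-elim (true≢false (lv-intro a) e)

  #vertices : # lv + isolated Γ ≡ N
  #vertices = trans (cong (# lv +_) (sym #isolated)) (trans (sym (∑-distrib-+ _ _)) (trans (∑-cong one) (trans (∑-const N 1) (*-identityʳ N))))
    where
    one : ∀ u → ⟦ lv u ⟧ + ⟦ not (lv u) ⟧ ≡ 1
    one u with lv u
    ... | true = refl
    ... | false = refl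

  #components : # liveRoot + isolated Γ ≡ components Γ
  #components = trans (cong (# liveRoot +_) (sym #isolated)) (trans (sym (∑-distrib-+ _ _)) (trans (∑-cong one) #isRoot))
    where
    one : ∀ u → ⟦ liveRoot u ⟧ + ⟦ not (lv u) ⟧ ≡ ⟦ isRoot u ⟧
    one u with lv u in e | isRoot u in r
    ... | true | true = refl
    ... | true | false = refl
    ... | false | true = refl
    ... | false | false = contradiction (trans (sym (isolated-root u e)) r) λ ()

  -- An isolated vertex contributes 2 + 2 on the left and 4 on the right, so all of them cancel.
  euler-live : 2 * N + 2 * numFaces Γ ρ + 2 * isolated Γ ≡ darts Γ + 4 * components Γ →
               2 * # lv + 2 * # isFace ≡ # dart + 4 * # liveRoot
  euler-live planar = +-cancelʳ-≡ (4 * isolated Γ) _ _ (begin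
      2 * # lv + 2 * # isFace + 4 * isolated Γ
        ≡⟨ solve 3 (λ a b c → con 2 :* a :+ con 2 :* b :+ con 4 :* c := con 2 :* (a :+ c) :+ con 2 :* b :+ con 2 :* c) refl (# lv) (# isFace) (isolated Γ) ⟩
      2 * (# lv + isolated Γ) + 2 * # isFace + 2 * isolated Γ
        ≡⟨ cong₂ (λ a b → 2 * a + 2 * b + 2 * isolated Γ) #vertices #isFace ⟩
      2 * N + 2 * numFaces Γ ρ + 2 * isolated Γ   ≡⟨ planar ⟩
      darts Γ + 4 * components Γ                  ≡⟨ cong₂ (λ a b → a + 4 * b) (sym #dart) (sym #components) ⟩
      # dart + 4 * (# liveRoot + isolated Γ)
        ≡⟨ solve 3 (λ a b c → a :+ con 4 :* (b :+ c) := a :+ con 4 :* b :+ con 4 :* c) refl (# dart) (# liveRoot) (isolated Γ) ⟩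
      # dart + 4 * # liveRoot + 4 * isolated Γ ∎)
    where
    open ≡-Reasoning

  at : ∀ {v} → lv v ≡ true → ∃ λ x → dart x ≡ true × fst x ≡ v
  at {v} l with lv-elim l
  ... | w , a = enc v w , dart-enc a , fst-enc v w

  module _ (r₀ : Fin N) (root₀ : lv r₀ ≡ true) where

    record Joined (ts : List (Fin N)) (S : Map lv) : Set₁ where
      field
        S'     : Map lv
        src≡   : ∀ x → Map.src S' x ≡ fst x
        keep   : ∀ {x} → Map.live S x ≡ true → Map.live S' x ≡ true
        #live≤ : # (Map.live S') ≤ 2 * length ts + # (Map.live S)
        #fr≤   : # (Map.fr S) ≤ length ts + # (Map.fr S')
        spokes : All (λ t → Map.live S' (enc r₀ t) ≡ true) ts

    Fresh : Map lv → Fin N → Set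
    Fresh S t = lv t ≡ true × r₀ ≢ t × Map.live S (enc r₀ t) ≡ false × Map.live S (enc t r₀) ≡ false

    join-all : ∀ ts (S : Map lv) → (∀ x → Map.src S x ≡ fst x) → (∀ {x} → dart x ≡ true → Map.live S x ≡ true) →
               Unique ts → All (Fresh S) ts → Joined ts S
    join-all [] S src≡ base [] [] = record { S' = S ; src≡ = src≡ ; keep = λ l → l ; #live≤ = ≤-refl ; #fr≤ = ≤-refl ; spokes = [] }
    join-all (t ∷ ts) S src≡ base (t∉ ∷ u) ((lt , r≢t , dead , dead') ∷ fresh) = record
        { S' = S' ; src≡ = src≡' ; keep = λ l → keep (A.live⁺-intro (A.was l))
        ; #live≤ = ≤-trans #live≤ (≤-trans (+-monoʳ-≤ (2 * length ts) A.#live⁺)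
            (≤-reflexive (solve 2 (λ a b → con 2 :* a :+ (con 2 :+ b) := con 2 :* (con 1 :+ a) :+ b) refl (length ts) (# (Map.live S)))))
        ; #fr≤ = ≤-trans A.#fr⁺ (s≤s #fr≤)
        ; spokes = keep (A.live⁺-intro (A.is-d refl)) ∷ spokes }
      where
      x₁ = at root₀
      x₂ = at lt
      rev : reverse (enc r₀ t) ≡ enc t r₀
      rev = cong₂ enc (snd-enc r₀ t) (fst-enc r₀ t)
      src-d : Map.src S (enc r₀ t) ≡ r₀
      src-d = trans (src≡ _) (fst-enc r₀ t)
      src-d̄ : Map.src S (reverse (enc r₀ t)) ≡ t
      src-d̄ = trans (src≡ _) (trans (cong fst rev) (fst-enc t r₀))
      module A = Bridging.AddEdge S (enc r₀ t) dead (trans (cong (Map.live S) rev) dead')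
        (λ e → r≢t (trans (sym src-d) (trans e src-d̄)))
        (base (proj₁ (proj₂ x₁))) (base (proj₁ (proj₂ x₂)))
        (trans (src≡ _) (trans (proj₂ (proj₂ x₁)) (sym src-d))) (trans (src≡ _) (trans (proj₂ (proj₂ x₂)) (sym src-d̄)))
      still-dead : ∀ {a b} → (a ≡ r₀ → b ≢ t) → (a ≡ t → b ≢ r₀) → Map.live S (enc a b) ≡ false → A.live⁺ (enc a b) ≡ false
      still-dead {a} {b} n₁ n₂ dd with A.live⁺ (enc a b) in e
      ... | false = refl
      ... | true with A.live⁺-elim e
      ...   | A.is-d q = contradiction (trans (sym (snd-enc a b)) (trans (cong snd q) (snd-enc r₀ t))) (n₁ (trans (sym (fst-enc a b)) (trans (cong fst q) (fst-enc r₀ t))))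
      ...   | A.is-d̄ q = contradiction (trans (sym (snd-enc a b)) (trans (cong snd (trans q rev)) (snd-enc t r₀))) (n₂ (trans (sym (fst-enc a b)) (trans (cong fst (trans q rev)) (fst-enc t r₀))))
      ...   | A.was l = ⊥-elim (true≢false l dd)
      fresh' : ∀ {ts} → All (t ≢_) ts → All (Fresh S) ts → All (Fresh A.result) ts
      fresh' [] [] = []
      fresh' (t≢ ∷ ns) ((l , r≢ , d₁ , d₂) ∷ fs) =
        (l , r≢ , still-dead (λ _ e → t≢ (sym e)) (λ e _ → r≢t e) d₁ , still-dead (λ e _ → r≢ (sym e)) (λ e _ → t≢ (sym e)) d₂) ∷ fresh' ns fs
      open Joined (join-all ts A.result src≡ (λ l → A.live⁺-intro (A.was (base l))) u (fresh' t∉ fresh)) renaming (src≡ to src≡')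

  -- Joining the components to one of them costs one face per edge, so that Euler's
  -- relation for c components becomes the relation for one.
  connect : 2 * # lv + 2 * # isFace ≡ # dart + 4 * # liveRoot → ∀ {v} → lv v ≡ true →
            Σ (Plane lv) λ G → ∀ {u w} → adj Γ u w ≡ true → Plane.Adj G u w
  connect euler₀ {v} lw with # liveRoot in #r | pick liveRoot (# liveRoot) ≤-refl
  ... | zero | _ = contradiction (≤-trans (≤-reflexive (cong ⟦_⟧ (sym (proj₁ (proj₂ (live-root lw)))))) (≤-trans (term≤∑ (λ u → ⟦ liveRoot u ⟧) (proj₁ (live-root lw))) (≤-reflexive #r))) λ ()
  ... | suc c | r , r-inj , r-root = record { α = reverse ; α-involutive = reverse-involutive ; sphere = sphere } , embed
    where
    r₀ = r zero
    live₀ : lv r₀ ≡ true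
    live₀ = proj₂ (∧-elim {isRoot r₀} (r-root zero))
    ts = tabulate (λ i → r (suc i))
    -- The smaller of two adjacent vertices is reachable from the larger in one step, so the larger
    -- is not a root. The darts between roots are therefore free to carry the joining edges.
    apart : ∀ {i j} → toℕ (r i) < toℕ (r j) → adj Γ (r j) (r i) ≡ false
    apart {i} {j} lt with adj Γ (r j) (r i) in a
    ... | false = refl
    ... | true = ⊥-elim (true≢false (any-intro (λ v → reach Γ (r j) v ∧ (toℕ v <ᵇ toℕ (r j))) (∈-allFin (r i)) (∧-intro (reachable (≤-trans (s≤s z≤n) (toℕ<n (r j)))) (T⇒≡ (<⇒<ᵇ lt)))) (not-true (proj₁ (∧-elim (r-root j)))))
      where
      self : ∀ k u → reachIn Γ k u u ≡ true
      self zero u = dec-true (u ≟ u) refl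
      self (suc k) u = cong (_∨ any (λ w → reachIn Γ k u w ∧ adj Γ w u) (allFin N)) (self k u)
      reachable : ∀ {K} → 1 ≤ K → reachIn Γ K (r j) (r i) ≡ true
      reachable {suc K} _ = trans (cong (reachIn Γ K (r j) (r i) ∨_) (any-intro (λ w → reachIn Γ K (r j) w ∧ adj Γ w (r i)) (∈-allFin (r j)) (∧-intro (self K (r j)) a))) (∨-zeroʳ _)
    apart′ : ∀ {i j} → i ≢ j → adj Γ (r j) (r i) ≡ false
    apart′ {i} {j} ne with <-cmp (toℕ (r i)) (toℕ (r j))
    ... | tri< lt _ _ = apart lt
    ... | tri≈ _ e _ = contradiction (r-inj (toℕ-injective e)) ne
    ... | tri> _ _ gt with adj Γ (r j) (r i) in a
    ...   | false = refl
    ...   | true = ⊥-elim (true≢false (adj-symm a) (apart gt))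
    dead : ∀ {i j} → i ≢ j → dart (enc (r j) (r i)) ≡ false
    dead {i} {j} ne = trans (cong₂ (adj Γ) (fst-enc _ _) (snd-enc _ _)) (apart′ ne)
    fresh : ∀ i → Fresh r₀ live₀ shape (r (suc i))
    fresh i = proj₂ (∧-elim {isRoot (r (suc i))} (r-root (suc i))) , (λ e → contradiction (r-inj e) λ ()) , dead (λ ()) , dead (λ ())
    joined : Joined r₀ live₀ ts shape
    joined = join-all r₀ live₀ ts shape (λ _ → refl) (λ l → l) (Unique.tabulate⁺ (λ e → suc-injective (r-inj e))) (All.tabulate⁺ fresh)
    open Joined joined
    onto : ∀ {u} → liveRoot u ≡ true → ∃ λ i → u ≡ r i
    onto {u} l with image r u in e
    ... | true = image-elim r e
    ... | false = contradiction (≤-trans (#-image-≥ r r-inj) (#-mono (λ v h → remove-intro {a = u} {P = liveRoot} (λ { refl → true≢false h e }) (in-root h))))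
                    (<⇒≱ (≤-reflexive (trans (sym (#-remove {P = liveRoot} l)) #r)))
      where
      in-root : ∀ {v} → image r v ≡ true → liveRoot v ≡ true
      in-root h with image-elim r h
      ... | i , refl = r-root i
    conn : (P : Fin N → Set) → (∀ {x} → Map.live S' x ≡ true → P (Map.src S' x) → P (Map.src S' (reverse x))) →
           ∀ {u v} → lv u ≡ true → lv v ≡ true → P u → P v
    conn P closed {u} {v} lu lw p with live-root lu | live-root lw
    ... | a , ra , ta | b , rb , tb = proj₂ (tb P closed₀) (out (onto rb) (into (onto ra) (proj₁ (ta P closed₀) p)))
      where
      step : ∀ {u v} → Map.live S' (enc u v) ≡ true → P u → P v
      step {u} {v} l p = subst P (trans (src≡ _) (trans (fst-enc _ _) (snd-enc u v))) (closed l (subst P (sym (trans (src≡ _) (fst-enc u v))) p))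
      back : ∀ {u v} → Map.live S' (enc u v) ≡ true → P v → P u
      back {u} {v} l p = step (trans (cong (Map.live S') (sym (cong₂ enc (snd-enc u v) (fst-enc u v)))) (Map.live-α S' l)) p
      closed₀ : Closed P
      closed₀ a = step (keep (dart-enc a))
      into : ∀ {a} → (∃ λ i → a ≡ r i) → P a → P r₀
      into (zero , refl) p = p
      into (suc i , refl) p = back (All.tabulate⁻ spokes i) p
      out : ∀ {a} → (∃ λ i → a ≡ r i) → P r₀ → P a
      out (zero , refl) p = p
      out (suc i , refl) p = step (All.tabulate⁻ spokes i) p
    euler : # (Map.live S') + 4 ≤ 2 * # lv + 2 * # (Map.fr S')
    euler = +-cancelˡ-≤ (2 * c) _ _ (begin
        2 * c + (# (Map.live S') + 4)                    ≤⟨ +-monoʳ-≤ (2 * c) (+-monoˡ-≤ 4 (subst (λ k → # (Map.live S') ≤ 2 * k + # dart) (length-tabulate (λ i → r (suc i))) #live≤)) ⟩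
        2 * c + ((2 * c + # dart) + 4)                   ≡⟨ solve 2 (λ c d → con 2 :* c :+ ((con 2 :* c :+ d) :+ con 4) := d :+ con 4 :* (con 1 :+ c)) refl c (# dart) ⟩
        # dart + 4 * suc c                               ≡⟨ euler₀ ⟨
        2 * # lv + 2 * # isFace                          ≤⟨ +-monoʳ-≤ (2 * # lv) (*-monoʳ-≤ 2 (subst (λ k → # isFace ≤ k + # (Map.fr S')) (length-tabulate (λ i → r (suc i))) #fr≤)) ⟩
        2 * # lv + 2 * (c + # (Map.fr S'))               ≡⟨ solve 3 (λ l c f → con 2 :* l :+ con 2 :* (c :+ f) := con 2 :* c :+ (con 2 :* l :+ con 2 :* f)) refl (# lv) c (# (Map.fr S')) ⟩
        2 * c + (2 * # lv + 2 * # (Map.fr S')) ∎)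
      where
      open ≤-Reasoning
    sphere : Sphere lv
    sphere = record { shape = S' ; conn = conn ; euler = euler }
    embed : ∀ {u w} → adj Γ u w ≡ true → Sphere.Adj sphere u w
    embed {u} {w} a = enc u w , keep (dart-enc a) , trans (src≡ _) (fst-enc u w) , trans (src≡ _) (trans (fst-enc _ _) (snd-enc u w))

planar⇒plane : ∀ {N} {Γ : Graph N} → Planar Γ → ∀ {u₀ v₀} → adj Γ u₀ v₀ ≡ true →
               Σ (Fin N → Bool) λ lv → Σ (Plane lv) λ G → ∀ {u w} → adj Γ u w ≡ true → Plane.Adj G u w
planar⇒plane {N} {Γ} (ρ , rotation , euler) a = _ , Components.connect Γ ρ rotation (Components.euler-live Γ ρ rotation euler) (FromGraph.lv-intro Γ ρ rotation a)

-- The vertices outside the image of `ι` are contracted away, which keeps Euler's inequality for a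
-- connected graph, and those left are renamed by the inverse of `ι`.
induced : ∀ {N k} {lv : Fin N → Bool} (G : Plane lv) (ι : Fin k → Fin N) → Injective _≡_ _≡_ ι → 2 ≤ k → (∀ i → lv (ι i) ≡ true) →
          Σ (Plane {k} (λ _ → true)) λ G' → ∀ {i j} → Plane.Adj G (ι i) (ι j) → Plane.Adj G' i j
induced {N} {suc k} {lv} G ι ι-inj two ι-lv with absorb {B = image ι} (λ _ → false) (λ _ → ⊥) (λ ()) (≤-trans two (#-image-≥ ι ι-inj)) G in-lv
  where
  in-lv : ∀ {v} → image ι v ≡ true → lv v ≡ true
  in-lv e with image-elim ι e
  ... | i , refl = ι-lv i
... | G₁ , keep , _ = record { α = α ; α-involutive = α-involutive ; sphere = record
        { shape = record
          { live = live ; src = name ∘ src ; φ = φ ; fc = fc ; fr = fr ; live-α = live-α ; live-φ = live-φ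
          ; src-φ = λ l → cong name (src-φ l)
          ; loopless = λ l e → loopless l (name-inj (lv-src l) (lv-src (live-α l)) e)
          ; fc-φ = fc-φ ; fr-fc = fr-fc ; fr-onto = fr-onto ; lv-src = λ _ → refl
          ; vtx = λ P closed lx ly e → vtx P closed lx ly (name-inj (lv-src lx) (lv-src ly) e) }
        ; conn = λ P closed {u} {v} _ _ p → subst P (name-ι v) (conn (P ∘ name) closed (image-intro ι u) (image-intro ι v) (subst P (sym (name-ι u)) p))
        ; euler = ≤-trans euler (+-monoˡ-≤ (2 * # fr) (*-monoʳ-≤ 2 (≤-trans (#-image-≤ ι) (≤-reflexive (sym (trans (∑-const (suc k) 1) (*-identityʳ _))))))) } }
      , embed
  where
  open Plane G₁
  name : Fin N → Fin (suc k)
  name v with any? (λ i → v ≟ ι i)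
  ... | yes (i , _) = i
  -- A default: live darts start in the image of `ι`, and the name matters only there.
  ... | no _ = zero
  ι-name : ∀ {v} → image ι v ≡ true → ι (name v) ≡ v
  ι-name {v} e with any? (λ i → v ≟ ι i)
  ... | yes (i , q) = sym q
  ... | no none = contradiction (image-elim ι e) none
  name-ι : ∀ i → name (ι i) ≡ i
  name-ι i = ι-inj (ι-name (image-intro ι i))
  name-inj : ∀ {u v} → image ι u ≡ true → image ι v ≡ true → name u ≡ name v → u ≡ v
  name-inj eu ev e = trans (sym (ι-name eu)) (trans (cong ι e) (ι-name ev))
  embed : ∀ {i j} → Plane.Adj G (ι i) (ι j) → ∃ λ x → live x ≡ true × name (src x) ≡ i × name (src (α x)) ≡ j
  embed {i} {j} h with keep (image-intro ι i) (image-intro ι j) h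
  ... | x , l , s , t = x , l , trans (cong name s) (name-ι i) , trans (cong name t) (name-ι j)

-- The upper bound

module Labels (m n : ℕ) where

  -- The order is outgoing arcs, incoming arcs, edges. Since `2 * m` unfolds to `m + (m + 0)`, the
  -- first two need embeddings with a trailing zero.
  toFin : Lab m n → Fin (2 * m + n)
  toFin (fwd i)  = (i ↑ˡ (m + 0)) ↑ˡ n
  toFin (bwd i)  = (m ↑ʳ (i ↑ˡ 0)) ↑ˡ n
  toFin (edge j) = (2 * m) ↑ʳ j

  arc : Fin m ⊎ Fin (m + 0) → Lab m n
  arc (inj₁ i) = fwd i
  arc (inj₂ i) = [ bwd , (λ ()) ]′ (splitAt m i)

  fromFin : Fin (2 * m + n) → Lab m n
  fromFin c = [ (λ i → arc (splitAt m i)) , edge ]′ (splitAt (2 * m) c)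

  fromFin-toFin : ∀ l → fromFin (toFin l) ≡ l
  fromFin-toFin (fwd i) rewrite splitAt-↑ˡ (2 * m) (i ↑ˡ (m + 0)) n | splitAt-↑ˡ m i (m + 0) = refl
  fromFin-toFin (bwd i) rewrite splitAt-↑ˡ (2 * m) (m ↑ʳ (i ↑ˡ 0)) n | splitAt-↑ʳ m (m + 0) (i ↑ˡ 0) | splitAt-↑ˡ m i 0 = refl
  fromFin-toFin (edge j) rewrite splitAt-↑ʳ (2 * m) n j = refl

  toFin-fromFin : ∀ c → toFin (fromFin c) ≡ c
  toFin-fromFin c with splitAt (2 * m) c in e
  ... | inj₂ j = splitAt⁻¹-↑ʳ e
  ... | inj₁ i with splitAt m i in e'
  ...   | inj₁ a = trans (cong (_↑ˡ n) (splitAt⁻¹-↑ˡ e')) (splitAt⁻¹-↑ˡ e)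
  ...   | inj₂ b with splitAt m b in e''
  ...     | inj₁ a = trans (cong (_↑ˡ n) (trans (cong (m ↑ʳ_) (splitAt⁻¹-↑ˡ e'')) (splitAt⁻¹-↑ʳ e'))) (splitAt⁻¹-↑ˡ e)

  toFin-injective : ∀ {l l'} → toFin l ≡ toFin l' → l ≡ l'
  toFin-injective {l} {l'} e = trans (sym (fromFin-toFin l)) (trans (cong fromFin e) (fromFin-toFin l'))

  fromFin-injective : ∀ {c c'} → fromFin c ≡ fromFin c' → c ≡ c'
  fromFin-injective {c} {c'} e = trans (sym (toFin-fromFin c)) (trans (cong toFin e) (toFin-fromFin c'))

  flip-involutive : ∀ (l : Lab m n) → flipLab (flipLab l) ≡ l
  flip-involutive (fwd i) = refl
  flip-involutive (bwd i) = refl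
  flip-involutive (edge j) = refl

  flip-injective : ∀ {l l' : Lab m n} → flipLab l ≡ flipLab l' → l ≡ l'
  flip-injective {l} {l'} e = trans (sym (flip-involutive l)) (trans (cong flipLab e) (flip-involutive l'))

  label-≟ : (l l' : Lab m n) → Dec (l ≡ l')
  label-≟ l l' with toFin l ≟ toFin l'
  ... | yes e = yes (toFin-injective e)
  ... | no ne = no (λ e → ne (cong toFin e))

module CliqueSees {m n k : ℕ} (G : MixedGraph m n (suc k)) (clique : IsClique G) where
  open Labels m n

  Separates : Fin (suc k) → Fin (suc k) → Fin (suc k) → Set
  Separates u v w = ∃ λ a → ∃ λ b → a ≢ b × lab G w u ≡ just a × lab G w v ≡ just b

  separates? : ∀ u v w → Dec (Separates u v w)
  separates? u v w with lab G w u | lab G w v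
  ... | nothing | _ = no λ { (_ , _ , _ , () , _) }
  ... | just a | nothing = no λ { (_ , _ , _ , _ , ()) }
  ... | just a | just b with label-≟ a b
  ...   | yes refl = no λ { (_ , _ , ne , refl , refl) → ne refl }
  ...   | no ne = yes (a , b , ne , refl , refl)

  module Identify {u v : Fin (suc k)} (u≢v : u ≢ v) (apart : lab G u v ≡ nothing) (agree : ∀ w → ¬ Separates u v w) where

    apart′ : lab G v u ≡ nothing
    apart′ = trans (labSym G u v) (cong (Maybe.map flipLab) apart)

    when : ∀ {a} {A : Set a} → Dec A → Maybe (Lab m n) → Maybe (Lab m n)
    when (yes _) l = l
    when (no _) l = nothing

    -- `u` takes over the labels of `v` wherever it has none of its own; where both have one,
    -- `agree` makes them equal. The quotient is then a homomorphic image of smaller order.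
    merged : Fin (suc k) → Fin (suc k) → Maybe (Lab m n)
    merged x y = lab G x y <∣> when (x ≟ u) (lab G v y) <∣> when (y ≟ u) (lab G x v)

    merged-loopless : ∀ x → merged x x ≡ nothing
    merged-loopless x rewrite Defs.loopless G x with x ≟ u
    ... | yes refl rewrite apart′ = apart
    ... | no _ = refl

    merged-sym : ∀ x y → merged y x ≡ Maybe.map flipLab (merged x y)
    merged-sym x y rewrite labSym G x y with lab G x y
    ... | just l = refl
    ... | nothing with x ≟ u | y ≟ u
    ...   | yes refl | yes refl rewrite apart′ | apart = refl
    ...   | no _ | no _ = refl
    ...   | yes refl | no _ rewrite labSym G v y with lab G v y
    ...     | just _ = refl
    ...     | nothing = refl
    merged-sym x y | nothing | no _ | yes refl rewrite labSym G x v with lab G x v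
    ...     | just _ = refl
    ...     | nothing = refl

    quotient : MixedGraph m n k
    quotient = record
      { lab = λ i j → merged (punchIn v i) (punchIn v j)
      ; loopless = λ i → merged-loopless (punchIn v i)
      ; labSym = λ i j → merged-sym (punchIn v i) (punchIn v j) }

    π : Fin (suc k) → Fin (suc k)
    π = redirect v u

    π-≢ : ∀ x → v ≢ π x
    π-≢ x = redirect-elim (v ≢_) (λ _ e → u≢v (sym e)) (λ ne e → ne (sym e))

    f : Fin (suc k) → Fin k
    f x = punchOut (π-≢ x)

    merged-π : ∀ x y {l} → lab G x y ≡ just l → merged (π x) (π y) ≡ just l
    merged-π x y {l} e with x ≟ v | y ≟ v
    ... | yes refl | yes refl = contradiction (trans (sym e) (Defs.loopless G x)) λ ()
    ... | no nx | no ny rewrite redirect-≢ {e = u} nx | redirect-≢ {e = u} ny | e = refl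
    ... | yes refl | no ny rewrite redirect-≡ v u | redirect-≢ {e = u} ny with lab G u y in e'
    ...   | just l' = cong just (same (label-≟ l' l))
      where
      same : Dec (l' ≡ l) → l' ≡ l
      same (yes q) = q
      same (no ne) = ⊥-elim (agree y (flipLab l' , flipLab l , (λ q → ne (flip-injective q)) ,
        trans (labSym G u y) (cong (Maybe.map flipLab) e') , trans (labSym G v y) (cong (Maybe.map flipLab) e)))
    ...   | nothing with u ≟ u
    ...     | yes _ rewrite e = refl
    ...     | no ne = contradiction refl ne
    merged-π x y {l} e | no nx | yes refl rewrite redirect-≡ v u | redirect-≢ {e = u} nx with lab G x u in e'
    ...   | just l' = cong just (same (label-≟ l' l))
      where
      same : Dec (l' ≡ l) → l' ≡ l
      same (yes q) = q
      same (no ne) = ⊥-elim (agree x (l' , l , ne , e' , e))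
    ...   | nothing with x ≟ u | u ≟ u
    ...     | yes refl | _ = contradiction (trans (sym e) apart) λ ()
    ...     | no _ | yes _ = e
    ...     | no _ | no ne = contradiction refl ne

    hom : Hom G quotient
    hom = f , λ x y l e → trans (cong₂ merged (punchIn-punchOut (π-≢ x)) (punchIn-punchOut (π-≢ y))) (merged-π x y e)

  sees : ∀ {u v} → u ≢ v → is-just (lab G u v) ≡ true ⊎ ∃ (Separates u v)
  sees {u} {v} u≢v with lab G u v in e | any? (separates? u v)
  ... | just _ | _ = inj₁ refl
  ... | nothing | yes h = inj₂ h
  ... | nothing | no none = ⊥-elim (clique k ≤-refl (Identify.quotient u≢v e agree) (Identify.hom u≢v e agree))
    where
    agree : ∀ w → ¬ Separates u v w
    agree w h = none (w , h)

upper-bound : ∀ m n → ¬ (m ≡ 0 × n ≡ 1) → ∀ N (Γ : Graph N) → Planar Γ → ωa≤ m n Γ (9 * (2 * m + n) ^ 2 + 2 * (2 * m + n) + 2)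
upper-bound m n excluded N Γ planar G underlying zero S clique = z≤n
upper-bound m n excluded N Γ planar G underlying (suc zero) S clique = ≤-trans (n≤1+n 1) (m≤n+m 2 _)
upper-bound m n excluded N Γ planar G underlying (suc (suc k)) S clique with 2 ≤? 2 * m + n
... | yes two = ≤-trans (order-bound labels plane₂ emb symm sees′ two) (≤-reflexive (cong (λ q → 9 * ((2 * m + n) * q) + 2 * (2 * m + n) + 2) (sym (*-identityʳ (2 * m + n)))))
  where
  open Subgraph S renaming (sub to H)
  open Labels m n
  open CliqueSees H clique
  labels : Fin (suc (suc k)) → Fin (suc (suc k)) → Maybe (Fin (2 * m + n))
  labels u v = Maybe.map toFin (lab H u v)
  is-just-map : ∀ {A B : Set} {g : A → B} x → is-just (Maybe.map g x) ≡ is-just x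
  is-just-map (just _) = refl
  is-just-map nothing = refl
  other : ∀ (u : Fin (suc (suc k))) → ∃ λ v → u ≢ v
  other zero = suc zero , λ ()
  other (suc u) = zero , λ ()
  in-Γ : ∀ {u v} → is-just (lab H u v) ≡ true → adj Γ (ι u) (ι v) ≡ true
  in-Γ {u} {v} j with lab H u v in e
  ... | just l = trans (underlying (ι u) (ι v)) (cong is-just (pres u v l e))
  flipped : ∀ {u v} → is-just (lab H u v) ≡ true → is-just (lab H v u) ≡ true
  flipped {u} {v} j = trans (cong is-just (labSym H u v)) (trans (is-just-map (lab H u v)) j)
  -- A vertex is adjacent to some other vertex or separated from it by a common neighbour, and
  -- either way it has a neighbour. Hence the clique survives the removal of isolated vertices.
  neighbour-of : ∀ u → ∃ λ v → adj Γ (ι u) (ι v) ≡ true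
  neighbour-of u with sees (proj₂ (other u))
  ... | inj₁ j = _ , in-Γ j
  ... | inj₂ (w , a , b , _ , e , _) = w , in-Γ (flipped (cong is-just e))
  plane₁ = planar⇒plane planar (proj₂ (neighbour-of zero))
  plane₂₊ = induced (proj₁ (proj₂ plane₁)) ι inj (s≤s (s≤s z≤n)) (λ i → Plane.adj-lvˡ (proj₁ (proj₂ plane₁)) (proj₂ (proj₂ plane₁) (proj₂ (neighbour-of i))))
  plane₂ = proj₁ plane₂₊
  emb : ∀ {u v} → is-just (labels u v) ≡ true → Plane.Adj plane₂ u v
  emb {u} {v} j = proj₂ plane₂₊ (proj₂ (proj₂ plane₁) (in-Γ (trans (sym (is-just-map (lab H u v))) j)))
  symm : ∀ {u v} → is-just (labels u v) ≡ true → is-just (labels v u) ≡ true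
  symm {u} {v} j = trans (is-just-map (lab H v u)) (flipped (trans (sym (is-just-map (lab H u v))) j))
  sees′ : ∀ {u v} → u ≢ v → is-just (labels u v) ≡ true ⊎ ∃ λ w → ∃ λ a → ∃ λ b → a ≢ b × labels w u ≡ just a × labels w v ≡ just b
  sees′ {u} {v} ne with sees ne
  ... | inj₁ j = inj₁ (trans (is-just-map (lab H u v)) j)
  ... | inj₂ (w , a , b , a≢b , ea , eb) = inj₂ (w , toFin a , toFin b , (λ e → a≢b (toFin-injective e)) , cong (Maybe.map toFin) ea , cong (Maybe.map toFin) eb)
-- Fewer than two labels means none at all, as the case of one label is excluded; but two vertices
-- of a clique require a label.
... | no small = ⊥-elim (no-labels (few m n (≰⇒> small) excluded))
  where
  few : ∀ m n → 2 * m + n < 2 → ¬ (m ≡ 0 × n ≡ 1) → m ≡ 0 × n ≡ 0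
  few zero zero _ _ = refl , refl
  few zero (suc zero) _ ne = contradiction (refl , refl) ne
  few zero (suc (suc n)) (s≤s (s≤s ())) _
  few (suc m) n lt _ = contradiction lt (≤⇒≯ (≤-trans (*-monoʳ-≤ 2 (s≤s z≤n)) (m≤m+n (2 * suc m) n)))
  no-label : m ≡ 0 × n ≡ 0 → Lab m n → ⊥
  no-label (refl , refl) (fwd ())
  no-label (refl , refl) (bwd ())
  no-label (refl , refl) (edge ())
  no-labels : m ≡ 0 × n ≡ 0 → ⊥
  no-labels none with CliqueSees.sees (Subgraph.sub S) clique {zero} {suc zero} (λ ())
  ... | inj₂ (_ , a , _) = no-label none a
  ... | inj₁ j with lab (Subgraph.sub S) zero (suc zero)
  ...   | just l = no-label none l

-- Stacked triangulations

nxt prv : Fin 3 → Fin 3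
nxt zero = suc zero
nxt (suc zero) = suc (suc zero)
nxt (suc (suc zero)) = zero
prv zero = suc (suc zero)
prv (suc zero) = zero
prv (suc (suc zero)) = suc zero

prv-nxt : ∀ i → prv (nxt i) ≡ i
prv-nxt zero = refl
prv-nxt (suc zero) = refl
prv-nxt (suc (suc zero)) = refl

nxt-prv : ∀ i → nxt (prv i) ≡ i
nxt-prv zero = refl
nxt-prv (suc zero) = refl
nxt-prv (suc (suc zero)) = refl

prv-prv : ∀ i → prv (prv i) ≡ nxt i
prv-prv zero = refl
prv-prv (suc zero) = refl
prv-prv (suc (suc zero)) = refl

-- A plane triangulation with a distinguished face, oriented so that at each of its
-- corners the rotation leads from the preceding to the following corner.
record Triangulation (N : ℕ) : Set where
  field
    Γ : Graph N
    ρ : Fin N → Fin N → Fin N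
    rotation : IsRotation Γ ρ
    triangles : ∀ {u v} → adj Γ u v ≡ true → ρ (ρ v u) v ≡ u
    size : ∑ (λ u → ∑ (λ v → ⟦ adj Γ u v ⟧)) + 12 ≡ 6 * N
    corner : Fin 3 → Fin N
    corner-adj : ∀ i → adj Γ (corner i) (corner (prv i)) ≡ true
    corner-face : ∀ i → ρ (corner i) (corner (prv i)) ≡ corner (nxt i)

  adj-symm : ∀ {u v} → adj Γ u v ≡ true → adj Γ v u ≡ true
  adj-symm {u} {v} a = trans (sym (Graph.sym Γ u v)) a

  adj-≢ : ∀ {u v} → adj Γ u v ≡ true → u ≢ v
  adj-≢ {u} a refl = true≢false a (irrefl Γ u)

  corner-nxt : ∀ i → adj Γ (corner i) (corner (nxt i)) ≡ true
  corner-nxt i = adj-symm (subst (λ k → adj Γ (corner (nxt i)) (corner k) ≡ true) (prv-nxt i) (corner-adj (nxt i)))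

  corner-inj : Injective _≡_ _≡_ corner
  corner-inj {zero} {zero} e = refl
  corner-inj {suc zero} {suc zero} e = refl
  corner-inj {suc (suc zero)} {suc (suc zero)} e = refl
  corner-inj {zero} {suc zero} e = contradiction e (adj-≢ (corner-nxt zero))
  corner-inj {zero} {suc (suc zero)} e = contradiction e (adj-≢ (corner-adj zero))
  corner-inj {suc zero} {zero} e = contradiction e (adj-≢ (corner-adj (suc zero)))
  corner-inj {suc zero} {suc (suc zero)} e = contradiction e (adj-≢ (corner-nxt (suc zero)))
  corner-inj {suc (suc zero)} {zero} e = contradiction e (adj-≢ (corner-nxt (suc (suc zero))))
  corner-inj {suc (suc zero)} {suc zero} e = contradiction e (adj-≢ (corner-adj (suc (suc zero))))

_⟶⟨_⟩_ : ∀ {A : Set} → A → (A → A) → A → Set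
v ⟶⟨ f ⟩ w = Σ ℕ λ k → iter f k v ≡ w

⟶-trans : ∀ {A : Set} {f : A → A} {u v w} → u ⟶⟨ f ⟩ v → v ⟶⟨ f ⟩ w → u ⟶⟨ f ⟩ w
⟶-trans {f = f} {u} (k , refl) (l , refl) = l + k , iter-+ f l k u

⟶-step : ∀ {A : Set} {f : A → A} {u v} → f u ≡ v → u ⟶⟨ f ⟩ v
⟶-step e = 1 , e

-- A new vertex (zero) placed in the distinguished face and joined to its corners.
module Insert {N : ℕ} (T : Triangulation N) where
  open Triangulation T

  adj⁺ : Fin (suc N) → Fin (suc N) → Bool
  adj⁺ zero zero = false
  adj⁺ zero (suc v) = image corner v
  adj⁺ (suc u) zero = image corner u
  adj⁺ (suc u) (suc v) = adj Γ u v

  Γ⁺ : Graph (suc N)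
  Γ⁺ = record { adj = adj⁺ ; irrefl = irr ; sym = symm }
    where
    irr : ∀ u → adj⁺ u u ≡ false
    irr zero = refl
    irr (suc u) = irrefl Γ u
    symm : ∀ u v → adj⁺ u v ≡ adj⁺ v u
    symm zero zero = refl
    symm zero (suc v) = refl
    symm (suc u) zero = refl
    symm (suc u) (suc v) = Graph.sym Γ u v

  opaque

    -- At each corner the new vertex comes between the preceding and the following corner. Around
    -- the new vertex itself the corners follow each other in the opposite sense, as a consistent
    -- orientation demands.
    ρ⁺ : Fin (suc N) → Fin (suc N) → Fin (suc N)
    ρ⁺ zero zero = zero
    ρ⁺ zero (suc v) with any? (λ i → v ≟ corner i)
    ... | yes (i , _) = suc (corner (prv i))
    ... | no _ = zero
    ρ⁺ (suc u) zero with any? (λ i → u ≟ corner i)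
    ... | yes (i , _) = suc (corner (nxt i))
    ... | no _ = zero
    ρ⁺ (suc u) (suc v) with any? (λ i → (u ≟ corner i) ×-dec (v ≟ corner (prv i)))
    ... | yes _ = zero
    ... | no _ = suc (ρ u v)

    ρ⁺-centre : ∀ i → ρ⁺ zero (suc (corner i)) ≡ suc (corner (prv i))
    ρ⁺-centre i with any? (λ k → corner i ≟ corner k)
    ... | yes (k , e) = cong (λ k → suc (corner (prv k))) (corner-inj (sym e))
    ... | no none = contradiction (i , refl) none

    ρ⁺-out : ∀ i → ρ⁺ (suc (corner i)) zero ≡ suc (corner (nxt i))
    ρ⁺-out i with any? (λ k → corner i ≟ corner k)
    ... | yes (k , e) = cong (λ k → suc (corner (nxt k))) (corner-inj (sym e))
    ... | no none = contradiction (i , refl) none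

    ρ⁺-in : ∀ i → ρ⁺ (suc (corner i)) (suc (corner (prv i))) ≡ zero
    ρ⁺-in i with any? (λ k → (corner i ≟ corner k) ×-dec (corner (prv i) ≟ corner (prv k)))
    ... | yes _ = refl
    ... | no none = contradiction (i , refl , refl) none

    ρ⁺-old : ∀ {u v} → (∀ i → u ≡ corner i → v ≢ corner (prv i)) → ρ⁺ (suc u) (suc v) ≡ suc (ρ u v)
    ρ⁺-old {u} {v} h with any? (λ i → (u ≟ corner i) ×-dec (v ≟ corner (prv i)))
    ... | yes (i , e , e') = contradiction e' (h i e)
    ... | no _ = refl

  data Turn (u v : Fin N) : Set where
    enters : ∀ i → u ≡ corner i → v ≡ corner (prv i) → Turn u v
    passes : (∀ i → u ≡ corner i → v ≢ corner (prv i)) → Turn u v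

  turn : ∀ u v → Turn u v
  turn u v with any? (λ i → (u ≟ corner i) ×-dec (v ≟ corner (prv i)))
  ... | yes (i , e , e') = enters i e e'
  ... | no none = passes (λ i e e' → none (i , e , e'))

  ρ-adj = proj₁ rotation
  ρ-injective = proj₁ (proj₂ rotation)
  ρ-transitive = proj₂ (proj₂ rotation)

  closed⁺ : ∀ u v → adj⁺ u v ≡ true → adj⁺ u (ρ⁺ u v) ≡ true
  closed⁺ zero (suc v) a with image-elim corner a
  ... | i , refl rewrite ρ⁺-centre i = image-intro corner (prv i)
  closed⁺ (suc u) zero a with image-elim corner a
  ... | i , refl rewrite ρ⁺-out i = corner-nxt i
  closed⁺ (suc u) (suc v) a with turn u v
  ... | enters i refl refl rewrite ρ⁺-in i = image-intro corner i
  ... | passes h rewrite ρ⁺-old h = ρ-adj u v a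

  suc-inj : ∀ {n} {x y : Fin n} → suc x ≡ suc y → x ≡ y
  suc-inj refl = refl

  prv-inj : ∀ {i j} → prv i ≡ prv j → i ≡ j
  prv-inj {i} {j} e = trans (sym (nxt-prv i)) (trans (cong nxt e) (nxt-prv j))

  out≢old : ∀ i {v} → adj Γ (corner i) v ≡ true → (∀ k → corner i ≡ corner k → v ≢ corner (prv k)) → corner (nxt i) ≢ ρ (corner i) v
  out≢old i {v} a h e = h i refl (sym (ρ-injective (corner i) (corner (prv i)) v (corner-adj i) a (trans (corner-face i) e)))

  injective⁺ : ∀ u v w → adj⁺ u v ≡ true → adj⁺ u w ≡ true → ρ⁺ u v ≡ ρ⁺ u w → v ≡ w
  injective⁺ zero (suc v) (suc w) a b e with image-elim corner a | image-elim corner b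
  ... | i , refl | j , refl rewrite ρ⁺-centre i | ρ⁺-centre j = cong (suc ∘ corner) (prv-inj (corner-inj (suc-inj e)))
  injective⁺ (suc u) zero zero a b e = refl
  injective⁺ (suc u) zero (suc w) a b e with image-elim corner a
  ... | i , refl with turn (corner i) w
  ...   | enters k q refl rewrite corner-inj q | ρ⁺-out k | ρ⁺-in k = contradiction e λ ()
  ...   | passes h rewrite ρ⁺-out i | ρ⁺-old h = contradiction (suc-inj e) (out≢old i b h)
  injective⁺ (suc u) (suc v) zero a b e with image-elim corner b
  ... | i , refl with turn (corner i) v
  ...   | enters k q refl rewrite corner-inj q | ρ⁺-out k | ρ⁺-in k = contradiction e λ ()
  ...   | passes h rewrite ρ⁺-out i | ρ⁺-old h = contradiction (suc-inj (sym e)) (out≢old i a h)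
  injective⁺ (suc u) (suc v) (suc w) a b e with turn u v | turn u w
  ... | enters i refl refl | enters k q refl rewrite corner-inj q = refl
  ... | enters i refl refl | passes h rewrite ρ⁺-in i | ρ⁺-old h = contradiction e λ ()
  ... | passes h | enters i refl refl rewrite ρ⁺-in i | ρ⁺-old h = contradiction e λ ()
  ... | passes h | passes h' rewrite ρ⁺-old h | ρ⁺-old h' = cong suc (ρ-injective u v w a b (suc-inj e))

  -- A step across the distinguished face becomes two steps by way of the new vertex, and any other
  -- step is unchanged, so old orbits lift to new ones.
  lift-step : ∀ u v → suc v ⟶⟨ ρ⁺ (suc u) ⟩ suc (ρ u v)
  lift-step u v with turn u v
  ... | passes h = ⟶-step (ρ⁺-old h)
  ... | enters i refl refl = ⟶-trans {v = zero} (⟶-step (ρ⁺-in i)) (⟶-step (trans (ρ⁺-out i) (cong suc (sym (corner-face i)))))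

  lift : ∀ u v k → suc v ⟶⟨ ρ⁺ (suc u) ⟩ suc (iter (ρ u) k v)
  lift u v zero = 0 , refl
  lift u v (suc k) = ⟶-trans (lift u v k) (lift-step u (iter (ρ u) k v))

  lift′ : ∀ {u v w} → adj Γ u v ≡ true → adj Γ u w ≡ true → suc v ⟶⟨ ρ⁺ (suc u) ⟩ suc w
  lift′ {u} {v} {w} a b with ρ-transitive u v w a b
  ... | k , refl = lift u v k

  around : ∀ i j → suc (corner i) ⟶⟨ ρ⁺ zero ⟩ suc (corner j)
  around i j with i ≟ j | prv i ≟ j
  ... | yes refl | _ = 0 , refl
  ... | no _ | yes refl = ⟶-step (ρ⁺-centre i)
  ... | no n₁ | no n₂ = ⟶-trans (⟶-step (ρ⁺-centre i)) (⟶-step (trans (ρ⁺-centre (prv i)) (cong (suc ∘ corner) (third i j n₁ n₂))))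
    where
    third : ∀ i j → i ≢ j → prv i ≢ j → prv (prv i) ≡ j
    third zero zero n _ = contradiction refl n
    third zero (suc zero) _ _ = refl
    third zero (suc (suc zero)) _ n = contradiction refl n
    third (suc zero) zero _ n = contradiction refl n
    third (suc zero) (suc zero) n _ = contradiction refl n
    third (suc zero) (suc (suc zero)) _ _ = refl
    third (suc (suc zero)) zero _ _ = refl
    third (suc (suc zero)) (suc zero) _ n = contradiction refl n
    third (suc (suc zero)) (suc (suc zero)) n _ = contradiction refl n

  transitive⁺ : ∀ u v w → adj⁺ u v ≡ true → adj⁺ u w ≡ true → v ⟶⟨ ρ⁺ u ⟩ w
  transitive⁺ zero (suc v) (suc w) a b with image-elim corner a | image-elim corner b
  ... | i , refl | j , refl = around i j
  transitive⁺ (suc u) zero zero a b = 0 , refl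
  transitive⁺ (suc u) zero (suc w) a b with image-elim corner a
  ... | i , refl = ⟶-trans (⟶-step (ρ⁺-out i)) (lift′ (corner-nxt i) b)
  transitive⁺ (suc u) (suc v) zero a b with image-elim corner b
  ... | i , refl = ⟶-trans (lift′ a (corner-adj i)) (⟶-step (ρ⁺-in i))
  transitive⁺ (suc u) (suc v) (suc w) a b = lift′ a b

  triangles⁺ : ∀ {u v} → adj⁺ u v ≡ true → ρ⁺ (ρ⁺ v u) v ≡ u
  triangles⁺ {zero} {suc v} a with image-elim corner a
  ... | i , refl rewrite ρ⁺-out i = subst (λ k → ρ⁺ (suc (corner (nxt i))) (suc (corner k)) ≡ zero) (prv-nxt i) (ρ⁺-in (nxt i))
  triangles⁺ {suc u} {zero} a with image-elim corner a
  ... | i , refl rewrite ρ⁺-centre i = trans (ρ⁺-out (prv i)) (cong (suc ∘ corner) (nxt-prv i))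
  triangles⁺ {suc u} {suc v} a with turn v u
  ... | enters i refl refl rewrite ρ⁺-in i = ρ⁺-centre i
  ... | passes h rewrite ρ⁺-old h = trans (ρ⁺-old other) (cong suc (triangles a))
    where
    -- If the next dart of the triangle were on the distinguished face, closing the triangle would
    -- put the present one there as well.
    other : ∀ k → ρ v u ≡ corner k → v ≢ corner (prv k)
    other k e e' = h (prv k) e' (trans (sym (triangles a)) (trans (cong₂ ρ e e') (trans (corner-face k) (cong corner (sym (prv-prv k))))))

  #corner : # (image corner) ≡ 3
  #corner = ≤-antisym (#-image-≤ corner) (#-image-≥ corner corner-inj)

  size⁺ : ∑ (λ u → ∑ (λ v → ⟦ adj⁺ u v ⟧)) + 12 ≡ 6 * suc N
  size⁺ = begin
    ∑ (λ u → ∑ (λ v → ⟦ adj⁺ u v ⟧)) + 12                   ≡⟨ cong (_+ 12) (trans (∑-suc _) (cong₂ _+_ (trans (∑-suc _) #corner) (trans (∑-cong (λ u → ∑-suc _)) (trans (∑-distrib-+ _ _) (cong (_+ E) #corner))))) ⟩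
    3 + (3 + E) + 12                                        ≡⟨ solve 1 (λ e → con 3 :+ (con 3 :+ e) :+ con 12 := con 6 :+ (e :+ con 12)) refl E ⟩
    6 + (E + 12)                                            ≡⟨ cong (6 +_) size ⟩
    6 + 6 * N                                               ≡⟨ sym (*-suc 6 N) ⟩
    6 * suc N ∎
    where
    open ≡-Reasoning
    E = ∑ (λ u → ∑ (λ v → ⟦ adj Γ u v ⟧))

  -- The face opposite to corner j: corner j is replaced by the new vertex.
  corner⁺ : Fin 3 → Fin 3 → Fin (suc N)
  corner⁺ j i = if does (i ≟ j) then zero else suc (corner i)

  insert : Fin 3 → Triangulation (suc N)
  insert j = record
    { Γ = Γ⁺ ; ρ = ρ⁺ ; rotation = closed⁺ , injective⁺ , transitive⁺ ; triangles = triangles⁺ ; size = size⁺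
    ; corner = corner⁺ j ; corner-adj = c-adj j ; corner-face = c-face j }
    where
    c-adj : ∀ j i → adj⁺ (corner⁺ j i) (corner⁺ j (prv i)) ≡ true
    c-adj zero zero = image-intro corner (suc (suc zero))
    c-adj zero (suc zero) = image-intro corner (suc zero)
    c-adj zero (suc (suc zero)) = corner-adj (suc (suc zero))
    c-adj (suc zero) zero = corner-adj zero
    c-adj (suc zero) (suc zero) = image-intro corner zero
    c-adj (suc zero) (suc (suc zero)) = image-intro corner (suc (suc zero))
    c-adj (suc (suc zero)) zero = image-intro corner zero
    c-adj (suc (suc zero)) (suc zero) = corner-adj (suc zero)
    c-adj (suc (suc zero)) (suc (suc zero)) = image-intro corner (suc zero)
    c-face : ∀ j i → ρ⁺ (corner⁺ j i) (corner⁺ j (prv i)) ≡ corner⁺ j (nxt i)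
    c-face zero zero = ρ⁺-centre (suc (suc zero))
    c-face zero (suc zero) = ρ⁺-out (suc zero)
    c-face zero (suc (suc zero)) = ρ⁺-in (suc (suc zero))
    c-face (suc zero) zero = ρ⁺-in zero
    c-face (suc zero) (suc zero) = ρ⁺-centre zero
    c-face (suc zero) (suc (suc zero)) = ρ⁺-out (suc (suc zero))
    c-face (suc (suc zero)) zero = ρ⁺-out zero
    c-face (suc (suc zero)) (suc zero) = ρ⁺-in (suc zero)
    c-face (suc (suc zero)) (suc (suc zero)) = ρ⁺-centre (suc zero)

triangle : Triangulation 3
triangle = record
  { Γ = Γ₃ ; ρ = third ; rotation = closed , injective , transitive ; triangles = λ {u} {v} → tri u v ; size = count₃
  ; corner = λ i → i ; corner-adj = c-adj ; corner-face = c-face }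
  where
  adj₃ : Fin 3 → Fin 3 → Bool
  adj₃ u v = not (does (u ≟ v))
  Γ₃ : Graph 3
  Γ₃ = record { adj = adj₃ ; irrefl = λ u → cong not (dec-true (u ≟ u) refl) ; sym = symm }
    where
    symm : ∀ u v → adj₃ u v ≡ adj₃ v u
    symm zero zero = refl
    symm zero (suc zero) = refl
    symm zero (suc (suc zero)) = refl
    symm (suc zero) zero = refl
    symm (suc zero) (suc zero) = refl
    symm (suc zero) (suc (suc zero)) = refl
    symm (suc (suc zero)) zero = refl
    symm (suc (suc zero)) (suc zero) = refl
    symm (suc (suc zero)) (suc (suc zero)) = refl
  third : Fin 3 → Fin 3 → Fin 3
  third u v = if does (v ≟ prv u) then nxt u else prv u
  closed : ∀ u v → adj₃ u v ≡ true → adj₃ u (third u v) ≡ true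
  closed zero (suc zero) _ = refl
  closed zero (suc (suc zero)) _ = refl
  closed (suc zero) zero _ = refl
  closed (suc zero) (suc (suc zero)) _ = refl
  closed (suc (suc zero)) zero _ = refl
  closed (suc (suc zero)) (suc zero) _ = refl
  closed (suc (suc zero)) (suc (suc zero)) ()
  tri : ∀ u v → adj₃ u v ≡ true → third (third v u) v ≡ u
  tri zero (suc zero) _ = refl
  tri zero (suc (suc zero)) _ = refl
  tri (suc zero) zero _ = refl
  tri (suc zero) (suc (suc zero)) _ = refl
  tri (suc (suc zero)) zero _ = refl
  tri (suc (suc zero)) (suc zero) _ = refl
  tri (suc (suc zero)) (suc (suc zero)) ()
  twice : ∀ u v → adj₃ u v ≡ true → third u (third u v) ≡ v
  twice zero (suc zero) _ = refl
  twice zero (suc (suc zero)) _ = refl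
  twice (suc zero) zero _ = refl
  twice (suc zero) (suc (suc zero)) _ = refl
  twice (suc (suc zero)) zero _ = refl
  twice (suc (suc zero)) (suc zero) _ = refl
  twice (suc (suc zero)) (suc (suc zero)) ()
  injective : ∀ u v w → adj₃ u v ≡ true → adj₃ u w ≡ true → third u v ≡ third u w → v ≡ w
  injective u v w a b e = trans (sym (twice u v a)) (trans (cong (third u) e) (twice u w b))
  transitive : ∀ u v w → adj₃ u v ≡ true → adj₃ u w ≡ true → v ⟶⟨ third u ⟩ w
  transitive zero (suc zero) (suc zero) _ _ = 0 , refl
  transitive zero (suc zero) (suc (suc zero)) _ _ = 1 , refl
  transitive zero (suc (suc zero)) (suc zero) _ _ = 1 , refl
  transitive zero (suc (suc zero)) (suc (suc zero)) _ _ = 0 , refl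
  transitive (suc zero) zero zero _ _ = 0 , refl
  transitive (suc zero) zero (suc (suc zero)) _ _ = 1 , refl
  transitive (suc zero) (suc (suc zero)) zero _ _ = 1 , refl
  transitive (suc zero) (suc (suc zero)) (suc (suc zero)) _ _ = 0 , refl
  transitive (suc (suc zero)) zero zero _ _ = 0 , refl
  transitive (suc (suc zero)) zero (suc zero) _ _ = 1 , refl
  transitive (suc (suc zero)) (suc zero) zero _ _ = 1 , refl
  transitive (suc (suc zero)) (suc zero) (suc zero) _ _ = 0 , refl
  transitive (suc (suc zero)) (suc (suc zero)) w ()
  transitive (suc (suc zero)) zero (suc (suc zero)) _ ()
  transitive (suc (suc zero)) (suc zero) (suc (suc zero)) _ ()
  opaque
    unfolding ∑
    count₃ : ∑ (λ u → ∑ (λ v → ⟦ adj₃ u v ⟧)) + 12 ≡ 18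
    count₃ = refl
  c-adj : ∀ i → adj₃ i (prv i) ≡ true
  c-adj zero = refl
  c-adj (suc zero) = refl
  c-adj (suc (suc zero)) = refl
  c-face : ∀ i → third i (prv i) ≡ nxt i
  c-face i = cong (λ b → if b then nxt i else prv i) (dec-true (prv i ≟ prv i) refl)

-- Three faces' worth of darts fill the faces exactly, so in a connected triangulation Euler's
-- relation is one third of `size` plus 3F = 2E.
euler-count : ∀ {n f i d c} → d + 12 ≡ 6 * n → 3 * f ≡ d → i ≡ 0 → c ≡ 1 → 2 * n + 2 * f + 2 * i ≡ d + 4 * c
euler-count {n} {f} size refl refl refl = *-cancelˡ-≡ (2 * n + 2 * f + 0) (3 * f + 4) 3 (begin
  3 * (2 * n + 2 * f + 0)     ≡⟨ solve 2 (λ n f → con 3 :* (con 2 :* n :+ con 2 :* f :+ con 0) := con 6 :* n :+ con 6 :* f) refl n f ⟩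
  6 * n + 6 * f               ≡⟨ cong (_+ 6 * f) (sym size) ⟩
  3 * f + 12 + 6 * f          ≡⟨ solve 1 (λ f → con 3 :* f :+ con 12 :+ con 6 :* f := con 3 :* (con 3 :* f :+ con 4)) refl f ⟩
  3 * (3 * f + 4) ∎)
  where
  open ≡-Reasoning

module _ {N : ℕ} (T : Triangulation (3 + N)) {apex : Fin (3 + N)}
  (apex-adj : ∀ {u} → u ≢ apex → adj (Triangulation.Γ T) apex u ≡ true) where
  open Triangulation T hiding (adj-symm)
  open Encoding (3 + N)
  open FromGraph Γ ρ rotation
  open Components Γ ρ rotation

  next³ : ∀ {x} → dart x ≡ true → next (next (next x)) ≡ x
  next³ {x} l = begin
    next (next (next x))                  ≡⟨ cong (λ y → next (next y)) (refl {x = enc v w}) ⟩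
    next (next (enc v w))                 ≡⟨ cong next (next-enc v w) ⟩
    next (enc w (ρ w v))                  ≡⟨ cong (λ k → next (enc w k)) (triangles l) ⟩
    next (enc w u)                        ≡⟨ next-enc w u ⟩
    enc u (ρ u w)                         ≡⟨ cong (enc u) (trans (cong (λ k → ρ k w) (sym (triangles l))) (triangles (ρ-adj v u (adj-symm l)))) ⟩
    enc u v                               ≡⟨ enc-pair x ⟩
    x ∎
    where
    open ≡-Reasoning
    u = fst x
    v = snd x
    w = ρ v u
    next-enc : ∀ a b → next (enc a b) ≡ enc b (ρ b a)
    next-enc a b = cong₂ enc (snd-enc a b) (cong₂ ρ (snd-enc a b) (fst-enc a b))

  next-≢ : ∀ {x} → dart x ≡ true → next x ≢ x
  next-≢ l e = adj-≢ l (trans (cong fst (sym e)) (fst-enc _ _))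

  next²-≢ : ∀ {x} → dart x ≡ true → next (next x) ≢ x
  next²-≢ l e = next-≢ l (trans (cong next (sym e)) (next³ l))

  orbit : ∀ k {x} → dart x ≡ true → let y = iter next k x in y ≡ x ⊎ y ≡ next x ⊎ y ≡ next (next x)
  orbit zero l = inj₁ refl
  orbit (suc k) l with orbit k l
  ... | inj₁ e = inj₂ (inj₁ (cong next e))
  ... | inj₂ (inj₁ e) = inj₂ (inj₂ (cong next e))
  ... | inj₂ (inj₂ e) = inj₁ (trans (cong next e) (next³ l))

  faces≤ : 3 * # isFace ≤ # dart
  faces≤ = ≤-trans (Bounds.face-weight shape 3 (λ _ → 1) three)
                   (≤-reflexive (∑-cong (λ x → *-identityʳ _)))
    where
    three : ∀ {x} → dart x ≡ true → ∃ λ xs → Unique xs × All (λ y → dart y ≡ true × face y ≡ face x) xs × 3 ≤ sum (map (λ _ → 1) xs)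
    three {x} l = x ∷ next x ∷ next (next x) ∷ [] ,
      ((λ e → next-≢ l (sym e)) ∷ (λ e → next²-≢ l (sym e)) ∷ []) ∷ ((λ e → next-≢ (dart-next l) (sym e)) ∷ []) ∷ [] ∷ [] ,
      (l , refl) ∷ (dart-next l , face-next l) ∷ (dart-next (dart-next l) , trans (face-next (dart-next l)) (face-next l)) ∷ [] , ≤-refl

  -- Since `next` has order three on darts, a dart is one of the three on the cycle of its
  -- representative.
  faces≥ : # dart ≤ 3 * # isFace
  faces≥ = begin
    # dart                                                                             ≤⟨ ∑-mono cover ⟩
    ∑ (λ x → ∑ (λ l → ⟦ isFace l ⟧ * hits l x))                                        ≡⟨ ∑-comm _ ⟩
    ∑ (λ l → ∑ (λ x → ⟦ isFace l ⟧ * hits l x))                                        ≤⟨ ∑-mono (λ l → ≤-trans (≤-reflexive (sym (*-distribˡ-∑ ⟦ isFace l ⟧ _))) (*-monoʳ-≤ ⟦ isFace l ⟧ (three l))) ⟩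
    ∑ (λ l → ⟦ isFace l ⟧ * 3)                                                         ≡⟨ trans (∑-cong (λ l → *-comm ⟦ isFace l ⟧ 3)) (sym (*-distribˡ-∑ 3 _)) ⟩
    3 * # isFace ∎
    where
    open ≤-Reasoning
    hits : Fin ((3 + N) * (3 + N)) → Fin ((3 + N) * (3 + N)) → ℕ
    hits l x = δ l x + (δ (next l) x + δ (next (next l)) x)
    three : ∀ l → ∑ (hits l) ≤ 3
    three l = ≤-trans (≤-reflexive (trans (∑-distrib-+ _ _) (cong (∑ (δ l) +_) (∑-distrib-+ _ _)))) (+-mono-≤ (one l) (+-mono-≤ (one (next l)) (one (next (next l)))))
      where
      one : ∀ l → ∑ (δ l) ≤ 1
      one l = ≤-reflexive (∑-δ l)
    hit : ∀ {x l} → dart x ≡ true → (l ≡ x ⊎ l ≡ next x ⊎ l ≡ next (next x)) → 1 ≤ hits l x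
    hit {x} l (inj₁ refl) = ≤-trans (≤-reflexive (sym (δ-refl x))) (m≤m+n _ _)
    hit {x} l (inj₂ (inj₁ refl)) = ≤-trans (≤-trans (≤-reflexive (sym (trans (cong (λ y → δ y x) (next³ l)) (δ-refl x)))) (m≤n+m _ (δ (next (next x)) x))) (m≤n+m _ (δ (next x) x))
    hit {x} l (inj₂ (inj₂ refl)) = ≤-trans (≤-trans (≤-reflexive (sym (trans (cong (λ y → δ y x) (next³ l)) (δ-refl x)))) (m≤m+n _ (δ (next (next (next (next x)))) x))) (m≤n+m _ (δ (next (next x)) x))
    cover : ∀ x → ⟦ dart x ⟧ ≤ ∑ (λ l → ⟦ isFace l ⟧ * hits l x)
    cover x with dart x in lx
    ... | false = z≤n
    ... | true = ≤-trans (≤-trans (hit lx at-face) (≤-reflexive (sym (trans (cong (λ b → ⟦ b ⟧ * hits (face x) x) (isFace-face lx)) (*-identityˡ _))))) (term≤∑ (λ l → ⟦ isFace l ⟧ * hits l x) (face x))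
      where
      at-face : face x ≡ x ⊎ face x ≡ next x ⊎ face x ≡ next (next x)
      at-face with Least.index (face-least lx)
      ... | k , e with orbit k lx
      ...   | inj₁ q = inj₁ (trans (sym e) q)
      ...   | inj₂ (inj₁ q) = inj₂ (inj₁ (trans (sym e) q))
      ...   | inj₂ (inj₂ q) = inj₂ (inj₂ (trans (sym e) q))

  reach-self : ∀ k u → reachIn Γ k u u ≡ true
  reach-self zero u = dec-true (u ≟ u) refl
  reach-self (suc k) u = cong (_∨ any (λ w → reachIn Γ k u w ∧ adj Γ w u) (allFin _)) (reach-self k u)

  hop : ∀ {k u v w} → reachIn Γ k u v ≡ true → v ≡ w ⊎ adj Γ v w ≡ true → reachIn Γ (suc k) u w ≡ true
  hop {k} {u} {v} r (inj₁ refl) = cong (_∨ any (λ x → reachIn Γ k u x ∧ adj Γ x v) (allFin _)) r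
  hop {k} {u} {v} {w} r (inj₂ a) = trans (cong (reachIn Γ k u w ∨_) (any-intro (λ x → reachIn Γ k u x ∧ adj Γ x w) (∈-allFin v) (∧-intro r a))) (∨-zeroʳ _)

  from-apex : ∀ u → apex ≡ u ⊎ adj Γ apex u ≡ true
  from-apex u with u ≟ apex
  ... | yes e = inj₁ (sym e)
  ... | no ne = inj₂ (apex-adj ne)

  to-apex : ∀ u → u ≡ apex ⊎ adj Γ u apex ≡ true
  to-apex u with from-apex u
  ... | inj₁ e = inj₁ (sym e)
  ... | inj₂ a = inj₂ (adj-symm a)

  -- Two hops by way of the apex suffice; a hop may stay in place, which covers the cases where an
  -- end is the apex.
  connected : ∀ u v → reach Γ u v ≡ true
  connected u v = hop {suc (suc N)} (hop {suc N} (reach-self (suc N) u) (to-apex u)) (from-apex v)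

  any-none : ∀ {A : Set} (q : A → Bool) xs → (∀ x → q x ≡ false) → any q xs ≡ false
  any-none q [] h = refl
  any-none q (x ∷ xs) h rewrite h x = any-none q xs h

  one-component : components Γ ≡ 1
  one-component = trans (sym #isRoot) (trans (∑-suc _) (cong₂ _+_ (cong (⟦_⟧ ∘ not) least) (∑-zero (λ u → cong (⟦_⟧ ∘ not) (not-least u)))))
    where
    least : any (λ v → reach Γ zero v ∧ (toℕ v <ᵇ 0)) (allFin (3 + N)) ≡ false
    least = any-none _ (allFin (3 + N)) (λ v → trans (cong (reach Γ zero v ∧_) (none (toℕ v))) (∧-zeroʳ _))
      where
      none : ∀ k → (k <ᵇ 0) ≡ false
      none zero = refl
      none (suc k) = refl
    not-least : ∀ u → any (λ v → reach Γ (suc u) v ∧ (toℕ v <ᵇ suc (toℕ u))) (allFin (3 + N)) ≡ true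
    not-least u = any-intro (λ v → reach Γ (suc u) v ∧ (toℕ v <ᵇ suc (toℕ u))) (∈-allFin zero) (∧-intro (connected (suc u) zero) refl)

  no-isolated : isolated Γ ≡ 0
  no-isolated = trans (sym #isolated) (∑-zero (λ u → cong (⟦_⟧ ∘ not) (lively u)))
    where
    lively : ∀ u → lv u ≡ true
    lively u with u ≟ apex
    ... | no ne = lv-intro (adj-symm (apex-adj ne))
    ... | yes refl with u ≟ zero
    ...   | no ne = lv-intro {v = zero} (apex-adj (λ e → ne (sym e)))
    ...   | yes refl = lv-intro {v = suc zero} (apex-adj λ ())

  triangulation-planar : Planar Γ
  triangulation-planar = ρ , rotation , euler-count {3 + N} {numFaces Γ ρ} (trans (cong (_+ 12) #darts) size)
      (trans (cong (3 *_) (sym #isFace)) (trans (≤-antisym faces≤ faces≥) #dart)) no-isolated one-component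
    where
    #darts : darts Γ ≡ ∑ (λ u → ∑ (λ v → ⟦ adj Γ u v ⟧))
    #darts = trans (sum-allFin _) (∑-cong (λ u → sum-allFin _))

-- The lower bound

-- New vertices enter as `zero` and shift the older ones; counting from the other end gives each
-- vertex a date of insertion that later insertions do not change.
time : ∀ {N} → Fin N → ℕ
time {suc N} zero = N
time (suc u) = time u

time< : ∀ {N} (u : Fin N) → time u < N
time< zero = ≤-refl
time< (suc u) = ≤-trans (time< u) (n≤1+n _)

time-injective : ∀ {N} {u v : Fin N} → time u ≡ time v → u ≡ v
time-injective {u = zero} {zero} e = refl
time-injective {u = zero} {suc v} e = contradiction (time< v) (<-irrefl (sym e))
time-injective {u = suc u} {zero} e = contradiction (time< u) (<-irrefl e)
time-injective {u = suc u} {suc v} e = cong suc (time-injective e)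

-- Besides the apex there are p hubs; hub i has p paths of three leaves each, leaf i j κ
-- being the κ-th vertex of path j.
data Role : Set where
  hub  : ℕ → Role
  leaf : ℕ → ℕ → Fin 3 → Role

group : Role → ℕ
group (hub i) = i
group (leaf i _ _) = i

module Roles (p : ℕ) (p>0 : 0 < p) where

  branch : ∀ {A : Set} → Dec A → Role → Role → Role
  branch (yes _) r _ = r
  branch (no _) _ r = r

  after : Role → Role
  after (hub i) = leaf i 0 zero
  after (leaf i j zero) = leaf i j (suc zero)
  after (leaf i j (suc zero)) = leaf i j (suc (suc zero))
  after (leaf i j (suc (suc zero))) = branch (suc j <? p) (leaf i (suc j) zero) (hub (suc i))

  role : ℕ → Role
  role zero = hub 0
  role (suc s) = after (role s)

  Valid : Role → Set
  Valid (hub i) = 0 < p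
  Valid (leaf i j κ) = j < p

  -- The position in the order of insertion: a group occupies `1 + p * 3` places, its hub followed
  -- by its leaves. The vertex of time `suc s` plays `role s`, time 0 being the apex.
  index : Role → ℕ
  index (hub i) = i * (1 + p * 3)
  index (leaf i j κ) = i * (1 + p * 3) + (1 + (j * 3 + toℕ κ))

  after-valid : ∀ r → Valid r → Valid (after r) × index (after r) ≡ suc (index r)
  after-valid (hub i) v = v , trans (+-comm _ 1) refl
  after-valid (leaf i j zero) v = v , trans (cong (λ k → i * (1 + p * 3) + suc k) (+-suc (j * 3) 0)) (+-suc (i * (1 + p * 3)) _)
  after-valid (leaf i j (suc zero)) v = v , trans (cong (λ k → i * (1 + p * 3) + suc k) (+-suc (j * 3) 1)) (+-suc (i * (1 + p * 3)) _)
  after-valid (leaf i j (suc (suc zero))) v with suc j <? p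
  ... | yes lt = lt , solve 2 (λ a j → a :+ (con 1 :+ ((con 1 :+ j) :* con 3 :+ con 0)) := con 1 :+ (a :+ (con 1 :+ (j :* con 3 :+ con 2)))) refl (i * (1 + p * 3)) j
  ... | no ge = p>0 , trans (cong (λ q → (1 + q * 3) + i * (1 + p * 3)) (≤-antisym (≮⇒≥ ge) v))
      (solve 2 (λ a j → (con 1 :+ (con 1 :+ j) :* con 3) :+ a := con 1 :+ (a :+ (con 1 :+ (j :* con 3 :+ con 2)))) refl (i * (1 + p * 3)) j)

  role-valid : ∀ s → Valid (role s) × index (role s) ≡ s
  role-valid zero = p>0 , refl
  role-valid (suc s) with after-valid (role s) (proj₁ (role-valid s))
  ... | v , e = v , trans e (cong suc (proj₂ (role-valid s)))

  role-injective : ∀ {s s'} → role s ≡ role s' → s ≡ s'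
  role-injective {s} {s'} e = trans (sym (proj₂ (role-valid s))) (trans (cong index e) (proj₂ (role-valid s')))

  index-at : ∀ {s r} → role s ≡ r → s ≡ index r
  index-at {s} e = trans (sym (proj₂ (role-valid s))) (cong index e)

  group*≤ : ∀ r → group r * (1 + p * 3) ≤ index r
  group*≤ (hub i) = ≤-refl
  group*≤ (leaf i j κ) = m≤m+n _ _

  group< : ∀ {s} → s < p * (1 + p * 3) → group (role s) < p
  group< {s} lt = *-cancelʳ-< (1 + p * 3) (group (role s)) p (≤-trans (s≤s (≤-trans (group*≤ (role s)) (≤-reflexive (proj₂ (role-valid s))))) lt)

  IsLeaf : Role → Set
  IsLeaf r = ∃ λ i → ∃ λ j → ∃ λ κ → r ≡ leaf i j κ

  after-group : ∀ r {i j κ} → after r ≡ leaf i j κ → group r ≡ i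
  after-group (hub i) refl = refl
  after-group (leaf i j zero) refl = refl
  after-group (leaf i j (suc zero)) refl = refl
  after-group (leaf i j (suc (suc zero))) e with suc j <? p | e
  ... | yes _ | refl = refl

  after-leaf : ∀ r {i j κ} → after r ≡ leaf i j (suc κ) → IsLeaf r
  after-leaf (leaf i j κ) e = i , j , κ , refl
  after-leaf (hub i) ()

  -- Vertices are inserted in the order of their roles, always into a face containing the
  -- apex, the current hub and the last leaf.
  record Family (t : ℕ) : Set where
    field
      T : Triangulation (3 + t)
    open Triangulation T public
    apex : Fin (3 + t)
    apex = corner (suc (suc zero))
    current : Fin (3 + t)
    current = corner (suc zero)
    last : Fin (3 + t)
    last = corner zero
    field
      apex-time : time apex ≡ 0
      apex-adj  : ∀ {u} → u ≢ apex → adj Γ apex u ≡ true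
      at-hub    : ∃ λ s → time current ≡ suc s × role s ≡ hub (group (role (suc t)))
      at-last   : IsLeaf (role (suc t)) → time last ≡ 2 + t
      hub-adj   : ∀ {u s i j κ} → time u ≡ suc s → role s ≡ leaf i j κ →
                  ∃ λ h → ∃ λ s' → time h ≡ suc s' × role s' ≡ hub i × adj Γ u h ≡ true
      path-adj  : ∀ {u s i j κ} → time u ≡ suc (suc s) → role (suc s) ≡ leaf i j (suc κ) →
                  ∃ λ v → time v ≡ suc s × adj Γ u v ≡ true

  -- From oldest to youngest, the three vertices are the apex, the first hub and its first leaf.
  base : Family 0
  base = record
    { T = triangle ; apex-time = refl ; apex-adj = a-adj ; at-hub = 0 , refl , refl ; at-last = λ _ → refl
    ; hub-adj = λ {u} → h-adj u ; path-adj = λ {u} → p-adj u }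
    where
    a-adj : ∀ {u} → u ≢ suc (suc zero) → not (does (suc (suc (zero {0})) ≟ u)) ≡ true
    a-adj {zero} _ = refl
    a-adj {suc zero} _ = refl
    a-adj {suc (suc zero)} ne = contradiction refl ne
    h-adj : ∀ u {s i j κ} → time u ≡ suc s → role s ≡ leaf i j κ →
            ∃ λ h → ∃ λ s' → time h ≡ suc s' × role s' ≡ hub i × not (does (u ≟ h)) ≡ true
    h-adj zero {suc zero} refl refl = suc zero , 0 , refl , refl , refl
    h-adj (suc zero) {zero} refl ()
    h-adj (suc (suc zero)) ()
    p-adj : ∀ u {s i j κ} → time u ≡ suc (suc s) → role (suc s) ≡ leaf i j (suc κ) →
            ∃ λ v → time v ≡ suc s × not (does (u ≟ v)) ≡ true
    p-adj zero {zero} refl ()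
    p-adj (suc zero) ()
    p-adj (suc (suc zero)) ()

  module _ {t : ℕ} (F : Family t) where
    open Family F
    open Insert T using (adj⁺)

    hub-adj⁺ : ∀ {u s i j κ} → time u ≡ suc s → role s ≡ leaf i j κ →
               ∃ λ h → ∃ λ s' → time h ≡ suc s' × role s' ≡ hub i × adj⁺ u h ≡ true
    hub-adj⁺ {zero} refl e with at-hub
    ... | s' , e₁ , e₂ = suc current , s' , e₁ , trans e₂ (cong hub (after-group (role (suc t)) e)) , image-intro corner (suc zero)
    hub-adj⁺ {suc u} e r with hub-adj e r
    ... | h , s' , e₁ , e₂ , a = suc h , s' , e₁ , e₂ , a

    path-adj⁺ : ∀ {u s i j κ} → time u ≡ suc (suc s) → role (suc s) ≡ leaf i j (suc κ) →
                ∃ λ v → time v ≡ suc s × adj⁺ u v ≡ true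
    path-adj⁺ {zero} refl e = suc last , at-last (after-leaf (role (suc t)) e) , image-intro corner zero
    path-adj⁺ {suc u} e r with path-adj e r
    ... | v , e₁ , a = suc v , e₁ , a

    apex-adj⁺ : ∀ {u} → u ≢ suc apex → adj⁺ (suc apex) u ≡ true
    apex-adj⁺ {zero} _ = image-intro corner (suc (suc zero))
    apex-adj⁺ {suc u} ne = apex-adj (λ e → ne (cong suc e))

    -- A new leaf replaces the last leaf in the distinguished face and a new hub replaces the
    -- current hub, so the apex remains a corner throughout. Further edges arising between groups do
    -- no harm: adjacency and separation can only become more frequent.
    extend : Family (suc t)
    extend with after (role (suc t)) in e
    ... | leaf i j κ = record
        { T = Insert.insert T zero ; apex-time = apex-time ; apex-adj = apex-adj⁺
        ; at-hub = proj₁ at-hub , proj₁ (proj₂ at-hub) ,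
                   trans (proj₂ (proj₂ at-hub)) (cong hub (trans (after-group (role (suc t)) e) (sym (cong group e))))
        ; at-last = λ _ → refl ; hub-adj = λ {u} → hub-adj⁺ {u} ; path-adj = λ {u} → path-adj⁺ {u} }
    ... | hub i = record
        { T = Insert.insert T (suc zero) ; apex-time = apex-time ; apex-adj = apex-adj⁺
        ; at-hub = 2 + t , refl , trans e (cong hub (sym (cong group e)))
        ; at-last = λ { (_ , _ , _ , e') → contradiction (trans (sym e) e') λ () }
        ; hub-adj = λ {u} → hub-adj⁺ {u} ; path-adj = λ {u} → path-adj⁺ {u} }

  family : ∀ t → Family t
  family zero = base
  family (suc t) = extend (family t)

module Colouring (m n : ℕ) (two : 2 ≤ 2 * m + n) {t : ℕ} (order : 3 + t ≡ 1 + (2 * m + n) * (1 + (2 * m + n) * 3)) where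
  open Labels m n

  p = 2 * m + n

  p>0 : 0 < p
  p>0 = ≤-trans (s≤s z≤n) two

  open Roles p p>0
  open Family (family t) hiding (adj-symm)

  adj-symm : ∀ {u v} → adj Γ u v ≡ true → adj Γ v u ≡ true
  adj-symm = Triangulation.adj-symm T

  enc : ℕ → Lab m n
  enc c with c <? p
  ... | yes lt = fromFin (fromℕ< lt)
  -- A default for totality; the numbers that matter are groups, paths, 0 and 1, all below `p`.
  ... | no _ = fromFin (fromℕ< p>0)

  enc-injective : ∀ {a b} → a < p → b < p → enc a ≡ enc b → a ≡ b
  enc-injective {a} {b} a< b< e with a <? p | b <? p
  ... | yes a<′ | yes b<′ = fromℕ<-injective a b a<′ b<′ (fromFin-injective e)
  ... | no ge | _ = contradiction a< ge
  ... | _ | no ge = contradiction b< ge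

  -- The label into a middle leaf is flipped so that the middle sees the earlier end under `enc 0`
  -- and the later end under `enc 1`. This is where two different labels are needed.
  roleLabel : Role → Role → Lab m n
  roleLabel (hub _) (leaf _ j _) = enc j
  roleLabel (leaf _ _ _) (leaf _ _ (suc zero)) = flipLab (enc 0)
  roleLabel _ _ = enc 1

  -- The label from the earlier to the later vertex.
  label : ℕ → ℕ → Lab m n
  label zero (suc s) = enc (group (role s))
  label (suc s) (suc s') = roleLabel (role s) (role s')
  label _ zero = enc 0

  directed : Fin (3 + t) → Fin (3 + t) → Lab m n
  directed u v = if time u <ᵇ time v then label (time u) (time v) else flipLab (label (time v) (time u))

  <ᵇ-true : ∀ {a b} → a < b → (a <ᵇ b) ≡ true
  <ᵇ-true {a} {b} lt = dec-true (a <? b) lt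

  <ᵇ-false : ∀ {a b} → ¬ a < b → (a <ᵇ b) ≡ false
  <ᵇ-false {a} {b} ge = dec-false (a <? b) ge

  directed-flip : ∀ {u v} → u ≢ v → directed v u ≡ flipLab (directed u v)
  directed-flip {u} {v} ne with <-cmp (time u) (time v)
  ... | tri< lt _ gt rewrite <ᵇ-true lt | <ᵇ-false gt = refl
  ... | tri≈ _ e _ = contradiction (time-injective e) ne
  ... | tri> lt _ gt rewrite <ᵇ-true gt | <ᵇ-false lt = sym (flip-involutive _)

  G : MixedGraph m n (3 + t)
  G = record { lab = λ u v → if adj Γ u v then just (directed u v) else nothing ; loopless = none ; labSym = symm }
    where
    none : ∀ u → (if adj Γ u u then just (directed u u) else nothing) ≡ nothing
    none u rewrite irrefl Γ u = refl
    symm : ∀ u v → (if adj Γ v u then just (directed v u) else nothing) ≡ Maybe.map flipLab (if adj Γ u v then just (directed u v) else nothing)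
    symm u v rewrite Graph.sym Γ v u with adj Γ u v in a
    ... | true = cong just (directed-flip (adj-≢ a))
    ... | false = refl

  underlying : HasUnderlying G Γ
  underlying u v with adj Γ u v
  ... | true = refl
  ... | false = refl

  Separated : Fin (3 + t) → Fin (3 + t) → Set
  Separated u v = ∃ λ w → ∃ λ a → ∃ λ b → a ≢ b × lab G w u ≡ just a × lab G w v ≡ just b

  down : ∀ {u v} → adj Γ u v ≡ true → time u < time v → lab G u v ≡ just (label (time u) (time v))
  down a lt rewrite a | <ᵇ-true lt = refl

  up : ∀ {u v} → adj Γ u v ≡ true → time v < time u → lab G u v ≡ just (flipLab (label (time v) (time u)))
  up a lt rewrite a | <ᵇ-false (<-asym lt) = refl

  Linked′ : Fin (3 + t) → Fin (3 + t) → Set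
  Linked′ u v = adj Γ u v ≡ true ⊎ Separated u v

  swap : ∀ {u v} → Linked′ u v → Linked′ v u
  swap (inj₁ a) = inj₁ (adj-symm a)
  swap (inj₂ (w , a , b , a≢b , e , e')) = inj₂ (w , b , a , (λ q → a≢b (sym q)) , e' , e)

  s< : ∀ {u : Fin (3 + t)} {s} → time u ≡ suc s → s < p * (1 + p * 3)
  s< {u} e = ≤-pred (≤-trans (≤-trans (s≤s (≤-reflexive (sym e))) (time< u)) (≤-reflexive order))

  apex-label : ∀ {u s} → time u ≡ suc s → lab G apex u ≡ just (enc (group (role s)))
  apex-label {u} {s} e = trans (down (apex-adj (λ { refl → contradiction (trans (sym e) apex-time) λ () })) (≤-trans (s≤s (≤-reflexive apex-time)) (≤-trans (s≤s z≤n) (≤-reflexive (sym e)))))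
    (cong just (cong₂ label apex-time e))

  same-vertex : ∀ {u v : Fin (3 + t)} {s s'} → time u ≡ suc s → time v ≡ suc s' → role s ≡ role s' → u ≡ v
  same-vertex e e' r = time-injective (trans e (trans (cong suc (role-injective r)) (sym e')))

  hub-label : ∀ {u h s s' i j κ} → time u ≡ suc s → role s ≡ leaf i j κ → time h ≡ suc s' → role s' ≡ hub i → adj Γ u h ≡ true →
              lab G h u ≡ just (enc j)
  hub-label {u} {h} {s} {s'} {i} {j} {κ} eu ru eh rh a = trans (down (adj-symm a) earlier) (cong just (trans (cong₂ label eh eu) (cong₂ roleLabel rh ru)))
    where
    earlier : time h < time u
    earlier = begin-strict
      time h                                   ≡⟨ eh ⟩
      suc s'                                   ≡⟨ cong suc (index-at rh) ⟩
      suc (i * (1 + p * 3))                    <⟨ s≤s (m<m+n (i * (1 + p * 3)) (s≤s z≤n)) ⟩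
      suc (i * (1 + p * 3) + (1 + (j * 3 + toℕ κ)))  ≡⟨ cong suc (index-at ru) ⟨
      suc s                                    ≡⟨ eu ⟨
      time u ∎
      where open ≤-Reasoning

  leaf-index : ∀ {s i j} {κ κ' : Fin 3} → toℕ κ' ≡ suc (toℕ κ) → role (suc s) ≡ leaf i j κ' → s ≡ index (leaf i j κ)
  leaf-index {s} {i} {j} {κ} {κ'} q r = +-cancelˡ-≡ 1 _ _ (trans (index-at r) (trans (cong (λ k → i * (1 + p * 3) + (1 + (j * 3 + k))) q)
    (trans (cong (λ k → i * (1 + p * 3) + (1 + k)) (+-suc (j * 3) (toℕ κ))) (+-suc (i * (1 + p * 3)) _))))

  consecutive : ∀ {u v s s' i j κ κ'} → toℕ (suc κ') ≡ suc (toℕ κ) → time u ≡ suc s → role s ≡ leaf i j κ →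
                time v ≡ suc s' → role s' ≡ leaf i j (suc κ') → adj Γ v u ≡ true
  consecutive {s' = zero} q eu ru ev ()
  consecutive {u} {v} {s} {suc s'} {κ = κ} q eu ru ev rv with path-adj ev rv
  ... | x , ex , a = subst (λ y → adj Γ v y ≡ true) (time-injective (trans ex (trans (cong suc (trans (leaf-index {κ = κ} q rv) (sym (index-at ru)))) (sym eu)))) a

  ends : ∀ {u v s s' i j} → time u ≡ suc s → role s ≡ leaf i j zero → time v ≡ suc s' → role s' ≡ leaf i j (suc (suc zero)) → Linked′ u v
  ends {s' = zero} eu ru ev ()
  ends {u} {v} {s} {suc s'} {i} {j} eu ru ev rv with path-adj ev rv
  ... | x , ex , vx = inj₂ (x , enc 0 , enc 1 , (λ e → contradiction (enc-injective p>0 two e) λ ()) , to-u , to-v)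
    where
    rx : role s' ≡ leaf i j (suc zero)
    rx = middle (role s') rv
      where
      middle : ∀ r → after r ≡ leaf i j (suc (suc zero)) → r ≡ leaf i j (suc zero)
      middle (hub _) ()
      middle (leaf _ _ zero) ()
      middle (leaf _ _ (suc zero)) refl = refl
      middle (leaf _ k (suc (suc zero))) e with suc k <? p | e
      ... | yes _ | ()
      ... | no _ | ()
    xu : adj Γ x u ≡ true
    xu = consecutive {κ = zero} refl eu ru ex rx
    sx : s' ≡ suc s
    sx = trans (index-at rx) (trans (cong (λ k → i * (1 + p * 3) + (1 + k)) (+-suc (j * 3) 0)) (trans (+-suc (i * (1 + p * 3)) _) (cong suc (sym (index-at ru)))))
    to-u : lab G x u ≡ just (enc 0)
    to-u = trans (up xu (≤-reflexive (trans (cong suc eu) (trans (cong suc (sym sx)) (sym ex)))))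
      (cong just (trans (cong flipLab (trans (cong₂ label eu ex) (cong₂ roleLabel ru rx))) (flip-involutive _)))
    to-v : lab G x v ≡ just (enc 1)
    to-v = trans (down (adj-symm vx) (≤-reflexive (trans (cong suc ex) (sym ev)))) (cong just (trans (cong₂ label ex ev) (cong₂ roleLabel rx rv)))

  same-group : ∀ {u v s s'} → u ≢ v → time u ≡ suc s → time v ≡ suc s' → group (role s) ≡ group (role s') → Linked′ u v
  same-group {u} {v} {s} {s'} u≢v eu ev g with role s in ru | role s' in rv
  ... | hub i | hub i' = contradiction (same-vertex eu ev (trans ru (trans (cong hub g) (sym rv)))) u≢v
  ... | leaf i j κ | hub i' with hub-adj eu ru
  ...   | h , s'' , eh , rh , a = inj₁ (subst (λ x → adj Γ u x ≡ true) (same-vertex eh ev (trans rh (trans (cong hub g) (sym rv)))) a)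
  same-group u≢v eu ev g | hub i | leaf i' j' κ' with hub-adj ev rv
  ...   | h , s'' , eh , rh , a = inj₁ (adj-symm (subst (λ x → adj Γ _ x ≡ true) (same-vertex eh eu (trans rh (trans (cong hub (sym g)) (sym ru)))) a))
  same-group {u} {v} {s} {s'} u≢v eu ev refl | leaf i j κ | leaf i' j' κ' with j ≟ℕ j'
  ... | no j≢j' with hub-adj eu ru | hub-adj ev rv
  ...   | h , s₁ , eh , rh , a | h' , s₂ , eh' , rh' , a' =
    inj₂ (h , enc j , enc j' , (λ e → j≢j' (enc-injective (valid {s} ru) (valid {s'} rv) e)) , hub-label eu ru eh rh a ,
      hub-label ev rv eh rh (subst (λ x → adj Γ v x ≡ true) (same-vertex eh' eh (trans rh' (sym rh))) a'))
    where
    valid : ∀ {s i j κ} → role s ≡ leaf i j κ → j < p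
    valid {s} r = subst Valid r (proj₁ (role-valid s))
  same-group {u} {v} {s} {s'} u≢v eu ev refl | leaf i j κ | leaf i' j' κ' | yes refl = cases κ κ' ru rv
    where
    cases : ∀ κ κ' → role s ≡ leaf i j κ → role s' ≡ leaf i j κ' → Linked′ u v
    cases zero zero ru rv = contradiction (same-vertex eu ev (trans ru (sym rv))) u≢v
    cases (suc zero) (suc zero) ru rv = contradiction (same-vertex eu ev (trans ru (sym rv))) u≢v
    cases (suc (suc zero)) (suc (suc zero)) ru rv = contradiction (same-vertex eu ev (trans ru (sym rv))) u≢v
    cases zero (suc zero) ru rv = inj₁ (adj-symm (consecutive {κ = zero} refl eu ru ev rv))
    cases (suc zero) zero ru rv = inj₁ (consecutive {κ = zero} refl ev rv eu ru)
    cases (suc zero) (suc (suc zero)) ru rv = inj₁ (adj-symm (consecutive {κ = suc zero} refl eu ru ev rv))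
    cases (suc (suc zero)) (suc zero) ru rv = inj₁ (consecutive {κ = suc zero} refl ev rv eu ru)
    cases zero (suc (suc zero)) ru rv = ends eu ru ev rv
    cases (suc (suc zero)) zero ru rv = swap (ends ev rv eu ru)

  first? : ∀ (u : Fin (3 + t)) → time u ≡ 0 ⊎ ∃ λ s → time u ≡ suc s
  first? u with time u
  ... | zero = inj₁ refl
  ... | suc s = inj₂ (s , refl)

  linked : ∀ {u v} → u ≢ v → Linked′ u v
  linked {u} {v} u≢v with first? u | first? v
  ... | inj₁ eu | _ = inj₁ (subst (λ x → adj Γ x v ≡ true) (sym u≡apex) (apex-adj (λ e → u≢v (trans u≡apex (sym e)))))
    where
    u≡apex : u ≡ apex
    u≡apex = time-injective (trans eu (sym apex-time))
  ... | inj₂ _ | inj₁ ev = inj₁ (adj-symm (subst (λ x → adj Γ x u ≡ true) (sym v≡apex) (apex-adj (λ e → u≢v (trans e (sym v≡apex))))))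
    where
    v≡apex : v ≡ apex
    v≡apex = time-injective (trans ev (sym apex-time))
  ... | inj₂ (s , eu) | inj₂ (s' , ev) with group (role s) ≟ℕ group (role s')
  ...   | yes g = same-group u≢v eu ev g
  ...   | no ne = inj₂ (apex , _ , _ , (λ e → ne (enc-injective (group< (s< {u} eu)) (group< (s< {v} ev)) e)) , apex-label eu , apex-label ev)

  -- A map to fewer vertices identifies two of them. Adjacent vertices would produce a loop, and
  -- separated ones two labels on a single pair.
  clique : IsClique G
  clique K lt H (f , hom) with pigeonhole lt f
  ... | u , v , u<v , e with linked {u} {v} (λ { refl → <-irrefl refl u<v })
  ...   | inj₁ a with lab G u v in l | underlying u v
  ...     | just x | _ = contradiction (trans (sym (hom u v x l)) (trans (cong (lab H (f u)) (sym e)) (Defs.loopless H (f u)))) λ ()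
  ...     | nothing | q = true≢false a q
  clique K lt H (f , hom) | u , v , u<v , e | inj₂ (w , a , b , a≢b , ea , eb) =
    a≢b (just-injective (trans (sym (hom w u a ea)) (trans (cong (lab H (f w)) e) (hom w v b eb))))

  planar : Planar Γ
  planar = triangulation-planar T apex-adj

construction : ∀ m n → 2 ≤ 2 * m + n →
  Σ ℕ λ N → Σ (Graph N) λ Γ → Planar Γ × ωa≥ m n Γ (3 * (2 * m + n) ^ 2 + (2 * m + n) + 1)
construction m n two with m≤n⇒∃[o]m+o≡n large
  where
  large : 3 ≤ 1 + (2 * m + n) * (1 + (2 * m + n) * 3)
  large = s≤s (≤-trans two (m≤m*n (2 * m + n) (1 + (2 * m + n) * 3)))
... | t , order = 3 + t , _ , C.planar , C.G , C.underlying , 3 + t ,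
    record { sub = C.G ; ι = λ i → i ; inj = λ e → e ; pres = λ _ _ _ e → e } , C.clique ,
    ≤-reflexive (trans (solve 1 (λ p → con 3 :* (p :* (p :* con 1)) :+ p :+ con 1 := con 1 :+ p :* (con 1 :+ p :* con 3)) refl (2 * m + n)) (sym order))
  where
  module C = Colouring m n two order

lower-bound : ∀ m n → ¬ (m ≡ 0 × n ≡ 1) →
  Σ ℕ λ N → Σ (Graph N) λ Γ → Planar Γ × ωa≥ m n Γ (3 * (2 * m + n) ^ 2 + (2 * m + n) + 1)
-- Without labels the bound is 1, and a single vertex attains it.
lower-bound zero zero _ = 1 , point , ((λ _ v → v) , ((λ _ _ ()) , (λ _ _ _ ()) , (λ _ _ _ ())) , refl) ,
  G , (λ _ _ → refl) , 1 , record { sub = G ; ι = λ i → i ; inj = λ e → e ; pres = λ _ _ _ e → e } , clique , ≤-refl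
  where
  point : Graph 1
  point = record { adj = λ _ _ → false ; irrefl = λ _ → refl ; sym = λ _ _ → refl }
  G : MixedGraph 0 0 1
  G = record { lab = λ _ _ → nothing ; loopless = λ _ → refl ; labSym = λ _ _ → refl }
  clique : IsClique G
  clique zero _ H (f , _) with f zero
  ... | ()
  clique (suc K) (s≤s ()) H _
lower-bound zero (suc zero) excluded = contradiction (refl , refl) excluded
lower-bound zero (suc (suc n)) _ = construction 0 (2 + n) (s≤s (s≤s z≤n))
lower-bound (suc m) n _ = construction (suc m) n (≤-trans (*-monoʳ-≤ 2 (s≤s z≤n)) (m≤m+n (2 * suc m) n))

theorem3 : (m n : ℕ) → ¬ (m ≡ 0 × n ≡ 1) →
    (Σ ℕ λ N → Σ (Graph N) λ Γ → Planar Γ ×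
    ωa≥ m n Γ (3 * (2 * m + n) ^ 2 + (2 * m + n) + 1)) ×
    ((N : ℕ) → (Γ : Graph N) → Planar Γ →
    ωa≤ m n Γ (9 * (2 * m + n) ^ 2 + 2 * (2 * m + n) + 2))
theorem3 m n excluded = lower-bound m n excluded , upper-bound m n excluded
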